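{- Let $S$ be a sparse family of boolean databases, and let $\rho\in\{\mathrm{cnf},\mathrm{gain}_\theta,\mathrm{laplace}_h\}$, where $\theta$ is a fixed rational with $0<\theta\le 1$ and $h\ge 2$ is a fixed natural. The decision problem $\langle I,T,\rho,k,s\rangle$, restricted to inputs in which $T\in S$ is a database on the attribute set $I$, $1\le k\le |I|$ is a natural and $0<s\le 1$ is a rational, is in L (deterministic logarithmic space).
   Context: An attribute is an identifier $A$ with a domain $\mathrm{dom}(A)$. The domain of a categorical attribute is an unordered set of values; that of a numeric attribute is a set of integers or rationals; both kinds of domain also include a special null value $\epsilon$. An attribute $A$ is boolean if $\mathrm{dom}(A)=\{\epsilon,c(A)\}$ for a constant $c(A)$. A database $T$ on a finite attribute set $I$ is a relation with duplicates (a finite multiset of tuples) having attribute set $I$; $t[A]$ is the value of $A$ in tuple $t$, and $|t|=|\{A\in I: t[A]\neq\epsilon\}|$. $T$ is boolean if every attribute in $I$ is boolean. A family $S$ of boolean databases is sparse if, for $T\in S$ defined on $I$, the largest tuple size $\max_{t\in T}|t|$ is $\mathcal{O}(\log|I|)$. An atomic condition on a categorical attribute $A$ is $A=u$ or $A\neq u$ with $u\in \mathrm{dom}(A)\setminus\{\epsilon\}$; on a numeric attribute $A$ it is $A\in[l,u]$ or $A\notin[l,u]$ with numeric values $l\le u$ not necessarily distinct ($A=u$, $A\ne u$ abbreviate the case $[u,u]$). A tuple $t$ satisfies an atomic condition on $A$ iff $t[A]\neq\epsilon$ and $t[A]$ fulfils the stated relation (so a null value satisfies no condition). A condition is a conjunction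 $C=C_1\wedge\dots\wedge C_n$ of atomic conditions on distinct attributes; its size is $|C|=n$; $t$ satisfies $C$ iff it satisfies every $C_i$; $T_C$ is the (multi)set of tuples of $T$ satisfying $C$, with $|T_C|$ counted with duplicates. An association rule on $I$ is $B\Rightarrow H$ with $B,H$ conditions on attribute sets $I_B,I_H$ with $\emptyset\subset I_B,I_H\subset I$ and $I_B\cap I_H=\emptyset$; its size is $|B\Rightarrow H|=|B|+|H|$. It is trivial (w.r.t. $T$) if $B\wedge H$ contains at least one atomic condition $C_a$ with $T_{C_a}=T$. Indices: confidence $\mathrm{cnf}(B\Rightarrow H,T)=|T_{B\wedge H}|/|T_B|$, taken to be $0$ when $|T_B|=0$; $\theta$-gain $\mathrm{gain}_\theta(B\Rightarrow H,T)=\frac{|T_{B\wedge H}|-\theta|T_B|}{|T|}$; $h$-laplace $\mathrm{laplace}_h(B\Rightarrow H,T)=\frac{|T_{B\wedge H}|+1}{|T_B|+h}$. The problem $\langle I,T,\rho,k,s\rangle$ for an index $\rho$ asks: is there a non-trivial association rule $R$ on $I$ with $|R|\ge k$ and $\rho(R,T)\ge s$? -}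

module Defs where

open import Data.Bool.Base using (Bool; true; false)
import Data.Bool.Properties as Bool
open import Data.Fin.Base using (Fin)
import Data.Fin.Properties as Fin
open import Data.Fin.Subset using (Subset; Nonempty; Empty; _∩_; ∣_∣)
open import Data.Integer.Base as ℤ using (ℤ; +_; -[1+_])
open import Data.List.Base
  using (List; []; _∷_; _++_; map; concatMap; filter; length; allFin)
open import Data.List.Extrema.Nat using (max)
open import Data.List.Membership.Propositional using (_∈_)
import Data.List.Properties as List
open import Data.List.Relation.Binary.Permutation.Propositional using (_↭_)
open import Data.Digit using (toDigits)
open import Data.Maybe.Base using (Maybe; just; nothing; is-just; _<∣>_)
import Data.Maybe.Relation.Unary.All as Maybe
open import Data.Nat.Base as ℕ using (ℕ; zero; suc)
open import Data.Nat.Logarithm using (⌊log₂_⌋)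
open import Data.Product.Base using (Σ; ∃; ∃-syntax; _×_; _,_; proj₁; proj₂)
open import Data.Rational.Base as ℚ using (ℚ; 0ℚ; 1ℚ; _/_; ↥_; ↧ₙ_)
import Data.Rational.Properties as ℚ
open import Data.Sum.Base using (_⊎_; inj₁; inj₂)
open import Data.Vec.Base as Vec using (Vec)
open import Function.Bundles using (_⇔_; _↔_)
open import Function.Definitions using (Injective)
open import Level using (Level; 0ℓ) renaming (suc to lsuc; _⊔_ to _⊔ˡ_)
open import Relation.Binary.PropositionalEquality using (_≡_)
open import Relation.Nullary.Decidable using (Dec; no; map′; _×-dec_; ¬?)
open import Relation.Nullary.Negation using (¬_)
open import Relation.Unary using (Pred; _⊆_)

-- f = O(log g), as g tends to infinity.
O-log : ∀ {a} {X : Set a} → (X → ℕ) → (X → ℕ) → Set a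
O-log f g = ∃[ c ] ∃[ n₀ ] ∀ x → n₀ ℕ.≤ g x → f x ℕ.≤ c ℕ.* ⌊log₂ g x ⌋

IsFinite : Set → Set
IsFinite A = ∃[ n ] (A ↔ Fin n)

data Delimited (A : Set) : Set where
  ⊢ ⊣ : Delimited A
  sym : A → Delimited A

data Move : Set where
  left stay right : Move

-- A machine over the input alphabet A with a two-way read-only input
-- tape and a fixed number of read/write work tapes.  A transition
-- either halts, with verdict true for acceptance and false for
-- rejection, or gives the next state, the move of the input head, and
-- the symbol written and the move made on each work tape.
record Machine (A : Set) : Set₁ where
  field
    State         : Set
    WorkSymbol    : Set
    state-finite  : IsFinite State
    symbol-finite : IsFinite WorkSymbol
    tapes         : ℕ
    start         : State
    blank         : WorkSymbol
    δ             : State → Delimited A → Vec WorkSymbol tapes →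
                    Bool ⊎ (State × Move × Vec (WorkSymbol × Move) tapes)

-- The cells left of the head are listed starting from the head.
record Tape (A : Set) : Set where
  constructor tape
  field
    before : List A
    head   : A
    after  : List A

cells : ∀ {A} → Tape A → ℕ
cells (tape ls _ rs) = length ls ℕ.+ suc (length rs)

-- The input head does not leave the delimited input.
moveInput : ∀ {A} → Move → Tape A → Tape A
moveInput left  (tape (l ∷ ls) x rs) = tape ls l (x ∷ rs)
moveInput right (tape ls x (r ∷ rs)) = tape (x ∷ ls) r rs
moveInput _     t                    = t

-- Work tapes are unbounded in both directions; a cell is added to the
-- list representing the tape when it is first visited.
moveWork : ∀ {A} → A → Move → Tape A → Tape A
moveWork b left  (tape []       x rs)       = tape [] b (x ∷ rs)
moveWork b left  (tape (l ∷ ls) x rs)       = tape ls l (x ∷ rs)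
moveWork b stay  t                          = t
moveWork b right (tape ls       x [])       = tape (x ∷ ls) b []
moveWork b right (tape ls       x (r ∷ rs)) = tape (x ∷ ls) r rs

write : ∀ {A} → A → Tape A → Tape A
write y (tape ls _ rs) = tape ls y rs

inputTape : ∀ {A} → List A → Tape (Delimited A)
inputTape w = tape [] ⊢ (map sym w ++ ⊣ ∷ [])

module _ {A : Set} (M : Machine A) where
  open Machine M

  record Config : Set where
    constructor config
    field
      state : State
      input : Tape (Delimited A)
      work  : Vec (Tape WorkSymbol) tapes

  initial : List A → Config
  initial w = config start (inputTape w) (Vec.replicate tapes (tape [] blank []))

  -- The number of work-tape cells visited so far; the input tape is
  -- not counted.
  space : Config → ℕ
  space (config _ _ ts) = Vec.sum (Vec.map cells ts)

  step : Config → Bool ⊎ Config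
  step (config q i ts) with δ q (Tape.head i) (Vec.map Tape.head ts)
  ... | inj₁ verdict       = inj₁ verdict
  ... | inj₂ (q′ , m , as) =
    inj₂ (config q′ (moveInput m i)
                 (Vec.zipWith (λ (y , d) t → moveWork blank d (write y t)) as ts))

  -- The computation starting from c halts with verdict b, and all its
  -- configurations use at most n work-tape cells.
  data HaltsWithin (n : ℕ) (b : Bool) (c : Config) : Set where
    halt : space c ℕ.≤ n → step c ≡ inj₁ b → HaltsWithin n b c
    next : ∀ {c′} → space c ℕ.≤ n → step c ≡ inj₂ c′ →
           HaltsWithin n b c′ → HaltsWithin n b c

record DecisionProblem (A : Set) (a : Level) : Set (lsuc a) where
  field
    Instance : Set a
    encode   : Instance → List A
    Yes      : Instance → Set

-- The space bound and the correctness of the answer are required on the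
-- (encodings of) instances of the problem, so that a problem restricted
-- to a set of instances is treated as a promise problem.
InL : ∀ {A a} → DecisionProblem A a → Set (lsuc 0ℓ ⊔ˡ a)
InL {A} P = Σ (Machine A) λ M → ∃[ s ]
  (O-log s (λ x → length (encode x)) ×
   ∀ x → ∃[ b ] (HaltsWithin M (s x) b (initial M (encode x)) ×
                 (b ≡ true ⇔ Yes x)))
  where open DecisionProblem P

-- Attribute identifiers and categorical values.
Word : Set
Word = List Bool

data Kind : Set where
  categorical numeric : Kind

Value : Kind → Set
Value categorical = Word
Value numeric     = ℚ

-- Every domain also contains the null value: Dom gives the non-null
-- values only.
record Attribute : Set₁ where
  field
    name : Word
    kind : Kind
    Dom  : Pred (Value kind) 0ℓ
open Attribute public

BooleanAttribute : Attribute → Set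
BooleanAttribute A = ∃[ c ] ∀ v → Dom A v ⇔ v ≡ c

record AttributeSet : Set₁ where
  field
    size      : ℕ
    attribute : Fin size → Attribute
    distinct  : Injective _≡_ _≡_ (λ i → name (attribute i))
open AttributeSet public

-- The null value is represented by nothing.
Cell : Attribute → Set
Cell A = Maybe (Value (kind A))

Tuple : AttributeSet → Set
Tuple I = (i : Fin (size I)) → Cell (attribute I i)

-- A multiset of tuples is represented by a list, up to permutation.
record Database : Set₁ where
  field
    attributes : AttributeSet
    tuples     : List (Tuple attributes)
    in-domain  : ∀ {t} → t ∈ tuples → ∀ i → Maybe.All (Dom (attribute attributes i)) (t i)
open Database public

support : ∀ {n} {F : Fin n → Set} → ((i : Fin n) → Maybe (F i)) → Subset n
support f = Vec.tabulate (λ i → is-just (f i))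

tupleSize : (I : AttributeSet) → Tuple I → ℕ
tupleSize I t = ∣ support t ∣

maxTupleSize : Database → ℕ
maxTupleSize T = max 0 (map (tupleSize (attributes T)) (tuples T))

Boolean : Pred Database 0ℓ
Boolean T = ∀ i → BooleanAttribute (attribute (attributes T) i)

Sparse : ∀ {ℓ} → Pred Database ℓ → Set (lsuc 0ℓ ⊔ˡ ℓ)
Sparse S = O-log {X = Σ Database S} (λ (T , _) → maxTupleSize T)
                                    (λ (T , _) → size (attributes T))

data CategoricalAtom (D : Pred Word 0ℓ) : Set where
  equal notEqual : ∀ u → D u → CategoricalAtom D

-- The interval [ l , u ]; its bounds need not belong to the domain.
data NumericAtom : Set where
  inside outside : ∀ l u → l ℚ.≤ u → NumericAtom

AtomOn : (k : Kind) → Pred (Value k) 0ℓ → Set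
AtomOn categorical D = CategoricalAtom D
AtomOn numeric     _ = NumericAtom

Fulfils : ∀ k {D} → AtomOn k D → Pred (Value k) 0ℓ
Fulfils categorical (equal u _)     v = v ≡ u
Fulfils categorical (notEqual u _)  v = ¬ v ≡ u
Fulfils numeric     (inside l u _)  v = l ℚ.≤ v × v ℚ.≤ u
Fulfils numeric     (outside l u _) v = ¬ (l ℚ.≤ v × v ℚ.≤ u)

fulfils? : ∀ k {D} (a : AtomOn k D) v → Dec (Fulfils k {D} a v)
fulfils? categorical (equal u _)     v = List.≡-dec Bool._≟_ v u
fulfils? categorical (notEqual u _)  v = ¬? (List.≡-dec Bool._≟_ v u)
fulfils? numeric     (inside l u _)  v = l ℚ.≤? v ×-dec v ℚ.≤? u
fulfils? numeric     (outside l u _) v = ¬? (l ℚ.≤? v ×-dec v ℚ.≤? u)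

Atom : Attribute → Set
Atom A = AtomOn (kind A) (Dom A)

-- A null value satisfies no atomic condition.
data SatisfiesAtom (A : Attribute) (a : Atom A) : Cell A → Set where
  satisfies : ∀ {v} → Fulfils (kind A) {Dom A} a v → SatisfiesAtom A a (just v)

satisfiesAtom? : ∀ A (a : Atom A) (x : Cell A) → Dec (SatisfiesAtom A a x)
satisfiesAtom? A a nothing  = no λ ()
satisfiesAtom? A a (just v) =
  map′ satisfies (λ { (satisfies p) → p }) (fulfils? (kind A) {Dom A} a v)

-- A conjunction of atomic conditions on distinct attributes: at most
-- one for each attribute.
Condition : AttributeSet → Set
Condition I = (i : Fin (size I)) → Maybe (Atom (attribute I i))

Satisfies : (I : AttributeSet) → Condition I → Tuple I → Set
Satisfies I C t = ∀ i → Maybe.All (λ a → SatisfiesAtom (attribute I i) a (t i)) (C i)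

satisfies? : ∀ I (C : Condition I) (t : Tuple I) → Dec (Satisfies I C t)
satisfies? I C t =
  Fin.all? λ i → Maybe.dec (λ a → satisfiesAtom? (attribute I i) a (t i)) (C i)

module _ (T : Database) where
  private I = attributes T

  selectAtom : ∀ i → Atom (attribute I i) → List (Tuple I)
  selectAtom i a = filter (λ t → satisfiesAtom? (attribute I i) a (t i)) (tuples T)

  select : Condition I → List (Tuple I)
  select C = filter (satisfies? I C) (tuples T)

-- Since the body and the head are on disjoint nonempty sets of
-- attributes, both sets are proper subsets of the attribute set.
record Rule (I : AttributeSet) : Set where
  field
    body head     : Condition I
    body-nonempty : Nonempty (support body)
    head-nonempty : Nonempty (support head)
    disjoint      : Empty (support body ∩ support head)

  body∧head : Condition I
  body∧head i = body i <∣> head i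

  ruleSize : ℕ
  ruleSize = ∣ support body ∣ ℕ.+ ∣ support head ∣
open Rule public

Trivial : (T : Database) → Rule (attributes T) → Set
Trivial T R = ∃[ i ] ∃[ a ] (body∧head R i ≡ just a × selectAtom T i a ↭ tuples T)

data Index : Set where
  cnf     : Index
  gain    : ∀ θ → 0ℚ ℚ.< θ → θ ℚ.≤ 1ℚ → Index
  laplace : ∀ h → 2 ℕ.≤ h → Index

fromℕ : ℕ → ℚ
fromℕ n = + n / 1

-- Division with value 0 for denominator 0.  For gain the denominator is
-- 0 only if the database is empty, and then all rules are trivial; for
-- laplace it is never 0.
_÷₀_ : ℚ → ℕ → ℚ
p ÷₀ zero  = 0ℚ
p ÷₀ suc n = p ℚ.* (+ 1 / suc n)

indexValue : Index → (T : Database) → Rule (attributes T) → ℚ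
indexValue ρ T R = value ρ
  where
  nBH = length (select T (body∧head R))
  nB  = length (select T (body R))
  n   = length (tuples T)
  value : Index → ℚ
  value cnf           = fromℕ nBH ÷₀ nB
  value (gain θ _ _)  = (fromℕ nBH ℚ.- θ ℚ.* fromℕ nB) ÷₀ n
  value (laplace h _) = fromℕ (nBH ℕ.+ 1) ÷₀ (nB ℕ.+ h)

-- An instance ⟨I,T,ρ,k,s⟩ with T in S; I is the attribute set of T, and
-- ρ is fixed.
record Input {ℓ} (S : Pred Database ℓ) : Set (lsuc 0ℓ ⊔ˡ ℓ) where
  field
    T   : Database
    T∈S : S T
    k   : ℕ
    s   : ℚ
    1≤k : 1 ℕ.≤ k
    k≤I : k ℕ.≤ size (attributes T)
    0<s : 0ℚ ℚ.< s
    s≤1 : s ℚ.≤ 1ℚ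

HasRule : Index → (T : Database) → ℕ → ℚ → Set
HasRule ρ T k s = Σ (Rule (attributes T)) λ R →
  ¬ Trivial T R × k ℕ.≤ ruleSize R × s ℚ.≤ indexValue ρ T R

data Symbol : Set where
  bit₀ bit₁ plus minus slash : Symbol
  attr# cat# num# row# cell# null# size# threshold# : Symbol

bit : Bool → Symbol
bit false = bit₀
bit true  = bit₁

digit : Fin 2 → Symbol
digit Fin.zero    = bit₀
digit (Fin.suc _) = bit₁

-- Binary, least significant bit first.
encodeℕ : ℕ → List Symbol
encodeℕ n = map digit (proj₁ (toDigits 2 n))

encodeℤ : ℤ → List Symbol
encodeℤ (+ n)      = plus ∷ encodeℕ n
encodeℤ (-[1+ n ]) = minus ∷ encodeℕ (suc n)

encodeℚ : ℚ → List Symbol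
encodeℚ q = encodeℤ (↥ q) ++ slash ∷ encodeℕ (↧ₙ q)

encodeValue : ∀ k → Value k → List Symbol
encodeValue categorical w = map bit w
encodeValue numeric     q = encodeℚ q

encodeKind : Kind → Symbol
encodeKind categorical = cat#
encodeKind numeric     = num#

encodeCell : ∀ A → Cell A → List Symbol
encodeCell A nothing  = cell# ∷ null# ∷ []
encodeCell A (just v) = cell# ∷ encodeValue (kind A) v

encodeTuple : ∀ I → Tuple I → List Symbol
encodeTuple I t =
  row# ∷ concatMap (λ i → encodeCell (attribute I i) (t i)) (allFin (size I))

-- The domain of a boolean attribute is given by its only non-null value.
encodeAttribute : ∀ A → BooleanAttribute A → List Symbol
encodeAttribute A (c , _) =
  attr# ∷ map bit (name A) ++ encodeKind (kind A) ∷ encodeValue (kind A) c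

encodeDatabase : (T : Database) → Boolean T → List Symbol
encodeDatabase T bool =
  concatMap (λ i → encodeAttribute (attribute I i) (bool i)) (allFin (size I)) ++
  concatMap (encodeTuple I) (tuples T)
  where I = attributes T

ruleProblem : ∀ {ℓ} (S : Pred Database ℓ) → S ⊆ Boolean → Index →
              DecisionProblem Symbol (lsuc 0ℓ ⊔ˡ ℓ)
ruleProblem S bool ρ = record
  { Instance = Input S
  ; encode   = λ x → let open Input x in
      encodeDatabase T (bool T∈S) ++
      size# ∷ encodeℕ k ++
      threshold# ∷ encodeℚ s
  ; Yes      = λ x → let open Input x in HasRule ρ T k s
  }

{-# OPTIONS --safe #-}

-- A rule that some tuple t satisfies is determined, up to the choice of
-- atoms with the same meaning, by t and a labelling of the attributes that
-- are not null in t as body, head or unused, since in a boolean database a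
-- satisfied atom only says that its attribute is not null.  By sparseness
-- the labelling is coded by a number that is polynomial in the length of
-- the input, so a search over all tuples and codes needs only counters of
-- logarithmic length.  As s > 0, a rule that no tuple satisfies is accepted
-- only by laplace h, and only if s <= 1/h; then a rule with unsatisfiable
-- atoms on all attributes will do, if there are two attributes and a tuple.
-- The numerator and the denominator of s are too long to be stored, but in a
-- comparison that reads them from the lowest bit on, the carries stay small.
--
-- The search is expressed by primitive recursive functions whose recursions
-- are cut off after Z steps, for a power Z of the input length.  This makes
-- all values polynomial in Z, so that a machine with one binary counter for
-- each intermediate value evaluates such a function in logarithmic space.
module Submission where

open import Defs renaming (sym to letter)
open import Data.Bool.Base using (Bool; true; false; if_then_else_; not; _∧_; _∨_) renaming (T to True)
import Data.Bool.Properties as Bool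
open import Data.Digit using (fromDigits; toDigits)
open import Data.Empty using (⊥)
open import Data.Fin.Base as Fin using (Fin; toℕ; fromℕ<)
import Data.Fin.Patterns as Fin
import Data.Fin.Properties as Fin
open import Data.Fin.Subset as Subset using (∣_∣)
open import Data.Fin.Subset.Properties using (x∈p∩q⁺; x∈p∩q⁻; ∣p∣≤n)
open import Data.Integer.Base as ℤ using (ℤ)
import Data.Integer.Properties as ℤ
import Data.Integer.Tactic.RingSolver as ℤ-Solver
open import Data.List.Base as List
  using (List; []; _∷_; _++_; _ʳ++_; map; replicate; length; drop; filter; concatMap; allFin)
open import Data.List.Extrema.Nat using (xs≤max)
open import Data.List.Membership.Propositional using (_∈_; find)
open import Data.List.Membership.Propositional.Properties using (∈-filter⁺; ∈-filter⁻; ∈-map⁺)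
import Data.List.Properties as List
open import Data.List.Relation.Binary.Permutation.Propositional using (↭-reflexive; ↭-sym)
open import Data.List.Relation.Binary.Permutation.Propositional.Properties using (∈-resp-↭)
open import Data.List.Relation.Binary.Pointwise.Base as Pointwise using (Pointwise; []; _∷_)
open import Data.List.Relation.Unary.All as All using (All; []; _∷_)
import Data.List.Relation.Unary.All.Properties as All
open import Data.List.Relation.Unary.Any using (here; there)
open import Data.Maybe.Base using (Maybe; just; nothing; is-just; maybe′)
import Data.Maybe.Relation.Unary.All as Maybe
open import Data.Nat.Base as ℕ
  using (ℕ; zero; suc; _+_; _*_; _^_; _≤_; _<_; z≤n; s≤s; _⊔_; _⊓_; _≡ᵇ_)
open import Data.Nat.DivMod using (_mod_; m<n⇒m%n≡m; m%n<n)
open import Data.Nat.Induction using (<-rec)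
open import Data.Nat.Logarithm
  using (⌊log₂_⌋; ⌊log₂⌋-mono-≤; ⌊log₂⌊n/2⌋⌋≡⌊log₂n⌋∸1; ⌊log₂[2^n]⌋≡n)
import Data.Nat.Properties as ℕ
open import Data.Nat.Tactic.RingSolver using (solve-∀)
open import Data.Product.Base using (∃; ∃-syntax; _×_; _,_; proj₁; proj₂)
open import Data.Rational.Base as ℚ using (ℚ; 0ℚ; mkℚ; toℚᵘ; ↥_; ↧ₙ_; _/_)
import Data.Rational.Properties as ℚ
open import Data.Rational.Unnormalised.Base as ℚᵘ using (mkℚᵘ)
import Data.Rational.Unnormalised.Properties as ℚᵘ
open import Data.Sum.Base using (_⊎_; inj₁; inj₂; [_,_]′)
open import Data.Sum.Function.Propositional using (_⊎-↔_)
open import Data.Unit.Base using (⊤; tt)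
open import Data.Vec.Base as Vec using (Vec; []; _∷_; lookup; _[_]≔_)
import Data.Vec.Properties as Vec
open import Data.Vec.Relation.Unary.All as VecAll using ([]; _∷_) renaming (All to VecAll)
import Data.Vec.Relation.Unary.All.Properties as VecAll
open import Function.Base using (id; _∘_)
open import Function.Bundles using (_⇔_; mk⇔; mk↔ₛ′; Equivalence)
open import Function.Construct.Composition using (_↔-∘_; _⇔-∘_)
open import Function.Construct.Identity using (⇔-id)
open import Function.Construct.Symmetry using (↔-sym)
open import Level using (Level)
open import Relation.Binary.PropositionalEquality
open import Relation.Nullary.Decidable
  using (Dec; yes; no; does; map′; toSum; _→-dec_; ¬?; dec-true; dec-false)
open import Relation.Nullary.Negation using (¬_; contradiction)
open import Relation.Unary using (Pred; _⊆_)

-- The space budget shapes the proof: a stored number may be polynomial in the input length and no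
-- more. Uncapped recursion could iterate doubling; with the cap an addition adds at most Z, so Z
-- rounds of it add at most the square of Z. The price is that a formula means what it should only
-- while its values stay below Z, and these side conditions fix the exponent of Z. Labels in base 3
-- are spent only on columns that are not null in the chosen tuple: a tuple of size c log |I| + n₀
-- has 3 ^ size codes, a power of the input length since 3 is below 2 ^ 2. The chosen tuple
-- certifies that each atom of the rule is satisfied by the only value of its column, so the counts
-- depend on the null pattern alone, and such an atom is trivial iff its column is nowhere null.
-- Without such a tuple, laplace has the value 1 / (|T_B| + h), largest for an unsatisfied body.
-- After clearing denominators all three indices become one linear inequality in the numerator and
-- the denominator of s with small coefficients, so a single comparison procedure serves them all,
-- and k as well.

-- Finiteness of state sets and tape alphabets

finite-⊤ : IsFinite ⊤
finite-⊤ = 1 , mk↔ₛ′ (λ _ → Fin.zero) (λ _ → tt) (λ { Fin.zero → refl ; (Fin.suc ()) }) (λ _ → refl)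

finite-⊎ : ∀ {A B} → IsFinite A → IsFinite B → IsFinite (A ⊎ B)
finite-⊎ (m , f) (n , g) = m ℕ.+ n , (↔-sym Fin.+↔⊎ ↔-∘ (f ⊎-↔ g))

finite-Maybe : ∀ {A} → IsFinite A → IsFinite (Maybe A)
finite-Maybe {A} (n , f) with finite-⊎ finite-⊤ (n , f)
... | m , g = m , (g ↔-∘ mk↔ₛ′ to from to∘from from∘to)
  where
  to : Maybe A → ⊤ ⊎ A
  to nothing  = inj₁ tt
  to (just x) = inj₂ x
  from : ⊤ ⊎ A → Maybe A
  from (inj₁ _) = nothing
  from (inj₂ x) = just x
  to∘from : ∀ x → to (from x) ≡ x
  to∘from (inj₁ _) = refl
  to∘from (inj₂ _) = refl
  from∘to : ∀ x → from (to x) ≡ x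
  from∘to nothing  = refl
  from∘to (just _) = refl

-- Structured programs

module Structured (A W : Set) (blank : W) (T : ℕ) where

  Heads Action Tapes Conf : Set
  Heads  = Vec W T
  Action = Move × Vec (W × Move) T
  Tapes  = Vec (Tape W) T
  Conf   = Tape (Delimited A) × Tapes

  moveTape : W × Move → Tape W → Tape W
  moveTape (y , d) t = moveWork blank d (write y t)

  perform : Action → Conf → Conf
  perform (m , as) (i , ts) = moveInput m i , Vec.zipWith moveTape as ts

  Observer : Set → Set
  Observer B = Delimited A → Heads → B

  observe : ∀ {B : Set} → Observer B → Conf → B
  observe f (i , ts) = f (Tape.head i) (Vec.map Tape.head ts)

  cellCount : Tapes → ℕ
  cellCount ts = Vec.sum (Vec.map cells ts)

  idle : Heads → Action
  idle ws = stay , Vec.map (_, stay) ws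

  idle-tapes : ∀ {n} (ts : Vec (Tape W) n) →
               Vec.zipWith moveTape (Vec.map (_, stay) (Vec.map Tape.head ts)) ts ≡ ts
  idle-tapes []       = refl
  idle-tapes (t ∷ ts) = cong (t ∷_) (idle-tapes ts)

  perform-idle : ∀ c → perform (observe (λ _ → idle) c) c ≡ c
  perform-idle (i , ts) = cong (i ,_) (idle-tapes ts)

  infixr 5 _⨾_
  data Prog : Set where
    act    : Observer Action → Prog
    _⨾_    : Prog → Prog → Prog
    branch : Observer Bool → Prog → Prog → Prog
    while  : Observer Bool → Prog → Prog

  module _ (n : ℕ) where
    -- Big-step and inductive, so an inhabitant also certifies termination. The space bound is asked
    -- exactly where the machine takes a step, before that step; sequencing has no step of its own.
    data Exec : Prog → Conf → Conf → Set where
      act       : ∀ {f c} → cellCount (proj₂ c) ℕ.≤ n → Exec (act f) c (perform (observe f c) c)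
      _⨾_       : ∀ {P Q c c′ c″} → Exec P c c′ → Exec Q c′ c″ → Exec (P ⨾ Q) c c″
      branch-t  : ∀ {b P Q c c′} → cellCount (proj₂ c) ℕ.≤ n → observe b c ≡ true →
                  Exec P c c′ → Exec (branch b P Q) c c′
      branch-f  : ∀ {b P Q c c′} → cellCount (proj₂ c) ℕ.≤ n → observe b c ≡ false →
                  Exec Q c c′ → Exec (branch b P Q) c c′
      while-end : ∀ {b P c} → cellCount (proj₂ c) ℕ.≤ n → observe b c ≡ false →
                  Exec (while b P) c c
      while-rep : ∀ {b P c c′ c″} → cellCount (proj₂ c) ℕ.≤ n → observe b c ≡ true →
                  Exec P c c′ → Exec (while b P) c′ c″ → Exec (while b P) c c″

  Point : Prog → Set
  Point (act f)        = ⊤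
  Point (P ⨾ Q)        = Point P ⊎ Point Q
  Point (branch b P Q) = ⊤ ⊎ (Point P ⊎ Point Q)
  Point (while b P)    = ⊤ ⊎ Point P

  finite-Point : ∀ P → IsFinite (Point P)
  finite-Point (act f)        = finite-⊤
  finite-Point (P ⨾ Q)        = finite-⊎ (finite-Point P) (finite-Point Q)
  finite-Point (branch b P Q) = finite-⊎ finite-⊤ (finite-⊎ (finite-Point P) (finite-Point Q))
  finite-Point (while b P)    = finite-⊎ finite-⊤ (finite-Point P)

  entry : ∀ P → Point P
  entry (act f)        = tt
  entry (P ⨾ Q)        = inj₁ (entry P)
  entry (branch b P Q) = inj₁ tt
  entry (while b P)    = inj₁ tt

  -- The successor nothing is the exit of the program.
  trans-at : ∀ P → Point P → Observer (Maybe (Point P) × Action)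
  redirect : ∀ {X Y : Set} → Maybe Y → (X → Y) → Maybe X × Action → Maybe Y × Action
  redirect y f (nothing , a) = y , a
  redirect y f (just x  , a) = just (f x) , a
  trans-at (act f)        tt              x ws = nothing , f x ws
  trans-at (P ⨾ Q)        (inj₁ p)        x ws = redirect (just (inj₂ (entry Q))) inj₁ (trans-at P p x ws)
  trans-at (P ⨾ Q)        (inj₂ q)        x ws = redirect nothing inj₂ (trans-at Q q x ws)
  trans-at (branch b P Q) (inj₁ tt)       x ws =
    just (inj₂ (if b x ws then inj₁ (entry P) else inj₂ (entry Q))) , idle ws
  trans-at (branch b P Q) (inj₂ (inj₁ p)) x ws = redirect nothing (inj₂ ∘ inj₁) (trans-at P p x ws)
  trans-at (branch b P Q) (inj₂ (inj₂ q)) x ws = redirect nothing (inj₂ ∘ inj₂) (trans-at Q q x ws)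
  trans-at (while b P)    (inj₁ tt)       x ws =
    (if b x ws then just (inj₂ (entry P)) else nothing) , idle ws
  trans-at (while b P)    (inj₂ p)        x ws = redirect (just (inj₁ tt)) inj₂ (trans-at P p x ws)

  module _ (n : ℕ) where
    data Steps (P : Prog) : Point P → Conf → Conf → Set where
      exit : ∀ {p c a} → cellCount (proj₂ c) ℕ.≤ n → observe (trans-at P p) c ≡ (nothing , a) →
             Steps P p c (perform a c)
      go   : ∀ {p p′ c c′ a} → cellCount (proj₂ c) ℕ.≤ n → observe (trans-at P p) c ≡ (just p′ , a) →
             Steps P p′ (perform a c) c′ → Steps P p c c′

    -- The transition table of the whole extends that of the part, so a run of the part is a run of
    -- the whole; here leaving the part means leaving the whole.
    embed-exit : ∀ {P Q} (f : Point P → Point Q) →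
                 (∀ p x ws → trans-at Q (f p) x ws ≡ redirect nothing f (trans-at P p x ws)) →
                 ∀ {p c c′} → Steps P p c c′ → Steps Q (f p) c c′
    embed-exit f h (exit s e)   = exit s (trans (h _ _ _) (cong (redirect nothing f) e))
    embed-exit f h (go s e r) = go s (trans (h _ _ _) (cong (redirect nothing f) e)) (embed-exit f h r)

    -- Here leaving the part is a jump to `q`, where the run continues.
    embed-goto : ∀ {P Q} (f : Point P → Point Q) (q : Point Q) →
                 (∀ p x ws → trans-at Q (f p) x ws ≡ redirect (just q) f (trans-at P p x ws)) →
                 ∀ {p c c′ c″} → Steps P p c c′ → Steps Q q c′ c″ → Steps Q (f p) c c″
    embed-goto f q h (exit s e)   k = go s (trans (h _ _ _) (cong (redirect (just q) f) e)) k
    embed-goto f q h (go s e r) k =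
      go s (trans (h _ _ _) (cong (redirect (just q) f) e)) (embed-goto f q h r k)

    -- A test costs a machine step, but it rewrites each scanned symbol by itself and moves no head.
    idle-step : ∀ {P p p′ c c′} → cellCount (proj₂ c) ℕ.≤ n →
                observe (trans-at P p) c ≡ (just p′ , observe (λ _ → idle) c) →
                Steps P p′ c c′ → Steps P p c c′
    idle-step {P} {p′ = p′} {c} {c′} s e r =
      go s e (subst (λ d → Steps P p′ d c′) (sym (perform-idle c)) r)

    idle-exit : ∀ {P p c} → cellCount (proj₂ c) ℕ.≤ n →
                observe (trans-at P p) c ≡ (nothing , observe (λ _ → idle) c) →
                Steps P p c c
    idle-exit {P} {p} {c} s e = subst (Steps P p c) (perform-idle c) (exit s e)

    exec⇒steps : ∀ {P c c′} → Exec n P c c′ → Steps P (entry P) c c′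
    exec⇒steps (act s)      = exit s refl
    exec⇒steps (_⨾_ {P} {Q} p q)      =
      embed-goto inj₁ _ (λ _ _ _ → refl) (exec⇒steps p)
        (embed-exit inj₂ (λ _ _ _ → refl) (exec⇒steps q))
    exec⇒steps (branch-t {b} {P} {Q} s e p) =
      idle-step s (cong (λ v → just (inj₂ (if v then inj₁ (entry P) else inj₂ (entry Q))) , _) e)
        (embed-exit (inj₂ ∘ inj₁) (λ _ _ _ → refl) (exec⇒steps p))
    exec⇒steps (branch-f {b} {P} {Q} s e p) =
      idle-step s (cong (λ v → just (inj₂ (if v then inj₁ (entry P) else inj₂ (entry Q))) , _) e)
        (embed-exit (inj₂ ∘ inj₂) (λ _ _ _ → refl) (exec⇒steps p))
    exec⇒steps (while-end {b} {P} s e) =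
      idle-exit s (cong (λ v → (if v then just (inj₂ (entry P)) else nothing) , _) e)
    exec⇒steps (while-rep {b} {P} s e p q) =
      idle-step s (cong (λ v → (if v then just (inj₂ (entry P)) else nothing) , _) e)
        (embed-goto inj₂ _ (λ _ _ _ → refl) (exec⇒steps p) (exec⇒steps q))

  -- The additional state `nothing` stands for the exit of the program; in it the verdict is read
  -- off the symbols under the heads.
  machine : IsFinite W → Prog → Observer Bool → Machine A
  machine fin P verdict = record
    { State         = Maybe (Point P)
    ; WorkSymbol    = W
    ; state-finite  = finite-Maybe (finite-Point P)
    ; symbol-finite = fin
    ; tapes         = T
    ; start         = just (entry P)
    ; blank         = blank
    ; δ             = λ { nothing  x ws → inj₁ (verdict x ws)
                        ; (just p) x ws → inj₂ (trans-at P p x ws) }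
    }

  module _ (fin : IsFinite W) (P : Prog) (verdict : Observer Bool) {n : ℕ} where
    private
      M = machine fin P verdict

    -- A run bounds the space only before each step, so the configuration in which the verdict is
    -- given needs a bound of its own.
    steps⇒halts : ∀ {p i ts c′} → Steps n P p (i , ts) c′ → cellCount (proj₂ c′) ℕ.≤ n →
                  HaltsWithin M n (observe verdict c′) (config (just p) i ts)
    steps⇒halts {p} {i} {ts} (exit {a = a} s e) s′ = next s eq (halt s′ refl)
      where
      eq : Defs.step M (config (just p) i ts) ≡
           inj₂ (config nothing (proj₁ (perform a (i , ts))) (proj₂ (perform a (i , ts))))
      eq rewrite e = refl
    steps⇒halts {p} {i} {ts} (go {p′ = p′} {a = a} s e r) s′ = next s eq (steps⇒halts r s′)
      where
      eq : Defs.step M (config (just p) i ts) ≡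
           inj₂ (config (just p′) (proj₁ (perform a (i , ts))) (proj₂ (perform a (i , ts))))
      eq rewrite e = refl

    machine-halts : ∀ w {c′} → Exec n P (inputTape w , Vec.replicate T (tape [] blank [])) c′ →
                    cellCount (proj₂ c′) ℕ.≤ n → HaltsWithin M n (observe verdict c′) (initial M w)
    machine-halts w e = steps⇒halts (exec⇒steps n e)

-- Binary counters

incr : List Bool → List Bool
incr []           = true ∷ []
incr (false ∷ bs) = true ∷ bs
incr (true ∷ bs)  = false ∷ incr bs

bits : ℕ → List Bool
bits zero    = []
bits (suc n) = incr (bits n)

fromBits : List Bool → ℕ
fromBits []           = 0
fromBits (false ∷ bs) = fromBits bs + fromBits bs
fromBits (true ∷ bs)  = suc (fromBits bs + fromBits bs)

fromBits-incr : ∀ bs → fromBits (incr bs) ≡ suc (fromBits bs)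
fromBits-incr []           = refl
fromBits-incr (false ∷ bs) = refl
fromBits-incr (true ∷ bs)  rewrite fromBits-incr bs = cong suc (ℕ.+-suc _ _)

fromBits-bits : ∀ n → fromBits (bits n) ≡ n
fromBits-bits zero    = refl
fromBits-bits (suc n) = trans (fromBits-incr (bits n)) (cong suc (fromBits-bits n))

bits-injective : ∀ {m n} → bits m ≡ bits n → m ≡ n
bits-injective {m} {n} e =
  trans (sym (fromBits-bits m)) (trans (cong fromBits e) (fromBits-bits n))

-- A numeral of v > 0 with top bit 1 satisfies 2 ^ length ≤ 2 v. The empty numeral of 0 violates
-- this by 1, hence the weaker hypothesis; one increment gives the sharp form.
2^length-incr : ∀ bs → 2 ^ length bs ≤ suc (fromBits bs + fromBits bs) →
                2 ^ length (incr bs) ≤ fromBits (incr bs) + fromBits (incr bs)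
2^length-incr []           h = s≤s (s≤s z≤n)
2^length-incr (false ∷ bs) h = ℕ.≤-trans h (ℕ.≤-trans (ℕ.n≤1+n _) (ℕ.≤-reflexive (cong suc (sym (ℕ.+-suc _ _)))))
2^length-incr (true ∷ bs)  h = begin
  2 ^ length (incr bs) + (2 ^ length (incr bs) + 0) ≡⟨ cong (2 ^ length (incr bs) +_) (ℕ.+-identityʳ _) ⟩
  2 ^ length (incr bs) + 2 ^ length (incr bs)       ≤⟨ ℕ.+-mono-≤ ih ih ⟩
  (f + f) + (f + f)                                 ∎
  where
  open ℕ.≤-Reasoning
  f = fromBits (incr bs)
  v = fromBits bs
  halve : ∀ a b → a + (a + 0) ≤ suc (suc (b + suc b)) → a ≤ suc b
  halve a b p = ℕ.≮⇒≥ λ q → ℕ.<-irrefl refl (begin-strict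
    a + (a + 0)               ≤⟨ p ⟩
    suc (suc (b + suc b))     <⟨ ℕ.n<1+n _ ⟩
    suc (suc (suc b + suc b)) ≡⟨ cong (suc ∘ suc) (sym (ℕ.+-suc b (suc b))) ⟩
    suc (suc b) + suc (suc b) ≤⟨ ℕ.+-mono-≤ q q ⟩
    a + a                     ≡⟨ cong (a +_) (sym (ℕ.+-identityʳ a)) ⟩
    a + (a + 0)               ∎)
  ih = 2^length-incr bs (halve _ _ h)

2^length-bits : ∀ n → 2 ^ length (bits n) ≤ suc (n + n)
2^length-bits zero    = s≤s z≤n
2^length-bits (suc n) = begin
  2 ^ length (incr (bits n))                          ≤⟨ 2^length-incr (bits n) (subst (λ v → 2 ^ length (bits n) ≤ suc (v + v)) (sym (fromBits-bits n)) (2^length-bits n)) ⟩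
  fromBits (bits (suc n)) + fromBits (bits (suc n))   ≡⟨ cong (λ v → v + v) (fromBits-bits (suc n)) ⟩
  suc n + suc n                                       ≤⟨ ℕ.n≤1+n _ ⟩
  suc (suc n + suc n)                                 ∎
  where open ℕ.≤-Reasoning

length-bits : ∀ {n e} → n < 2 ^ e → length (bits n) ≤ e
length-bits {n} {e} p = ℕ.≮⇒≥ λ q → ℕ.<-irrefl refl (begin-strict
  2 ^ suc e                 ≤⟨ ℕ.^-monoʳ-≤ 2 q ⟩
  2 ^ length (bits n)       ≤⟨ 2^length-bits n ⟩
  suc (n + n)               <⟨ s≤s (ℕ.≤-reflexive (sym (ℕ.+-suc n n))) ⟩
  suc n + suc n             ≤⟨ ℕ.+-mono-≤ p p ⟩
  2 ^ e + 2 ^ e             ≡⟨ cong (2 ^ e +_) (sym (ℕ.+-identityʳ _)) ⟩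
  2 ^ suc e                 ∎)
  where open ℕ.≤-Reasoning

Digit′ : Set
Digit′ = Maybe Bool

data Mark : Set where
  home : Mark
  dig  : Digit′ → Mark

finite-Mark : IsFinite Mark
finite-Mark with finite-⊎ finite-⊤ (finite-Maybe (finite-⊎ finite-⊤ finite-⊤))
... | n , f = n , (f ↔-∘ mk↔ₛ′ to from to∘from from∘to)
  where
  to : Mark → ⊤ ⊎ Maybe (⊤ ⊎ ⊤)
  to home               = inj₁ tt
  to (dig nothing)      = inj₂ nothing
  to (dig (just false)) = inj₂ (just (inj₁ tt))
  to (dig (just true))  = inj₂ (just (inj₂ tt))
  from : ⊤ ⊎ Maybe (⊤ ⊎ ⊤) → Mark
  from (inj₁ _)               = home
  from (inj₂ nothing)         = dig nothing
  from (inj₂ (just (inj₁ _))) = dig (just false)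
  from (inj₂ (just (inj₂ _))) = dig (just true)
  to∘from : ∀ x → to (from x) ≡ x
  to∘from (inj₁ _)               = refl
  to∘from (inj₂ nothing)         = refl
  to∘from (inj₂ (just (inj₁ _))) = refl
  to∘from (inj₂ (just (inj₂ _))) = refl
  from∘to : ∀ x → from (to x) ≡ x
  from∘to home               = refl
  from∘to (dig nothing)      = refl
  from∘to (dig (just false)) = refl
  from∘to (dig (just true))  = refl

blanks : ℕ → List Digit′
blanks e = replicate e nothing

-- A counter is a tape with its head at the home mark, followed by the
-- digits and the blanks left over from larger values.
numTape : List Digit′ → Tape Mark
numTape ds = tape [] home (map dig ds)

-- The first list holds the digits left of the head, nearest first, the second those from the head
-- on. If the latter is empty, the head is on a blank cell just added to the tape.
cursor : List Digit′ → List Digit′ → Tape Mark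
cursor xs []       = tape (map dig xs ++ home ∷ []) (dig nothing) []
cursor xs (y ∷ ys) = tape (map dig xs ++ home ∷ []) (dig y) (map dig ys)

-- A head that went one cell too far has made that cell part of the tape.
pad : List Digit′ → List Digit′
pad []       = nothing ∷ []
pad (d ∷ ds) = d ∷ ds

isOneMark notHome isBitMark : Mark → Bool
isOneMark (dig (just b)) = b
isOneMark _              = false
notHome home    = false
notHome (dig _) = true
isBitMark (dig (just _)) = true
isBitMark _              = false

sameBit bothBlank : Mark → Mark → Bool
sameBit (dig (just false)) (dig (just false)) = true
sameBit (dig (just true))  (dig (just true))  = true
sameBit _ _ = false
bothBlank (dig nothing) (dig nothing) = true
bothBlank _ _ = false

-- Programs for a single tape

stepTape : (Mark → Mark × Move) → Tape Mark → Tape Mark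
stepTape f t = moveWork (dig nothing) (proj₂ (f (Tape.head t))) (write (proj₁ (f (Tape.head t))) t)

infixr 5 _∙_
data Local : Set where
  once : (Mark → Mark × Move) → Local
  loop : (Mark → Bool) → (Mark → Mark × Move) → Local
  _∙_  : Local → Local → Local

infix 3 _⊩_⇝_
data _⊩_⇝_ : Local → Tape Mark → Tape Mark → Set where
  once     : ∀ {f t} → once f ⊩ t ⇝ stepTape f t
  loop-end : ∀ {p f t} → p (Tape.head t) ≡ false → loop p f ⊩ t ⇝ t
  loop-rep : ∀ {p f t t′} → p (Tape.head t) ≡ true → loop p f ⊩ stepTape f t ⇝ t′ →
             loop p f ⊩ t ⇝ t′
  _∙_      : ∀ {P Q t t′ t″} → P ⊩ t ⇝ t′ → Q ⊩ t′ ⇝ t″ → P ∙ Q ⊩ t ⇝ t″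

cells-moveWork : ∀ d y (t : Tape Mark) → cells t ≤ cells (moveWork (dig nothing) d (write y t))
cells-moveWork left  y (tape []       x rs)       = ℕ.n≤1+n _
cells-moveWork left  y (tape (l ∷ ls) x rs)       = ℕ.≤-reflexive (sym (ℕ.+-suc _ _))
cells-moveWork stay  y (tape ls x rs)             = ℕ.≤-refl
cells-moveWork right y (tape ls       x [])       = ℕ.n≤1+n _
cells-moveWork right y (tape ls       x (r ∷ rs)) = ℕ.≤-reflexive (ℕ.+-suc _ _)

-- Visited cells are never given up; a bound for the last tape of a run therefore covers all tapes
-- in between.
cells-mono : ∀ {P t t′} → P ⊩ t ⇝ t′ → cells t ≤ cells t′
cells-mono (once {f} {t}) = cells-moveWork (proj₂ (f (Tape.head t))) (proj₁ (f (Tape.head t))) t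
cells-mono (loop-end _)   = ℕ.≤-refl
cells-mono (loop-rep {f = f} {t} _ r) = ℕ.≤-trans (cells-moveWork (proj₂ (f (Tape.head t))) (proj₁ (f (Tape.head t))) t) (cells-mono r)
cells-mono (p ∙ q)        = ℕ.≤-trans (cells-mono p) (cells-mono q)

goHome increment erase : Local
goHome = loop notHome (λ w → w , left)
increment = once (λ w → w , right)
          ∙ loop isOneMark (λ _ → dig (just false) , right)
          ∙ once (λ _ → dig (just true) , stay)
          ∙ goHome
erase = once (λ w → w , right) ∙ loop isBitMark (λ _ → dig nothing , right) ∙ goHome

enter : ∀ ds → once (λ w → w , right) ⊩ numTape ds ⇝ cursor [] ds
enter []       = once
enter (d ∷ ds) = once

goHome-run : ∀ xs ds → goHome ⊩ cursor xs ds ⇝ numTape (xs ʳ++ pad ds)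
goHome-run []       []       = loop-rep refl (loop-end refl)
goHome-run []       (d ∷ ds) = loop-rep refl (loop-end refl)
goHome-run (x ∷ xs) []       = loop-rep refl (goHome-run xs (x ∷ nothing ∷ []))
goHome-run (x ∷ xs) (d ∷ ds) = loop-rep refl (goHome-run xs (x ∷ d ∷ ds))

move-right : ∀ f xs d ds {z} → f (dig d) ≡ (dig z , right) →
             stepTape f (cursor xs (d ∷ ds)) ≡ cursor (z ∷ xs) ds
move-right f xs d []      e rewrite e = refl
move-right f xs d (_ ∷ _) e rewrite e = refl

setOne : List Digit′ → List Digit′
setOne []       = just true ∷ []
setOne (_ ∷ ds) = just true ∷ ds

incDigits : List Digit′ → List Digit′
incDigits (just true ∷ ds) = just false ∷ incDigits ds
incDigits ds               = setOne ds

-- The carry stops at the first cell that is not a 1, which `xs′` and `ds′` describe; the equation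
-- says that writing a 1 there completes the increment.
carry-run : ∀ xs ds → ∃[ xs′ ] ∃[ ds′ ]
            (loop isOneMark (λ _ → dig (just false) , right) ⊩ cursor xs ds ⇝ cursor xs′ ds′ ×
             xs′ ʳ++ setOne ds′ ≡ xs ʳ++ incDigits ds)
carry-run xs []                = xs , [] , loop-end refl , refl
carry-run xs (nothing ∷ ds)    = xs , nothing ∷ ds , loop-end refl , refl
carry-run xs (just false ∷ ds) = xs , just false ∷ ds , loop-end refl , refl
carry-run xs (just true ∷ ds) with carry-run (just false ∷ xs) ds
... | xs′ , ds′ , r , e =
  xs′ , ds′ , loop-rep refl (subst (loop isOneMark _ ⊩_⇝ _) (sym (move-right (λ _ → dig (just false) , right) xs (just true) ds refl)) r) , e

increment-run : ∀ ds → increment ⊩ numTape ds ⇝ numTape (incDigits ds)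
increment-run ds with carry-run [] ds
... | xs , ds′ , r , e = enter ds ∙ r ∙ finish ds′ e
  where
  finish : ∀ ds′ → xs ʳ++ setOne ds′ ≡ incDigits ds →
           once (λ _ → dig (just true) , stay) ∙ goHome ⊩ cursor xs ds′ ⇝ numTape (incDigits ds)
  finish []       e = once ∙ subst (λ v → goHome ⊩ _ ⇝ numTape v) e (goHome-run xs (just true ∷ []))
  finish (d ∷ ds) e = once ∙ subst (λ v → goHome ⊩ _ ⇝ numTape v) e (goHome-run xs (just true ∷ ds))

content : List Bool → ℕ → List Digit′
content bs e = map just bs ++ blanks e

-- A carry out of the top bit uses up a leftover blank if there is one, so the tape grows only if
-- the numeral itself has no other room.
incDigits-content : ∀ {L} bs e → length bs + e ≤ L → length (incr bs) ≤ L →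
                    ∃[ e′ ] (incDigits (content bs e) ≡ content (incr bs) e′ ×
                             length (incr bs) + e′ ≤ L)
incDigits-content []           zero    p q = 0 , refl , ℕ.≤-trans (ℕ.≤-reflexive (ℕ.+-identityʳ _)) q
incDigits-content []           (suc e) p q = e , refl , p
incDigits-content (false ∷ bs) e       p q = e , refl , p
incDigits-content (true ∷ bs)  e (s≤s p) (s≤s q) with incDigits-content bs e p q
... | e′ , r , s = e′ , cong (just false ∷_) r , s≤s s

-- The end of a numeral is recognised by a blank behind it. If none is left over, one cell is added,
-- whence the maximum with 1.
pad-blanks : ∀ e → ∃[ e′ ] (pad (blanks e) ≡ blanks e′ × e′ ≤ e ⊔ 1)
pad-blanks zero    = 1 , refl , ℕ.≤-refl
pad-blanks (suc e) = suc e , refl , ℕ.m≤m⊔n (suc e) 1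

erase-run′ : ∀ bs e xs → ∃[ xs′ ] ∃[ ds′ ] ∃[ e′ ]
             (loop isBitMark (λ _ → dig nothing , right) ⊩ cursor xs (content bs e) ⇝ cursor xs′ ds′ ×
              xs′ ʳ++ pad ds′ ≡ xs ʳ++ blanks (length bs + e′) × e′ ≤ e ⊔ 1)
erase-run′ []       e xs with pad-blanks e
... | e′ , p , q = xs , blanks e , e′ , loop-end (stop e) , cong (xs ʳ++_) p , q
  where
  stop : ∀ e → isBitMark (Tape.head (cursor xs (blanks e))) ≡ false
  stop zero    = refl
  stop (suc e) = refl
erase-run′ (b ∷ bs) e xs with erase-run′ bs e (nothing ∷ xs)
... | xs′ , ds′ , e′ , r , p , q =
  xs′ , ds′ , e′ , loop-rep refl (subst (loop isBitMark _ ⊩_⇝ _) (sym (move-right (λ _ → dig nothing , right) xs (just b) (content bs e) refl)) r) , p , q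

erase-run : ∀ bs e → ∃[ e′ ] (erase ⊩ numTape (content bs e) ⇝ numTape (blanks (length bs + e′)) ×
                              e′ ≤ e ⊔ 1)
erase-run bs e with erase-run′ bs e []
... | xs′ , ds′ , e′ , r , p , q =
  e′ , enter _ ∙ r ∙ subst (λ v → goHome ⊩ _ ⇝ numTape v) p (goHome-run xs′ ds′) , q

-- Two tapes in parallel

data Compare : Tape Mark × Tape Mark → Tape Mark × Tape Mark → Set where
  end : ∀ {t u} → sameBit (Tape.head t) (Tape.head u) ≡ false → Compare (t , u) (t , u)
  rep : ∀ {t u v} → sameBit (Tape.head t) (Tape.head u) ≡ true →
        Compare (stepTape (λ w → w , right) t , stepTape (λ w → w , right) u) v → Compare (t , u) v

-- The scan ends at the first position that does not hold two equal bits. The numerals agree iff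
-- both cells are blank there; the numbers of leftover blanks may differ.
record Compared (xs : List Digit′) (bs : List Bool) (e : ℕ)
                (ys : List Digit′) (cs : List Bool) (f : ℕ) : Set where
  field
    xs′ ds′ ys′ es′ : List Digit′
    run   : Compare (cursor xs (content bs e) , cursor ys (content cs f))
                    (cursor xs′ ds′ , cursor ys′ es′)
    e′ f′ : ℕ
    left-content  : xs′ ʳ++ pad ds′ ≡ xs ʳ++ content bs e′
    right-content : ys′ ʳ++ pad es′ ≡ ys ʳ++ content cs f′
    e′≤   : e′ ≤ e ⊔ 1
    f′≤   : f′ ≤ f ⊔ 1
    if-≡ : bs ≡ cs → bothBlank (Tape.head (cursor xs′ ds′)) (Tape.head (cursor ys′ es′)) ≡ true
    if-≢ : ¬ bs ≡ cs → bothBlank (Tape.head (cursor xs′ ds′)) (Tape.head (cursor ys′ es′)) ≡ false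

head-blanks : ∀ xs e → Tape.head (cursor xs (blanks e)) ≡ dig nothing
head-blanks xs zero    = refl
head-blanks xs (suc e) = refl

compare : ∀ xs bs e ys cs f → Compared xs bs e ys cs f
compare xs [] e ys [] f with pad-blanks e | pad-blanks f
... | e′ , p , q | f′ , r , s = record
  { xs′ = xs ; ds′ = blanks e ; ys′ = ys ; es′ = blanks f ; e′ = e′ ; f′ = f′
  ; run = end (cong₂ sameBit (head-blanks xs e) (head-blanks ys f))
  ; left-content = cong (xs ʳ++_) p ; right-content = cong (ys ʳ++_) r ; e′≤ = q ; f′≤ = s
  ; if-≡ = λ _ → cong₂ bothBlank (head-blanks xs e) (head-blanks ys f)
  ; if-≢ = λ n → contradiction refl n }
compare xs [] e ys (c ∷ cs) f with pad-blanks e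
... | e′ , p , q = record
  { xs′ = xs ; ds′ = blanks e ; ys′ = ys ; es′ = content (c ∷ cs) f ; e′ = e′ ; f′ = f
  ; run = end (cong (λ h → sameBit h (dig (just c))) (head-blanks xs e))
  ; left-content = cong (xs ʳ++_) p ; right-content = refl ; e′≤ = q ; f′≤ = ℕ.m≤m⊔n f 1
  ; if-≡ = λ ()
  ; if-≢ = λ _ → cong (λ h → bothBlank h (dig (just c))) (head-blanks xs e) }
compare xs (b ∷ bs) e ys [] f with pad-blanks f
... | f′ , r , s = record
  { xs′ = xs ; ds′ = content (b ∷ bs) e ; ys′ = ys ; es′ = blanks f ; e′ = e ; f′ = f′
  ; run = end (trans (cong (sameBit (dig (just b))) (head-blanks ys f)) (bit-blank b))
  ; left-content = refl ; right-content = cong (ys ʳ++_) r ; e′≤ = ℕ.m≤m⊔n e 1 ; f′≤ = s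
  ; if-≡ = λ ()
  ; if-≢ = λ _ → refl }
  where
  bit-blank : ∀ b → sameBit (dig (just b)) (dig nothing) ≡ false
  bit-blank false = refl
  bit-blank true  = refl
compare xs (false ∷ bs) e ys (true ∷ cs) f = record
  { xs′ = xs ; ds′ = content (false ∷ bs) e ; ys′ = ys ; es′ = content (true ∷ cs) f ; e′ = e ; f′ = f
  ; run = end refl ; left-content = refl ; right-content = refl
  ; e′≤ = ℕ.m≤m⊔n e 1 ; f′≤ = ℕ.m≤m⊔n f 1 ; if-≡ = λ () ; if-≢ = λ _ → refl }
compare xs (true ∷ bs) e ys (false ∷ cs) f = record
  { xs′ = xs ; ds′ = content (true ∷ bs) e ; ys′ = ys ; es′ = content (false ∷ cs) f ; e′ = e ; f′ = f
  ; run = end refl ; left-content = refl ; right-content = refl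
  ; e′≤ = ℕ.m≤m⊔n e 1 ; f′≤ = ℕ.m≤m⊔n f 1 ; if-≡ = λ () ; if-≢ = λ _ → refl }
compare xs (false ∷ bs) e ys (false ∷ cs) f = record
  { xs′ = xs′ ; ds′ = ds′ ; ys′ = ys′ ; es′ = es′ ; e′ = e′ ; f′ = f′
  ; run = rep refl (subst (λ v → Compare v (cursor xs′ ds′ , cursor ys′ es′)) (sym (cong₂ _,_ (move-right (λ w → w , right) xs (just false) (content bs e) refl)
                                                               (move-right (λ w → w , right) ys (just false) (content cs f) refl))) run)
  ; left-content = left-content ; right-content = right-content ; e′≤ = e′≤ ; f′≤ = f′≤
  ; if-≡ = if-≡ ∘ List.∷-injectiveʳ ; if-≢ = λ n → if-≢ (n ∘ cong (false ∷_)) }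
  where open Compared (compare (just false ∷ xs) bs e (just false ∷ ys) cs f)
compare xs (true ∷ bs) e ys (true ∷ cs) f = record
  { xs′ = xs′ ; ds′ = ds′ ; ys′ = ys′ ; es′ = es′ ; e′ = e′ ; f′ = f′
  ; run = rep refl (subst (λ v → Compare v (cursor xs′ ds′ , cursor ys′ es′)) (sym (cong₂ _,_ (move-right (λ w → w , right) xs (just true) (content bs e) refl)
                                                               (move-right (λ w → w , right) ys (just true) (content cs f) refl))) run)
  ; left-content = left-content ; right-content = right-content ; e′≤ = e′≤ ; f′≤ = f′≤
  ; if-≡ = if-≡ ∘ List.∷-injectiveʳ ; if-≢ = λ n → if-≢ (n ∘ cong (true ∷_)) }
  where open Compared (compare (just true ∷ xs) bs e (just true ∷ ys) cs f)

-- Counter programs: stores, comparison of registers and Hoare triples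

infixl 6 _[_↦_]
_[_↦_] : (ℕ → ℕ) → ℕ → ℕ → ℕ → ℕ
(σ [ r ↦ v ]) j = if does (j ℕ.≟ r) then v else σ j

↦-same : ∀ σ {r} v → (σ [ r ↦ v ]) r ≡ v
↦-same σ {r} v rewrite dec-true (r ℕ.≟ r) refl = refl

↦-other : ∀ σ {r j} v → ¬ j ≡ r → (σ [ r ↦ v ]) j ≡ σ j
↦-other σ {r} {j} v n rewrite dec-false (j ℕ.≟ r) n = refl

module Counters (A : Set) (T′ : ℕ) where

  T : ℕ
  T = suc T′

  open Structured A Mark (dig nothing) T public

  -- The remainder makes the map total, so that programs can be written without proofs that their
  -- registers exist; below `T` it is injective.
  reg : ℕ → Fin T
  reg k = k mod T

  reg-injective : ∀ {j k} → j < T → k < T → reg j ≡ reg k → j ≡ k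
  reg-injective {j} {k} p q e = begin
    j            ≡⟨ m<n⇒m%n≡m p ⟨
    j ℕ.% T      ≡⟨ Fin.toℕ-fromℕ< (m%n<n j T) ⟨
    toℕ (reg j)  ≡⟨ cong toℕ e ⟩
    toℕ (reg k)  ≡⟨ Fin.toℕ-fromℕ< (m%n<n k T) ⟩
    k ℕ.% T      ≡⟨ m<n⇒m%n≡m q ⟩
    k            ∎
    where open ≡-Reasoning

  on : Fin T → (Mark → Mark × Move) → Observer Action
  on r f x ws = stay , Vec.map (_, stay) ws [ r ]≔ f (lookup ws r)

  onBoth : Fin T → Fin T → (Mark → Mark × Move) → Observer Action
  onBoth r s f x ws =
    stay , Vec.map (_, stay) ws [ r ]≔ f (lookup ws r) [ s ]≔ f (lookup ws s)

  test : Fin T → (Mark → Bool) → Observer Bool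
  test r p x ws = p (lookup ws r)

  testBoth : Fin T → Fin T → (Mark → Mark → Bool) → Observer Bool
  testBoth r s p x ws = p (lookup ws r) (lookup ws s)

  local : Fin T → Local → Prog
  local r (once f)   = act (on r f)
  local r (loop p f) = while (test r p) (act (on r f))
  local r (P ∙ Q)    = local r P ⨾ local r Q

  scan : Fin T → Fin T → Prog
  scan r s = act (onBoth r s (λ w → w , right)) ⨾
             while (testBoth r s sameBit) (act (onBoth r s (λ w → w , right)))

  homeBoth : Fin T → Fin T → Prog
  homeBoth r s = local r goHome ⨾ local s goHome

  inc clear : ℕ → Prog
  inc r = local (reg r) increment
  clear r = local (reg r) erase

  -- The outcome of a scan is visible only while both heads are away from home, so each branch
  -- starts by returning them.
  if≡ : ℕ → ℕ → Prog → Prog → Prog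
  if≡ r s P Q = scan (reg r) (reg s) ⨾
    branch (testBoth (reg r) (reg s) bothBlank)
      (homeBoth (reg r) (reg s) ⨾ P) (homeBoth (reg r) (reg s) ⨾ Q)

  -- The loop test is the outcome of a scan: one scan precedes the loop and one ends each round, and
  -- the heads return when a round starts and after the loop.
  while≢ : ℕ → ℕ → Prog → Prog
  while≢ r s P = scan (reg r) (reg s) ⨾
    while (λ x ws → not (testBoth (reg r) (reg s) bothBlank x ws))
      (homeBoth (reg r) (reg s) ⨾ P ⨾ scan (reg r) (reg s)) ⨾
    homeBoth (reg r) (reg s)

  moveHead : Move → Prog
  moveHead m = act (λ x ws → m , Vec.map (_, stay) ws)

  ifSymbol : (Delimited A → Bool) → Prog → Prog → Prog
  ifSymbol p = branch (λ x ws → p x)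

  whileSymbol : (Delimited A → Bool) → Prog → Prog
  whileSymbol p = while (λ x ws → p x)

  skip : Prog
  skip = moveHead stay

  zipWith-updates : ∀ {X Y Z : Set} (f : X → Y → Z) {n} (xs : Vec X n) (ys : Vec Y n) i x →
                    Vec.zipWith f (xs [ i ]≔ x) ys ≡ Vec.zipWith f xs ys [ i ]≔ f x (lookup ys i)
  zipWith-updates f (_ ∷ xs) (_ ∷ ys) Fin.zero    x = refl
  zipWith-updates f (_ ∷ xs) (_ ∷ ys) (Fin.suc i) x = cong (_ ∷_) (zipWith-updates f xs ys i x)

  perform-on : ∀ r f i ts → perform (observe (on r f) (i , ts)) (i , ts) ≡
               (i , ts [ r ]≔ stepTape f (lookup ts r))
  perform-on r f i ts = cong (i ,_) (begin
    _ ≡⟨ zipWith-updates moveTape _ ts r _ ⟩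
    _ ≡⟨ cong₂ (λ us h → us [ r ]≔ moveTape (f h) (lookup ts r)) (idle-tapes ts) (Vec.lookup-map r Tape.head ts) ⟩
    _ ∎)
    where open ≡-Reasoning

  perform-onBoth : ∀ r s f i ts → perform (observe (onBoth r s f) (i , ts)) (i , ts) ≡
                   (i , ts [ r ]≔ stepTape f (lookup ts r) [ s ]≔ stepTape f (lookup ts s))
  perform-onBoth r s f i ts = cong (i ,_) (begin
    _ ≡⟨ zipWith-updates moveTape _ ts s _ ⟩
    _ ≡⟨ cong (_[ s ]≔ _) (zipWith-updates moveTape _ ts r _) ⟩
    _ ≡⟨ cong₂ (λ us h → us [ r ]≔ moveTape (f h) (lookup ts r) [ s ]≔ moveTape (f (lookup (Vec.map Tape.head ts) s)) (lookup ts s))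
           (idle-tapes ts) (Vec.lookup-map r Tape.head ts) ⟩
    _ ≡⟨ cong (λ h → ts [ r ]≔ _ [ s ]≔ moveTape (f h) (lookup ts s)) (Vec.lookup-map s Tape.head ts) ⟩
    _ ∎)
    where open ≡-Reasoning

  -- L bounds the length of the counters and B their values.
  module Bounded (L B : ℕ) (fits : ∀ n → n ≤ B → suc (length (bits n)) ≤ L) where

    N : ℕ
    N = T * suc L

    record Small (ts : Tapes) : Set where
      constructor mkSmall
      field small-at : ∀ j → cells (lookup ts j) ≤ suc L
    open Small

    small-space : ∀ {ts} → Small ts → cellCount ts ≤ N
    small-space {ts} h = sum-cells ts (small-at h)
      where
      sum-cells : ∀ {n} (ts : Vec (Tape Mark) n) → (∀ j → cells (lookup ts j) ≤ suc L) →
           Vec.sum (Vec.map cells ts) ≤ n * suc L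
      sum-cells []       h = z≤n
      sum-cells (t ∷ ts) h = ℕ.+-mono-≤ (h Fin.zero) (sum-cells ts (h ∘ Fin.suc))

    small-update : ∀ {ts} r {t} → Small ts → cells t ≤ suc L → Small (ts [ r ]≔ t)
    small-at (small-update {ts} r {t} h c) j with j Fin.≟ r
    ... | yes refl = subst (λ u → cells u ≤ suc L) (sym (Vec.lookup∘update j ts t)) c
    ... | no  n    = subst (λ u → cells u ≤ suc L) (sym (Vec.lookup∘update′ n ts t)) (small-at h j)

    exec-on : ∀ r f {i ts t} → lookup ts r ≡ t → Small ts →
              Exec N (act (on r f)) (i , ts) (i , ts [ r ]≔ stepTape f t)
    exec-on r f {i} {ts} refl h =
      subst (Exec N _ _) (perform-on r f i ts) (act (small-space h))

    observe-test : ∀ r p {i ts t v} → lookup ts r ≡ t → p (Tape.head t) ≡ v →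
                   observe (test r p) (i , ts) ≡ v
    observe-test r p {ts = ts} refl e = trans (cong p (Vec.lookup-map r Tape.head ts)) e

    observe-testBoth : ∀ r s p {i ts t u v} → lookup ts r ≡ t → lookup ts s ≡ u →
                       p (Tape.head t) (Tape.head u) ≡ v →
                       observe (testBoth r s p) (i , ts) ≡ v
    observe-testBoth r s p {ts = ts} refl refl e =
      trans (cong₂ p (Vec.lookup-map r Tape.head ts) (Vec.lookup-map s Tape.head ts)) e

    exec-local : ∀ r {P i ts t t′} → P ⊩ t ⇝ t′ → cells t′ ≤ suc L → Small ts → lookup ts r ≡ t →
                 Exec N (local r P) (i , ts) (i , ts [ r ]≔ t′)
    exec-local r once c h e = exec-on r _ e h
    exec-local r {loop p f} {i} {ts} (loop-end x) c h e =
      subst (λ us → Exec N (while _ _) (i , ts) (i , us)) (sym (trans (cong (ts [ r ]≔_) (sym e)) (Vec.[]≔-lookup ts r)))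
        (while-end (small-space h) (observe-test r p {i} {ts} e x))
    exec-local r {loop p f} {i} {ts} {t} {t′} (loop-rep x run) c h e =
      while-rep (small-space h) (observe-test r p {i} {ts} e x) (exec-on r f e h)
        (subst (λ us → Exec N _ _ (i , us)) (Vec.[]≔-idempotent ts r)
          (exec-local r run c (small-update r h (ℕ.≤-trans (cells-mono run) c)) (Vec.lookup∘update r ts _)))
    exec-local r {i = i} {ts} (p ∙ q) c h e =
      exec-local r p (ℕ.≤-trans (cells-mono q) c) h e ⨾
      subst (λ us → Exec N _ _ (i , us)) (Vec.[]≔-idempotent ts r)
        (exec-local r q c (small-update r h (ℕ.≤-trans (cells-mono q) c)) (Vec.lookup∘update r ts _))

    module _ {r s : Fin T} (r≢s : ¬ r ≡ s) where

      both : Tapes → Tape Mark → Tape Mark → Tapes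
      both ts t u = ts [ r ]≔ t [ s ]≔ u

      both-r : ∀ ts t u → lookup (both ts t u) r ≡ t
      both-r ts t u = trans (Vec.lookup∘update′ r≢s (ts [ r ]≔ t) u) (Vec.lookup∘update r ts t)

      both-s : ∀ ts t u → lookup (both ts t u) s ≡ u
      both-s ts t u = Vec.lookup∘update s (ts [ r ]≔ t) u

      both-both : ∀ ts t u t′ u′ → both (both ts t u) t′ u′ ≡ both ts t′ u′
      both-both ts t u t′ u′ = begin
        ts [ r ]≔ t [ s ]≔ u [ r ]≔ t′ [ s ]≔ u′ ≡⟨ cong (_[ s ]≔ u′) (Vec.[]≔-commutes (ts [ r ]≔ t) s r (r≢s ∘ sym)) ⟩
        ts [ r ]≔ t [ r ]≔ t′ [ s ]≔ u [ s ]≔ u′ ≡⟨ Vec.[]≔-idempotent _ s ⟩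
        ts [ r ]≔ t [ r ]≔ t′ [ s ]≔ u′          ≡⟨ cong (_[ s ]≔ u′) (Vec.[]≔-idempotent ts r) ⟩
        ts [ r ]≔ t′ [ s ]≔ u′                   ∎
        where open ≡-Reasoning

      both-lookup : ∀ {ts t u} → lookup ts r ≡ t → lookup ts s ≡ u → both ts t u ≡ ts
      both-lookup {ts} refl refl =
        trans (cong (_[ s ]≔ lookup ts s) (Vec.[]≔-lookup ts r)) (Vec.[]≔-lookup ts s)

      small-both : ∀ {ts t u} → Small ts → cells t ≤ suc L → cells u ≤ suc L → Small (both ts t u)
      small-both h c d = small-update s (small-update r h c) d

      exec-onBoth : ∀ f {i ts t u} → lookup ts r ≡ t → lookup ts s ≡ u → Small ts →
                    Exec N (act (onBoth r s f)) (i , ts) (i , both ts (stepTape f t) (stepTape f u))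
      exec-onBoth f {i} {ts} refl refl h =
        subst (Exec N _ _) (perform-onBoth r s f i ts) (act (small-space h))

      compare-mono : ∀ {t u t′ u′} → Compare (t , u) (t′ , u′) → cells t ≤ cells t′ × cells u ≤ cells u′
      compare-mono (end x) = ℕ.≤-refl , ℕ.≤-refl
      compare-mono {t} {u} (rep x c) with compare-mono c
      ... | p , q = ℕ.≤-trans (cells-moveWork right (Tape.head t) t) p ,
                    ℕ.≤-trans (cells-moveWork right (Tape.head u) u) q

      exec-compare : ∀ {i ts t u t′ u′} → Compare (t , u) (t′ , u′) →
                     cells t′ ≤ suc L → cells u′ ≤ suc L → Small ts →
                     lookup ts r ≡ t → lookup ts s ≡ u →
                     Exec N (while (testBoth r s sameBit) (act (onBoth r s (λ w → w , right))))
                       (i , ts) (i , both ts t′ u′)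
      exec-compare {i} {ts} (end x) c d h e f =
        subst (λ us → Exec N _ (i , ts) (i , us)) (sym (both-lookup e f))
          (while-end (small-space h) (observe-testBoth r s sameBit {i} {ts} e f x))
      exec-compare {i} {ts} {t} {u} (rep x run) c d h e f =
        while-rep (small-space h) (observe-testBoth r s sameBit {i} {ts} e f x) (exec-onBoth _ e f h)
          (subst (λ us → Exec N _ _ (i , us)) (both-both ts _ _ _ _)
            (exec-compare run c d
              (small-both h (ℕ.≤-trans (proj₁ (compare-mono run)) c) (ℕ.≤-trans (proj₂ (compare-mono run)) d))
              (both-r ts _ _) (both-s ts _ _)))

    record Counter (n : ℕ) (t : Tape Mark) : Set where
      constructor counter
      field
        slack  : ℕ
        shape  : t ≡ numTape (content (bits n) slack)
        short  : length (bits n) + slack ≤ L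
        bounded : n ≤ B

    cells-numTape : ∀ ds → cells (numTape ds) ≡ suc (length ds)
    cells-numTape ds = cong suc (List.length-map dig ds)

    length-content : ∀ bs e → length (content bs e) ≡ length bs + e
    length-content bs e = trans (List.length-++ (map just bs)) (cong₂ _+_ (List.length-map {B = Digit′} just bs) (List.length-replicate e {x = nothing}))

    cells-content : ∀ bs e → length bs + e ≤ L → cells (numTape (content bs e)) ≤ suc L
    cells-content bs e p = ℕ.≤-trans (ℕ.≤-reflexive (trans (cells-numTape (content bs e)) (cong suc (length-content bs e)))) (s≤s p)

    -- Here the successor in `fits` pays off: it reserves the cell for the blank that ends a scan or
    -- an erasure.
    slack-pad : ∀ (bs : List Bool) {e e′} → e′ ≤ e ⊔ 1 → length bs + e ≤ L → suc (length bs) ≤ L → length bs + e′ ≤ L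
    slack-pad bs {zero}  {e′} p q r = ℕ.≤-trans (ℕ.+-monoʳ-≤ (length bs) p) (ℕ.≤-trans (ℕ.≤-reflexive (ℕ.+-comm (length bs) 1)) r)
    slack-pad bs {suc e} {e′} p q r = ℕ.≤-trans (ℕ.+-monoʳ-≤ (length bs) (subst (e′ ≤_) (cong suc (ℕ.⊔-identityʳ e)) p)) q

    record Rep (σ : ℕ → ℕ) (ts : Tapes) : Set where
      constructor mkRep
      field rep-at : ∀ {j} → j < T → Counter (σ j) (lookup ts (reg j))
    open Rep

    counter-small : ∀ {n t} → Counter n t → cells t ≤ suc L
    counter-small {n} (counter e refl s b) = cells-content (bits n) e s

    reg-surjective : ∀ j → ∃[ k ] (k < T × reg k ≡ j)
    reg-surjective j = toℕ j , Fin.toℕ<n j , Fin.toℕ-injective (begin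
      toℕ (reg (toℕ j)) ≡⟨ Fin.toℕ-fromℕ< (m%n<n (toℕ j) T) ⟩
      toℕ j ℕ.% T       ≡⟨ m<n⇒m%n≡m (Fin.toℕ<n j) ⟩
      toℕ j             ∎)
      where open ≡-Reasoning

    rep-small : ∀ {σ ts} → Rep σ ts → Small ts
    small-at (rep-small h) j with reg-surjective j
    ... | k , p , refl = counter-small (rep-at h p)

    rep-update : ∀ {σ σ′ ts r t} → r < T → Rep σ ts → Counter (σ′ r) t →
                 (∀ {j} → ¬ j ≡ r → σ′ j ≡ σ j) → Rep σ′ (ts [ reg r ]≔ t)
    rep-at (rep-update {σ} {σ′} {ts} {r} {t} p h c e) {j} q with j ℕ.≟ r
    ... | yes refl = subst (Counter (σ′ j)) (sym (Vec.lookup∘update (reg j) ts t)) c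
    ... | no  n    = subst₂ Counter (sym (e n)) (sym (Vec.lookup∘update′ (n ∘ reg-injective q p) ts t)) (rep-at h q)

    Store : Set
    Store = Tape (Delimited A) × (ℕ → ℕ)

    infix 3 _⟨_⟩_
    -- Total correctness. It quantifies over all tapes that represent the store, because their
    -- leftover blanks depend on the history.
    _⟨_⟩_ : Store → Prog → Store → Set
    (i , σ) ⟨ P ⟩ (i′ , σ′) = ∀ {ts} → Rep σ ts → ∃[ ts′ ] (Exec N P (i , ts) (i′ , ts′) × Rep σ′ ts′)

    infixr 5 _then_
    _then_ : ∀ {S S′ S″ P Q} → S ⟨ P ⟩ S′ → S′ ⟨ Q ⟩ S″ → S ⟨ P ⨾ Q ⟩ S″
    (p then q) h with p h
    ... | ts′ , x , h′ with q h′
    ... | ts″ , y , h″ = ts″ , x ⨾ y , h″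

    inc-triple : ∀ {i σ r} → r < T → suc (σ r) ≤ B →
                 (i , σ) ⟨ inc r ⟩ (i , σ [ r ↦ suc (σ r) ])
    inc-triple {i} {σ} {r} p b {ts} h with rep-at h p
    ... | counter e sh s _ with incDigits-content (bits (σ r)) e s (ℕ.≤-trans (ℕ.n≤1+n (length (bits (suc (σ r))))) (fits (suc (σ r)) b))
    ... | e′ , eq , s′ =
      ts [ reg r ]≔ t′ ,
      exec-local (reg r) (subst (λ ds → increment ⊩ _ ⇝ numTape ds) eq (increment-run (content (bits (σ r)) e)))
        (cells-content (bits (suc (σ r))) e′ s′) (rep-small h) sh ,
      rep-update p h (subst (λ n → Counter n t′) (sym (↦-same σ _)) (counter e′ refl s′ b)) (↦-other σ _)
      where t′ = numTape (content (bits (suc (σ r))) e′)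

    clear-triple : ∀ {i σ r} → r < T → (i , σ) ⟨ clear r ⟩ (i , σ [ r ↦ 0 ])
    clear-triple {i} {σ} {r} p {ts} h with rep-at h p
    ... | counter e sh s b with erase-run (bits (σ r)) e
    ... | e′ , run , e′≤ =
      ts [ reg r ]≔ t′ ,
      exec-local (reg r) run (cells-content [] e″ s′) (rep-small h) sh ,
      rep-update p h (subst (λ n → Counter n t′) (sym (↦-same σ _)) (counter e″ refl s′ z≤n)) (↦-other σ _)
      where
      e″ = length (bits (σ r)) + e′
      t′ = numTape (blanks e″)
      s′ : e″ ≤ L
      s′ = slack-pad (bits (σ r)) {e} {e′} e′≤ s (fits (σ r) b)

    move-triple : ∀ {i σ m} → (i , σ) ⟨ moveHead m ⟩ (moveInput m i , σ)
    move-triple {i} {σ} {m} {ts} h =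
      ts , subst (λ us → Exec N _ _ (moveInput m i , us)) (idle-tapes ts) (act (small-space (rep-small h))) , h

    skip-triple : ∀ {S} → S ⟨ skip ⟩ S
    skip-triple = move-triple

    symbol-true : ∀ {i σ S p P Q} → p (Tape.head i) ≡ true → (i , σ) ⟨ P ⟩ S → (i , σ) ⟨ ifSymbol p P Q ⟩ S
    symbol-true e t h with t h
    ... | ts′ , x , h′ = ts′ , branch-t (small-space (rep-small h)) e x , h′

    symbol-false : ∀ {i σ S p P Q} → p (Tape.head i) ≡ false → (i , σ) ⟨ Q ⟩ S → (i , σ) ⟨ ifSymbol p P Q ⟩ S
    symbol-false e t h with t h
    ... | ts′ , x , h′ = ts′ , branch-f (small-space (rep-small h)) e x , h′

    whileSymbol-end : ∀ {i σ p P} → p (Tape.head i) ≡ false → (i , σ) ⟨ whileSymbol p P ⟩ (i , σ)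
    whileSymbol-end e h = _ , while-end (small-space (rep-small h)) e , h

    whileSymbol-rep : ∀ {i σ S S′ p P} → p (Tape.head i) ≡ true → (i , σ) ⟨ P ⟩ S →
                      S ⟨ whileSymbol p P ⟩ S′ → (i , σ) ⟨ whileSymbol p P ⟩ S′
    whileSymbol-rep e t k h with t h
    ... | ts′ , x , h′ with k h′
    ... | ts″ , y , h″ = ts″ , while-rep (small-space (rep-small h)) e x y , h″

    -- The tapes `ts⁺` have displaced heads and show the outcome; `ts′` are the tapes after the
    -- return, again representing the unchanged store.
    record Scanned (r s : ℕ) (σ : ℕ → ℕ) (i : Tape (Delimited A)) (ts : Tapes) : Set where
      field
        ts⁺     : Tapes
        scanned : Exec N (scan (reg r) (reg s)) (i , ts) (i , ts⁺)
        small   : Small ts⁺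
        if-≡    : σ r ≡ σ s → observe (testBoth (reg r) (reg s) bothBlank) (i , ts⁺) ≡ true
        if-≢    : ¬ σ r ≡ σ s → observe (testBoth (reg r) (reg s) bothBlank) (i , ts⁺) ≡ false
        ts′     : Tapes
        homed   : Exec N (homeBoth (reg r) (reg s)) (i , ts⁺) (i , ts′)
        rep′    : Rep σ ts′

    do-scan : ∀ {r s σ i ts} → r < T → s < T → ¬ r ≡ s → Rep σ ts → Scanned r s σ i ts
    do-scan {r} {s} {σ} {i} {ts} r<T s<T r≢s h with rep-at h r<T | rep-at h s<T
    ... | counter e sh sr br | counter f sk ss bs = record
      { ts⁺ = us
      ; scanned = exec-onBoth reg≢ (λ w → w , right) {i} {ts} sh sk (rep-small h) ⨾
          subst (λ vs → Exec N _ (i , both reg≢ ts (enterTape t₀) (enterTape u₀)) (i , vs)) (both-both reg≢ ts _ _ _ _)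
            (exec-compare reg≢ run′ small-t small-u
              (small-both reg≢ (rep-small h) (ℕ.≤-trans (proj₁ (compare-mono reg≢ run′)) small-t)
                                        (ℕ.≤-trans (proj₂ (compare-mono reg≢ run′)) small-u))
              (both-r reg≢ ts _ _) (both-s reg≢ ts _ _))
      ; small = small-us
      ; if-≡ = λ q → observe-testBoth (reg r) (reg s) bothBlank {i} {us} (both-r reg≢ ts t u) (both-s reg≢ ts t u) (C.if-≡ (cong bits q))
      ; if-≢ = λ q → observe-testBoth (reg r) (reg s) bothBlank {i} {us} (both-r reg≢ ts t u) (both-s reg≢ ts t u) (C.if-≢ (q ∘ bits-injective))
      ; homed = exec-local (reg r) back-t cells-t′ small-us (both-r reg≢ ts t u) ⨾
                exec-local (reg s) back-u cells-u′ (small-update (reg r) small-us cells-t′)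
                  (trans (Vec.lookup∘update′ (reg≢ ∘ sym) us t′) (both-s reg≢ ts t u))
      ; rep′ = subst (Rep σ) (sym (both-both reg≢ ts t u t′ u′))
          (rep-update s<T (rep-update r<T h (counter C.e′ refl short-t br) (λ _ → refl))
            (counter C.f′ refl short-u bs) (λ _ → refl))
      }
      where
      reg≢ : ¬ reg r ≡ reg s
      reg≢ = r≢s ∘ reg-injective r<T s<T
      enterTape = stepTape (λ w → w , right)
      t₀ = numTape (content (bits (σ r)) e)
      u₀ = numTape (content (bits (σ s)) f)
      module C = Compared (compare [] (bits (σ r)) e [] (bits (σ s)) f)
      t = cursor C.xs′ C.ds′
      u = cursor C.ys′ C.es′
      us = both reg≢ ts t u
      t′ = numTape (content (bits (σ r)) C.e′)
      u′ = numTape (content (bits (σ s)) C.f′)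
      entered : ∀ ds → stepTape (λ w → w , right) (numTape ds) ≡ cursor [] ds
      entered []       = refl
      entered (_ ∷ ds) = refl
      run′ = subst₂ (λ a b → Compare (a , b) (t , u)) (sym (entered (content (bits (σ r)) e)))
                                                      (sym (entered (content (bits (σ s)) f))) C.run
      back-t : goHome ⊩ t ⇝ t′
      back-t = subst (λ ds → goHome ⊩ t ⇝ numTape ds) C.left-content (goHome-run C.xs′ C.ds′)
      back-u : goHome ⊩ u ⇝ u′
      back-u = subst (λ ds → goHome ⊩ u ⇝ numTape ds) C.right-content (goHome-run C.ys′ C.es′)
      short-t : length (bits (σ r)) + C.e′ ≤ L
      short-t = slack-pad (bits (σ r)) {e} {C.e′} C.e′≤ sr (fits (σ r) br)
      short-u : length (bits (σ s)) + C.f′ ≤ L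
      short-u = slack-pad (bits (σ s)) {f} {C.f′} C.f′≤ ss (fits (σ s) bs)
      cells-t′ = cells-content (bits (σ r)) C.e′ short-t
      cells-u′ = cells-content (bits (σ s)) C.f′ short-u
      small-t = ℕ.≤-trans (cells-mono back-t) cells-t′
      small-u = ℕ.≤-trans (cells-mono back-u) cells-u′
      small-us = small-both reg≢ (rep-small h) small-t small-u

    module _ {r s : ℕ} (r<T : r < T) (s<T : s < T) (r≢s : ¬ r ≡ s) where

      if≡-true : ∀ {i σ S P Q} → σ r ≡ σ s → (i , σ) ⟨ P ⟩ S → (i , σ) ⟨ if≡ r s P Q ⟩ S
      if≡-true e t h with do-scan r<T s<T r≢s h
      ... | c with t (Scanned.rep′ c)
      ... | ts″ , x , h″ = ts″ , scanned ⨾ branch-t (small-space small) (if-≡ e) (homed ⨾ x) , h″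
        where open Scanned c

      if≡-false : ∀ {i σ S P Q} → ¬ σ r ≡ σ s → (i , σ) ⟨ Q ⟩ S → (i , σ) ⟨ if≡ r s P Q ⟩ S
      if≡-false e t h with do-scan r<T s<T r≢s h
      ... | c with t (Scanned.rep′ c)
      ... | ts″ , x , h″ = ts″ , scanned ⨾ branch-f (small-space small) (if-≢ e) (homed ⨾ x) , h″
        where open Scanned c

      while≢-end : ∀ {i σ P} → σ r ≡ σ s → (i , σ) ⟨ while≢ r s P ⟩ (i , σ)
      while≢-end e h with do-scan r<T s<T r≢s h
      ... | c = ts′ , scanned ⨾ while-end (small-space small) (cong not (if-≡ e)) ⨾ homed , rep′
        where open Scanned c

      while≢-rep : ∀ {i σ S S′ P} → ¬ σ r ≡ σ s → (i , σ) ⟨ P ⟩ S →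
                   S ⟨ while≢ r s P ⟩ S′ → (i , σ) ⟨ while≢ r s P ⟩ S′
      while≢-rep e t k h with do-scan r<T s<T r≢s h
      ... | c with t (Scanned.rep′ c)
      ... | ts″ , x , h″ with k h″
      ... | ts‴ , (y ⨾ z ⨾ w) , h‴ =
        ts‴ , scanned ⨾ while-rep (small-space small) (cong not (if-≢ e)) (homed ⨾ x ⨾ y) z ⨾ w , h‴
        where open Scanned c

-- Capped primitive recursion

-- rec b f g iterates g as often as b says, but at most lim times.
data Fun (A : Set) (n : ℕ) : Set where
  var  : Fin n → Fun A n
  zero : Fun A n
  lim  : Fun A n
  suc  : Fun A n → Fun A n
  ifeq : (a b c d : Fun A n) → Fun A n
  read : (Delimited A → Bool) → Fun A n → Fun A n
  rec  : (b f : Fun A n) → Fun A (2 + n) → Fun A n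
  comp : ∀ {m} → Fun A m → Vec (Fun A n) m → Fun A n

recur : (ℕ → ℕ → ℕ) → ℕ → ℕ → ℕ
recur g a zero    = a
recur g a (suc y) = g y (recur g a y)

𝟙 : Bool → ℕ
𝟙 b = if b then 1 else 0

module Semantics {A : Set} (symbol : ℕ → Delimited A) (Z : ℕ) where

  ⟦_⟧  : ∀ {n} → Fun A n → Vec ℕ n → ℕ
  ⟦_⟧* : ∀ {n m} → Vec (Fun A n) m → Vec ℕ n → Vec ℕ m
  ⟦ var i ⟧        ρ = lookup ρ i
  ⟦ zero ⟧         ρ = 0
  ⟦ lim ⟧          ρ = Z
  ⟦ suc f ⟧        ρ = suc (⟦ f ⟧ ρ)
  ⟦ ifeq a b c d ⟧ ρ = if ⟦ a ⟧ ρ ℕ.≡ᵇ ⟦ b ⟧ ρ then ⟦ c ⟧ ρ else ⟦ d ⟧ ρ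
  ⟦ read p f ⟧     ρ = 𝟙 (p (symbol (⟦ f ⟧ ρ)))
  ⟦ rec b f g ⟧    ρ = recur (λ y a → ⟦ g ⟧ (y ∷ a ∷ ρ)) (⟦ f ⟧ ρ) (⟦ b ⟧ ρ ⊓ Z)
  ⟦ comp f gs ⟧    ρ = ⟦ f ⟧ (⟦ gs ⟧* ρ)
  ⟦ [] ⟧*          ρ = []
  ⟦ g ∷ gs ⟧*      ρ = ⟦ g ⟧ ρ ∷ ⟦ gs ⟧* ρ

  record Holds {n} (f : Fun A n) (ρ : Vec ℕ n) : Set where
    constructor holding
    field value-one : ⟦ f ⟧ ρ ≡ 1
  open Holds public

-- Bounds how far the value, and every intermediate value kept in a register, can exceed the largest
-- argument. It is additive under composition, so a recursion of at most Z rounds costs Z times the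
-- growth of its step; the round counter accounts for the other Z.
growth  : ∀ {A n} → ℕ → Fun A n → ℕ
growth* : ∀ {A n m} → ℕ → Vec (Fun A n) m → ℕ
growth Z (var i)        = 0
growth Z zero           = 0
growth Z lim            = Z
growth Z (suc f)        = suc (growth Z f)
growth Z (ifeq a b c d) = (growth Z a + growth Z b) + (growth Z c + growth Z d)
growth Z (read p f)     = suc (growth Z f)
growth Z (rec b f g)    = ((Z + growth Z b) + growth Z f) + Z * growth Z g
growth Z (comp f gs)    = growth* Z gs + growth Z f
growth* Z []            = 0
growth* Z (g ∷ gs)      = growth Z g + growth* Z gs

-- A sum of two powers of X ≥ 2 is absorbed by one further factor X; this explains the successors.
growth-exponent  : ∀ {A n} → Fun A n → ℕ
growth-exponent* : ∀ {A n m} → Vec (Fun A n) m → ℕ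
growth-exponent (var i)        = 0
growth-exponent zero           = 0
growth-exponent lim            = 1
growth-exponent (suc f)        = suc (growth-exponent f)
growth-exponent (ifeq a b c d) = suc (suc (growth-exponent a + growth-exponent b) + suc (growth-exponent c + growth-exponent d))
growth-exponent (read p f)     = suc (growth-exponent f)
growth-exponent (rec b f g)    = suc (suc (suc (1 + growth-exponent b) + growth-exponent f) + suc (growth-exponent g))
growth-exponent (comp f gs)    = suc (growth-exponent* gs + growth-exponent f)
growth-exponent* []            = 0
growth-exponent* (g ∷ gs)      = suc (growth-exponent g + growth-exponent* gs)

module _ {Z X : ℕ} (Z≤X : Z ≤ X) (2≤X : 2 ≤ X) where
  private
    X≢0 : ℕ.NonZero X
    X≢0 = ℕ.>-nonZero (ℕ.≤-trans (s≤s z≤n) 2≤X)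

    sum≤ : ∀ {a b} d e → a ≤ X ^ d → b ≤ X ^ e → a + b ≤ X ^ suc (d + e)
    sum≤ {a} {b} d e p q = begin
      a + b                           ≤⟨ ℕ.+-mono-≤ p q ⟩
      X ^ d + X ^ e                   ≤⟨ ℕ.+-mono-≤ (ℕ.^-monoʳ-≤ X {{X≢0}} (ℕ.m≤m+n d e)) (ℕ.^-monoʳ-≤ X {{X≢0}} (ℕ.m≤n+m e d)) ⟩
      X ^ (d + e) + X ^ (d + e)       ≡⟨ cong (X ^ (d + e) +_) (sym (ℕ.+-identityʳ _)) ⟩
      2 * X ^ (d + e)                 ≤⟨ ℕ.*-monoˡ-≤ (X ^ (d + e)) 2≤X ⟩
      X ^ suc (d + e)                 ∎
      where open ℕ.≤-Reasoning

    Z≤X^1 : Z ≤ X ^ 1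
    Z≤X^1 = ℕ.≤-trans Z≤X (ℕ.≤-reflexive (sym (ℕ.*-identityʳ X)))

  growth≤  : ∀ {A n} (f : Fun A n) → growth Z f ≤ X ^ growth-exponent f
  growth≤* : ∀ {A n m} (fs : Vec (Fun A n) m) → growth* Z fs ≤ X ^ growth-exponent* fs
  growth≤ (var i)        = z≤n
  growth≤ zero           = z≤n
  growth≤ lim            = Z≤X^1
  growth≤ (suc f)        = sum≤ 0 (growth-exponent f) (ℕ.≤-refl {1}) (growth≤ f)
  growth≤ (ifeq a b c d) = sum≤ (suc (growth-exponent a + growth-exponent b)) (suc (growth-exponent c + growth-exponent d))
    (sum≤ (growth-exponent a) (growth-exponent b) (growth≤ a) (growth≤ b))
    (sum≤ (growth-exponent c) (growth-exponent d) (growth≤ c) (growth≤ d))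
  growth≤ (read p f)     = sum≤ 0 (growth-exponent f) (ℕ.≤-refl {1}) (growth≤ f)
  growth≤ (rec b f g)    = sum≤ (suc (suc (1 + growth-exponent b) + growth-exponent f)) (suc (growth-exponent g))
    (sum≤ (suc (1 + growth-exponent b)) (growth-exponent f)
      (sum≤ 1 (growth-exponent b) Z≤X^1 (growth≤ b)) (growth≤ f))
    (ℕ.*-mono-≤ Z≤X (growth≤ g))
  growth≤ (comp f gs)    = sum≤ (growth-exponent* gs) (growth-exponent f) (growth≤* gs) (growth≤ f)
  growth≤* []            = z≤n
  growth≤* (g ∷ gs)      = sum≤ (growth-exponent g) (growth-exponent* gs) (growth≤ g) (growth≤* gs)

module _ {A : Set} (symbol : ℕ → Delimited A) (Z : ℕ) where
  open Semantics symbol Z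

  private
    grow : ∀ {a b M} → b ≤ M + a → ∀ {c} → a ≤ c → b ≤ M + c
    grow p q = ℕ.≤-trans p (ℕ.+-monoʳ-≤ _ q)

    if-≤ : ∀ b {x y z : ℕ} → x ≤ z → y ≤ z → (if b then x else y) ≤ z
    if-≤ true  p q = p
    if-≤ false p q = q

  -- The bound after y rounds. It is at least Z and M, so it also covers the round counter and the
  -- parameters that the next round receives.
  step-bound : ∀ {n} (b f : Fun A n) (g : Fun A (2 + n)) → ℕ → ℕ → ℕ
  step-bound b f g M y = M + (((Z + growth Z b) + growth Z f) + y * growth Z g)

  value-bound  : ∀ {n M} (f : Fun A n) {ρ} → VecAll (_≤ M) ρ → ⟦ f ⟧ ρ ≤ M + growth Z f
  value-bound* : ∀ {n m M} (fs : Vec (Fun A n) m) {ρ} → VecAll (_≤ M) ρ → VecAll (_≤ M + growth* Z fs) (⟦ fs ⟧* ρ)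
  recur-bound  : ∀ {n M} (b f : Fun A n) g {ρ} → VecAll (_≤ M) ρ → ∀ y → y ≤ Z →
                 recur (λ y a → ⟦ g ⟧ (y ∷ a ∷ ρ)) (⟦ f ⟧ ρ) y ≤ step-bound b f g M y
  step-env     : ∀ {n M} (b f : Fun A n) g {ρ} → VecAll (_≤ M) ρ → ∀ y → y ≤ Z →
                 VecAll (_≤ step-bound b f g M y) (y ∷ recur (λ y a → ⟦ g ⟧ (y ∷ a ∷ ρ)) (⟦ f ⟧ ρ) y ∷ ρ)
  value-bound {M = M} (var i) h = ℕ.≤-trans (VecAll.lookup⁺ h i) (ℕ.m≤m+n M 0)
  value-bound zero h = z≤n
  value-bound {M = M} lim h = ℕ.m≤n+m Z M
  value-bound {M = M} (suc f) h = ℕ.≤-trans (s≤s (value-bound f h)) (ℕ.≤-reflexive (sym (ℕ.+-suc M _)))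
  value-bound {M = M} (ifeq a b c d) {ρ} h = if-≤ (⟦ a ⟧ ρ ℕ.≡ᵇ ⟦ b ⟧ ρ)
    (grow {M = M} (value-bound c h) (ℕ.≤-trans (ℕ.m≤m+n (growth Z c) (growth Z d)) (ℕ.m≤n+m _ (growth Z a + growth Z b))))
    (grow {M = M} (value-bound d h) (ℕ.≤-trans (ℕ.m≤n+m (growth Z d) (growth Z c)) (ℕ.m≤n+m _ (growth Z a + growth Z b))))
  value-bound {M = M} (read p f) {ρ} h = if-≤ (p (symbol (⟦ f ⟧ ρ)))
    (ℕ.≤-trans (s≤s z≤n) (ℕ.m≤n+m (suc (growth Z f)) M)) z≤n
  value-bound {M = M} (rec b f g) {ρ} h = ℕ.≤-trans
    (recur-bound b f g h (⟦ b ⟧ ρ ⊓ Z) (ℕ.m⊓n≤n (⟦ b ⟧ ρ) Z))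
    (ℕ.+-monoʳ-≤ M (ℕ.+-monoʳ-≤ ((Z + growth Z b) + growth Z f) (ℕ.*-monoˡ-≤ (growth Z g) (ℕ.m⊓n≤n (⟦ b ⟧ ρ) Z))))
  value-bound {M = M} (comp f gs) h = ℕ.≤-trans (value-bound f (value-bound* gs h)) (ℕ.≤-reflexive (ℕ.+-assoc M _ _))
  value-bound* [] h = []
  value-bound* {M = M} (g ∷ gs) h =
    grow {M = M} (value-bound g h) (ℕ.m≤m+n (growth Z g) (growth* Z gs)) ∷
    VecAll.map (λ p → grow {M = M} p (ℕ.m≤n+m (growth* Z gs) (growth Z g))) (value-bound* gs h)
  recur-bound {M = M} b f g h zero    p = grow {M = M} (value-bound f h)
    (ℕ.≤-trans (ℕ.m≤n+m (growth Z f) (Z + growth Z b)) (ℕ.m≤m+n _ 0))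
  recur-bound {M = M} b f g h (suc y) p = ℕ.≤-trans (value-bound g (step-env b f g h y (ℕ.≤-trans (ℕ.n≤1+n y) p)))
    (ℕ.≤-reflexive (trans (ℕ.+-assoc M _ _) (cong (M +_) (trans (ℕ.+-assoc ((Z + growth Z b) + growth Z f) _ _) (cong (((Z + growth Z b) + growth Z f) +_) (ℕ.+-comm (y * growth Z g) (growth Z g)))))))
  step-env {M = M} b f g h y p =
    ℕ.≤-trans p (ℕ.≤-trans (ℕ.m≤m+n Z (growth Z b)) (ℕ.≤-trans (ℕ.m≤m+n _ (growth Z f)) (ℕ.≤-trans (ℕ.m≤m+n _ (y * growth Z g)) (ℕ.m≤n+m _ M)))) ∷
    recur-bound b f g h y p ∷
    VecAll.map (λ q → ℕ.≤-trans q (ℕ.m≤m+n M _)) h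

-- Compilation of functions to counter programs

-- Exceeds every register written by an evaluation whose result goes to register k; such an
-- evaluation writes no register below k.
top  : ∀ {A n} → Fun A n → ℕ → ℕ
top* : ∀ {A n m} → Vec (Fun A n) m → ℕ → ℕ
top (var i)        k = suc k
top zero           k = suc k
top lim            k = suc k
top (suc f)        k = suc k ⊔ top f k
top (ifeq a b c d) k = ((2 + k) ⊔ top a k) ⊔ (top b (suc k) ⊔ (top c k ⊔ top d k))
top (read p f)     k = (2 + k) ⊔ top f k
top (rec b f g)    k = (5 + k) ⊔ (top f k ⊔ (top b (suc k) ⊔ top g (4 + k)))
top (comp {m} f gs)    k = (2 + (k + m)) ⊔ (top* gs (suc k) ⊔ top f (suc (k + m)))
top* []            k = 0
top* (g ∷ gs)      k = top g k ⊔ top* gs (suc k)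

⊔-left : ∀ {a b c} → a ⊔ b ≤ c → a ≤ c
⊔-left {a} {b} = ℕ.m⊔n≤o⇒m≤o a b

⊔-right : ∀ {a b c} → a ⊔ b ≤ c → b ≤ c
⊔-right {a} {b} = ℕ.m⊔n≤o⇒n≤o a b

range : ∀ m → ℕ → Vec ℕ m
range zero    k = []
range (suc m) k = k ∷ range m (suc k)

module Compilation (A : Set) (T′ : ℕ) where
  open Counters A T′ public

  atStart atEnd : Delimited A → Bool
  atStart ⊢ = true
  atStart _ = false
  atEnd ⊣ = true
  atEnd _ = false

  copy : ℕ → ℕ → Prog
  copy r k = clear k ⨾ while≢ k r (inc k)

  rewind : Prog
  rewind = whileSymbol (not ∘ atStart) (moveHead left)

  -- The vector names the registers of the arguments and the number is the register of the result;
  -- those above it are scratch, and register 0 holds the limit Z.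
  compile  : ∀ {n} → Fun A n → Vec ℕ n → ℕ → Prog
  compile* : ∀ {n m} → Vec (Fun A n) m → Vec ℕ n → ℕ → Prog
  compile (var i)        e k = copy (lookup e i) k
  compile zero           e k = clear k
  compile lim            e k = copy 0 k
  compile (suc f)        e k = compile f e k ⨾ inc k
  compile (ifeq a b c d) e k =
    compile a e k ⨾ compile b e (suc k) ⨾ if≡ k (suc k) (compile c e k) (compile d e k)
  -- Between evaluations the input head is on the left delimiter, so a position is reached by
  -- counting moves from there.
  compile (read p f)     e k =
    compile f e k ⨾ clear (suc k) ⨾ while≢ (suc k) k (moveHead right ⨾ inc (suc k)) ⨾
    ifSymbol p (rewind ⨾ clear k ⨾ inc k) (rewind ⨾ clear k)
  -- Equality is the only test available. The minimum of b and Z arises by running exactly Z rounds,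
  -- counted in 2 + k, where a round is idle once the number of effective rounds in 3 + k equals b.
  compile (rec b f g)    e k =
    compile f e k ⨾ compile b e (1 + k) ⨾ clear (2 + k) ⨾ clear (3 + k) ⨾
    while≢ (2 + k) 0
      (if≡ (3 + k) (1 + k) skip
        (compile g (3 + k ∷ k ∷ e) (4 + k) ⨾ copy (4 + k) k ⨾ inc (3 + k)) ⨾
       inc (2 + k))
  compile (comp {m} f gs) e k =
    compile* gs e (suc k) ⨾ compile f (range m (suc k)) (suc (k + m)) ⨾ copy (suc (k + m)) k
  compile* []       e k = skip
  compile* (g ∷ gs) e k = compile g e k ⨾ compile* gs e (suc k)

-- The head cannot pass the right delimiter, so all positions beyond the end show that symbol.
ahead : ∀ {A} → ℕ → List A → Tape (Delimited A)
ahead zero    w = inputTape w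
ahead (suc p) w = moveInput right (ahead p w)

symbolAt : ∀ {A} → List A → ℕ → Delimited A
symbolAt w p = Tape.head (ahead p w)

module Compiled (A : Set) (T′ : ℕ) (L B : ℕ) (fits : ∀ n → n ≤ B → suc (length (bits n)) ≤ L)
                (w : List A) (Z : ℕ) where
  open Compilation A T′
  open Bounded L B fits
  open Semantics (symbolAt w) Z

  record Agree (k : ℕ) (σ σ′ : ℕ → ℕ) : Set where
    constructor agreeing
    field agreed : ∀ {j} → j < k → σ′ j ≡ σ j
  open Agree

  agree-trans : ∀ {k l σ σ′ σ″} → k ≤ l → Agree k σ σ′ → Agree l σ′ σ″ → Agree k σ σ″
  agree-trans k≤l p q = agreeing λ j<k → trans (agreed q (ℕ.≤-trans j<k k≤l)) (agreed p j<k)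

  agree-map : ∀ {k σ σ′ n} {e : Vec ℕ n} → VecAll (_< k) e → Agree k σ σ′ → Vec.map σ′ e ≡ Vec.map σ e
  agree-map []       h = refl
  agree-map (p ∷ ps) h = cong₂ _∷_ (agreed h p) (agree-map ps h)

  agree-update : ∀ {k σ r v} → k ≤ r → Agree k σ (σ [ r ↦ v ])
  agree-update {σ = σ} {v = v} k≤r = agreeing λ j<k → ↦-other σ v (ℕ.<⇒≢ (ℕ.<-≤-trans j<k k≤r))

  copy-loop : ∀ {i r k} d σ → r < T → k < T → ¬ k ≡ r → σ r ≤ B → σ k + d ≡ σ r →
              ∃[ σ′ ] ((i , σ) ⟨ while≢ k r (inc k) ⟩ (i , σ′) ×
                       (∀ {j} → ¬ j ≡ k → σ′ j ≡ σ j) × σ′ k ≡ σ r)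
  copy-loop zero σ p q n b e =
    σ , while≢-end q p n eq , (λ _ → refl) , eq
    where eq = trans (sym (ℕ.+-identityʳ _)) e
  copy-loop {r = r} {k} (suc d) σ p q n b e
    with copy-loop d (σ [ k ↦ suc (σ k) ]) p q n
           (subst (_≤ B) (sym (↦-other σ _ (n ∘ sym))) b)
           (trans (cong (_+ d) (↦-same σ _)) (trans (sym (ℕ.+-suc (σ k) d)) (trans e (sym (↦-other σ _ (n ∘ sym))))))
  ... | σ′ , run , same , eq =
    σ′ ,
    while≢-rep q p n (λ x → ℕ.m+1+n≢m (σ k) (trans e (sym x)))
      (inc-triple q (ℕ.≤-trans (s≤s (ℕ.m≤m+n (σ k) d)) (subst (_≤ B) (trans (sym e) (ℕ.+-suc (σ k) d)) b))) run ,
    (λ j≢k → trans (same j≢k) (↦-other σ _ j≢k)) ,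
    trans eq (↦-other σ _ (n ∘ sym))

  copy-triple : ∀ {i r k} σ → r < T → k < T → ¬ k ≡ r → σ r ≤ B →
                ∃[ σ′ ] ((i , σ) ⟨ copy r k ⟩ (i , σ′) × (∀ {j} → ¬ j ≡ k → σ′ j ≡ σ j) × σ′ k ≡ σ r)
  copy-triple {r = r} {k} σ p q n b
    with copy-loop (σ r) (σ [ k ↦ 0 ]) p q n (subst (_≤ B) (sym eq-r) b)
           (trans (cong (_+ σ r) (↦-same σ 0)) (sym eq-r))
    where eq-r = ↦-other σ 0 (n ∘ sym)
  ... | σ′ , run , same , eq =
    σ′ , clear-triple q then run , (λ j≢k → trans (same j≢k) (↦-other σ 0 j≢k)) ,
    trans eq (↦-other σ 0 (n ∘ sym))

  -- The left delimiter occurs only once, so rewinding goes on from every cell to its right; the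
  -- first component records this for the cells not yet reached.
  Rewinds : Tape (Delimited A) → Set
  Rewinds i = All (λ x → not (atStart x) ≡ true) (Tape.after i) ×
              (∀ {σ} → (i , σ) ⟨ rewind ⟩ (inputTape w , σ))

  rewinds-right : ∀ i → Rewinds i → Rewinds (moveInput right i)
  rewinds-right (tape ls x [])       h              = h
  rewinds-right (tape ls x (r ∷ rs)) (p ∷ ps , run) = ps , whileSymbol-rep p move-triple run

  rewinds : ∀ p → Rewinds (ahead p w)
  rewinds zero    = after-ok w , whileSymbol-end refl
    where
    after-ok : ∀ v → All (λ x → not (atStart x) ≡ true) (List.map letter v ++ ⊣ ∷ [])
    after-ok []      = refl ∷ []
    after-ok (_ ∷ v) = refl ∷ after-ok v
  rewinds (suc p) = rewinds-right (ahead p w) (rewinds p)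

  -- The counter k stays equal to the position of the input head, and d is the distance left.
  seek-loop : ∀ {r k} d σ → r < T → k < T → ¬ k ≡ r → σ r ≤ B → σ k + d ≡ σ r →
              ∃[ σ′ ] ((ahead (σ k) w , σ) ⟨ while≢ k r (moveHead right ⨾ inc k) ⟩ (ahead (σ r) w , σ′) ×
                       (∀ {j} → ¬ j ≡ k → σ′ j ≡ σ j))
  seek-loop {r} {k} zero σ p q n b e =
    σ , subst (λ x → (ahead (σ k) w , σ) ⟨ while≢ k r (moveHead right ⨾ inc k) ⟩ (ahead x w , σ)) eq (while≢-end q p n eq) , (λ _ → refl)
    where eq = trans (sym (ℕ.+-identityʳ _)) e
  seek-loop {r} {k} (suc d) σ p q n b e
    with seek-loop d (σ [ k ↦ suc (σ k) ]) p q n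
           (subst (_≤ B) (sym (↦-other σ _ (n ∘ sym))) b)
           (trans (cong (_+ d) (↦-same σ _)) (trans (sym (ℕ.+-suc (σ k) d)) (trans e (sym (↦-other σ _ (n ∘ sym))))))
  ... | σ′ , run , same =
    σ′ ,
    while≢-rep q p n (λ x → ℕ.m+1+n≢m (σ k) (trans e (sym x)))
      (move-triple then inc-triple q (ℕ.≤-trans (s≤s (ℕ.m≤m+n (σ k) d)) (subst (_≤ B) (trans (sym e) (ℕ.+-suc (σ k) d)) b)))
      (subst₂ (λ x y → (ahead x w , σ [ k ↦ suc (σ k) ]) ⟨ while≢ k r (moveHead right ⨾ inc k) ⟩ (ahead y w , σ′)) (↦-same σ {k} (suc (σ k))) (↦-other σ {k} {r} (suc (σ k)) (n ∘ sym)) run) ,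
    (λ j≢k → trans (same j≢k) (↦-other σ _ j≢k))

  seek-triple : ∀ {r k} σ → r < T → k < T → ¬ k ≡ r → σ r ≤ B →
                ∃[ σ′ ] ((inputTape w , σ) ⟨ clear k ⨾ while≢ k r (moveHead right ⨾ inc k) ⟩ (ahead (σ r) w , σ′) ×
                         (∀ {j} → ¬ j ≡ k → σ′ j ≡ σ j))
  seek-triple {r} {k} σ p q n b
    with seek-loop (σ r) (σ [ k ↦ 0 ]) p q n (subst (_≤ B) (sym eq-r) b)
           (trans (cong (_+ σ r) (↦-same σ 0)) (sym eq-r))
    where eq-r = ↦-other σ 0 (n ∘ sym)
  ... | σ′ , run , same =
    σ′ , clear-triple q then subst₂ (λ x y → (ahead x w , σ [ k ↦ 0 ]) ⟨ while≢ k r (moveHead right ⨾ inc k) ⟩ (ahead y w , σ′)) (↦-same σ {k} 0) (↦-other σ {k} {r} 0 (n ∘ sym)) run ,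
    (λ j≢k → trans (same j≢k) (↦-other σ 0 j≢k))

  i₀ : Tape (Delimited A)
  i₀ = inputTape w

  record Result (P : Prog) (k : ℕ) (σ : ℕ → ℕ) (v : ℕ) : Set where
    constructor result
    field
      σ′    : ℕ → ℕ
      run   : (i₀ , σ) ⟨ P ⟩ (i₀ , σ′)
      agree : Agree k σ σ′
      value : σ′ k ≡ v

  record Results (P : Prog) (k : ℕ) (σ : ℕ → ℕ) {m} (vs : Vec ℕ m) : Set where
    constructor results
    field
      σ′     : ℕ → ℕ
      run    : (i₀ , σ) ⟨ P ⟩ (i₀ , σ′)
      agree  : Agree k σ σ′
      values : Vec.map σ′ (range m k) ≡ vs

  range-< : ∀ m k → VecAll (_< k + m) (range m k)
  range-< zero    k = []
  range-< (suc m) k = ℕ.≤-trans (s≤s (ℕ.m≤m+n k m)) (ℕ.≤-reflexive (sym (ℕ.+-suc k m))) ∷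
    subst (λ l → VecAll (_< l) (range m (suc k))) (sym (ℕ.+-suc k m)) (range-< m (suc k))

  copied : ∀ {r k} σ → r < k → k < T → σ r ≤ B → Result (copy r k) k σ (σ r)
  copied σ r<k k<T b with copy-triple σ (ℕ.<-trans r<k k<T) k<T (ℕ.<⇒≢ r<k ∘ sym) b
  ... | σ′ , run , same , eq = result σ′ run (agreeing λ j<k → same (ℕ.<⇒≢ j<k)) eq

  -- `top f k ≤ T` provides the registers, and `M + growth Z f ≤ B` keeps every value within the
  -- reach of a counter.
  compiled  : ∀ {n} (f : Fun A n) {e ρ k σ M} → VecAll (_< k) e → Vec.map σ e ≡ ρ → VecAll (_≤ M) ρ →
              top f k ≤ T → M + growth Z f ≤ B → 0 < k → σ 0 ≡ Z →
              Result (compile f e k) k σ (⟦ f ⟧ ρ)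
  compiled* : ∀ {n m} (fs : Vec (Fun A n) m) {e ρ k σ M} → VecAll (_< k) e → Vec.map σ e ≡ ρ → VecAll (_≤ M) ρ →
              top* fs k ≤ T → M + growth* Z fs ≤ B → 0 < k → σ 0 ≡ Z →
              Results (compile* fs e k) k σ (⟦ fs ⟧* ρ)
  -- The loop invariant after x of the Z rounds, with d to go: 3 + k holds the number of effective
  -- rounds so far, and k the accumulator after them.
  iterated  : ∀ {n} (b f : Fun A n) (g : Fun A (2 + n)) {e ρ k M} → VecAll (_< k) e → VecAll (_≤ M) ρ →
              top (rec b f g) k ≤ T → M + growth Z (rec b f g) ≤ B → 0 < k →
              ∀ d x σ → x + d ≡ Z → Vec.map σ e ≡ ρ → σ 0 ≡ Z → σ (1 + k) ≡ ⟦ b ⟧ ρ → σ (2 + k) ≡ x →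
              σ (3 + k) ≡ ⟦ b ⟧ ρ ⊓ x → σ k ≡ recur (λ y a → ⟦ g ⟧ (y ∷ a ∷ ρ)) (⟦ f ⟧ ρ) (⟦ b ⟧ ρ ⊓ x) →
              Result (while≢ (2 + k) 0
                (if≡ (3 + k) (1 + k) skip
                  (compile g (3 + k ∷ k ∷ e) (4 + k) ⨾ copy (4 + k) k ⨾ inc (3 + k)) ⨾ inc (2 + k)))
                k σ (⟦ rec b f g ⟧ ρ)
  compiled (var i) {e} {σ = σ} {M} ek refl h t b z s =
    subst (Result _ _ _) (sym (Vec.lookup-map i σ e))
      (copied σ (VecAll.lookup⁺ ek i) t (ℕ.≤-trans (subst (_≤ M) (Vec.lookup-map i σ e) (VecAll.lookup⁺ h i)) (ℕ.≤-trans (ℕ.m≤m+n M 0) b)))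
  compiled zero {σ = σ} ek refl h t b z s = result _ (clear-triple t) (agree-update ℕ.≤-refl) (↦-same σ 0)
  compiled lim {σ = σ} {M} ek refl h t b z s =
    subst (Result _ _ _) s (copied σ z t (ℕ.≤-trans (ℕ.≤-reflexive s) (ℕ.≤-trans (ℕ.m≤n+m Z M) b)))
  compiled (suc f) {k = k} {σ} {M} ek eq h t b z s
    with compiled f ek eq h (⊔-right {suc k} t) (ℕ.≤-trans (ℕ.+-monoʳ-≤ M (ℕ.n≤1+n _)) b) z s
  ... | result σ′ run agr val =
    result _ (run then inc-triple (⊔-left {b = top f k} t)
               (ℕ.≤-trans (ℕ.≤-reflexive (cong suc val)) (ℕ.≤-trans (value-bound (symbolAt w) Z (suc f) h) b)))
      (agree-trans ℕ.≤-refl agr (agree-update ℕ.≤-refl))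
      (trans (↦-same σ′ _) (cong suc val))
  compiled (ifeq a b c d) {e} {ρ} {k} {σ} {M} ek eq h t bd z s
    with compiled a ek eq h (⊔-right {2 + k} (⊔-left t)) (ℕ.≤-trans (ℕ.+-monoʳ-≤ M (ℕ.≤-trans (ℕ.m≤m+n _ (growth Z b)) (ℕ.m≤m+n _ _))) bd) z s
  ... | result σ₁ run₁ agr₁ val₁
    with compiled b {k = suc k} (VecAll.map (λ p → ℕ.≤-trans p (ℕ.n≤1+n k)) ek) (trans (agree-map ek agr₁) eq) h
           (⊔-left (⊔-right {(2 + k) ⊔ top a k} t))
           (ℕ.≤-trans (ℕ.+-monoʳ-≤ M (ℕ.≤-trans (ℕ.m≤n+m (growth Z b) (growth Z a)) (ℕ.m≤m+n _ _))) bd)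
           (s≤s z≤n) (trans (agreed agr₁ z) s)
  ... | result σ₂ run₂ agr₂ val₂ = finish
    where
    agr : Agree k σ σ₂
    agr = agree-trans (ℕ.n≤1+n k) agr₁ agr₂
    val₁′ : σ₂ k ≡ ⟦ a ⟧ ρ
    val₁′ = trans (agreed agr₂ ℕ.≤-refl) val₁
    k<T : suc k < T
    k<T = ⊔-left {b = top a k} (⊔-left t)
    t′ : top c k ⊔ top d k ≤ T
    t′ = ⊔-right {top b (suc k)} (⊔-right {(2 + k) ⊔ top a k} t)
    branch-c = compiled c ek (trans (agree-map ek agr) eq) h (⊔-left t′)
      (ℕ.≤-trans (ℕ.+-monoʳ-≤ M (ℕ.≤-trans (ℕ.m≤m+n (growth Z c) (growth Z d)) (ℕ.m≤n+m _ (growth Z a + growth Z b)))) bd) z (trans (agreed agr z) s)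
    branch-d = compiled d ek (trans (agree-map ek agr) eq) h (⊔-right {top c k} t′)
      (ℕ.≤-trans (ℕ.+-monoʳ-≤ M (ℕ.≤-trans (ℕ.m≤n+m (growth Z d) (growth Z c)) (ℕ.m≤n+m _ (growth Z a + growth Z b)))) bd) z (trans (agreed agr z) s)
    finish : Result _ k σ (if ⟦ a ⟧ ρ ℕ.≡ᵇ ⟦ b ⟧ ρ then ⟦ c ⟧ ρ else ⟦ d ⟧ ρ)
    finish with ⟦ a ⟧ ρ ℕ.≡ᵇ ⟦ b ⟧ ρ in ab
    ... | true  = result (Result.σ′ branch-c)
      (run₁ then run₂ then if≡-true (ℕ.≤-trans (ℕ.n≤1+n _) k<T) k<T (ℕ.1+n≢n ∘ sym)
        (trans val₁′ (trans (ℕ.≡ᵇ⇒≡ _ _ (subst True (sym ab) _)) (sym val₂))) (Result.run branch-c))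
      (agree-trans ℕ.≤-refl agr (Result.agree branch-c)) (Result.value branch-c)
    ... | false = result (Result.σ′ branch-d)
      (run₁ then run₂ then if≡-false (ℕ.≤-trans (ℕ.n≤1+n _) k<T) k<T (ℕ.1+n≢n ∘ sym)
        (λ x → subst True ab (ℕ.≡⇒≡ᵇ _ _ (trans (sym val₁′) (trans x val₂)))) (Result.run branch-d))
      (agree-trans ℕ.≤-refl agr (Result.agree branch-d)) (Result.value branch-d)
  compiled (read p f) {e} {ρ} {k} {σ} {M} ek eq h t b z s
    with compiled f ek eq h (⊔-right {2 + k} t) (ℕ.≤-trans (ℕ.+-monoʳ-≤ M (ℕ.n≤1+n _)) b) z s
  ... | result σ₁ run₁ agr₁ val₁
    with seek-triple {k} {suc k} σ₁ (ℕ.≤-trans (ℕ.n≤1+n _) (⊔-left {2 + k} {top f k} t)) (⊔-left {2 + k} {top f k} t) ℕ.1+n≢n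
           (ℕ.≤-trans (ℕ.≤-reflexive val₁) (ℕ.≤-trans (value-bound (symbolAt w) Z f h) (ℕ.≤-trans (ℕ.+-monoʳ-≤ M (ℕ.n≤1+n _)) b)))
  ... | σ₂ , run₂ , same₂ = finish
    where
    k<T : k < T
    k<T = ℕ.≤-trans (ℕ.n≤1+n _) (⊔-left {2 + k} {top f k} t)
    run₂′ : ∀ {S Q} → (ahead (⟦ f ⟧ ρ) w , σ₂) ⟨ Q ⟩ S →
            (i₀ , σ₁) ⟨ clear (suc k) ⨾ while≢ (suc k) k (moveHead right ⨾ inc (suc k)) ⨾ Q ⟩ S
    run₂′ q x with run₂ x
    ... | ts , (c₁ ⨾ c₂) , x′ with subst (λ v → (ahead v w , σ₂) ⟨ _ ⟩ _) (sym val₁) q x′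
    ... | ts′ , c₃ , x″ = ts′ , c₁ ⨾ c₂ ⨾ c₃ , x″
    back : ∀ {σ} → (ahead (⟦ f ⟧ ρ) w , σ) ⟨ rewind ⟩ (i₀ , σ)
    back = proj₂ (rewinds (⟦ f ⟧ ρ))
    agr : Agree k σ σ₂
    agr = agree-trans ℕ.≤-refl agr₁ (agreeing λ j<k → same₂ (ℕ.<⇒≢ (ℕ.≤-trans j<k (ℕ.n≤1+n k))))
    1≤B : 1 ≤ B
    1≤B = ℕ.≤-trans (s≤s z≤n) (ℕ.≤-trans (ℕ.m≤n+m (suc (growth Z f)) M) b)
    finish : Result _ k σ (𝟙 (p (symbolAt w (⟦ f ⟧ ρ))))
    finish with p (symbolAt w (⟦ f ⟧ ρ)) in pw
    ... | true  = result (σ₂ [ k ↦ 0 ] [ k ↦ suc ((σ₂ [ k ↦ 0 ]) k) ])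
      (run₁ then run₂′ (symbol-true pw (back then clear-triple k<T then
        inc-triple k<T (subst (λ v → suc v ≤ B) (sym (↦-same σ₂ 0)) 1≤B))))
      (agree-trans ℕ.≤-refl agr (agree-trans ℕ.≤-refl (agree-update {σ = σ₂} ℕ.≤-refl) (agree-update {σ = σ₂ [ k ↦ 0 ]} ℕ.≤-refl)))
      (trans (↦-same (σ₂ [ k ↦ 0 ]) {k} _) (cong suc (↦-same σ₂ {k} 0)))
    ... | false = result (σ₂ [ k ↦ 0 ])
      (run₁ then run₂′ (symbol-false pw (back then clear-triple k<T)))
      (agree-trans ℕ.≤-refl agr (agree-update ℕ.≤-refl)) (↦-same σ₂ 0)
  compiled (rec b f g) {e} {ρ} {k} {σ} {M} ek eq h t bd z s
    with compiled f ek eq h (⊔-left (⊔-right {5 + k} t))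
           (ℕ.≤-trans (ℕ.+-monoʳ-≤ M (ℕ.≤-trans (ℕ.m≤n+m _ (Z + growth Z b)) (ℕ.m≤m+n _ (Z * growth Z g)))) bd) z s
  ... | result σ₁ run₁ agr₁ val₁
    with compiled b {k = suc k} (VecAll.map (λ p → ℕ.≤-trans p (ℕ.n≤1+n k)) ek) (trans (agree-map ek agr₁) eq) h
           (⊔-left (⊔-right {top f k} (⊔-right {5 + k} t)))
           (ℕ.≤-trans (ℕ.+-monoʳ-≤ M (ℕ.≤-trans (ℕ.m≤n+m _ Z) (ℕ.≤-trans (ℕ.m≤m+n _ (growth Z f)) (ℕ.m≤m+n _ (Z * growth Z g))))) bd)
           (s≤s z≤n) (trans (agreed agr₁ z) s)
  ... | result σ₂ run₂ agr₂ val₂ =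
    result (Result.σ′ it)
      (run₁ then run₂ then clear-triple (k+ 2 (s≤s (s≤s (s≤s z≤n)))) then clear-triple (k+ 3 (s≤s (s≤s (s≤s (s≤s z≤n))))) then Result.run it)
      (agree-trans ℕ.≤-refl agr₄ (Result.agree it)) (Result.value it)
    where
    σ₃ = σ₂ [ 2 + k ↦ 0 ]
    σ₄ = σ₃ [ 3 + k ↦ 0 ]
    k+ : ∀ c → suc c ≤ 5 → c + k < T
    k+ c p = ℕ.≤-trans (ℕ.+-monoˡ-≤ k p) (⊔-left {5 + k} {top f k ⊔ (top b (suc k) ⊔ top g (4 + k))} t)
    agr₂₄ : Agree (2 + k) σ₂ σ₄
    agr₂₄ = agree-trans (ℕ.n≤1+n _) (agree-update {σ = σ₂} ℕ.≤-refl) (agree-update {σ = σ₃} ℕ.≤-refl)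
    agr₄ : Agree k σ σ₄
    agr₄ = agree-trans (ℕ.n≤1+n k) agr₁ (agree-trans (ℕ.n≤1+n (suc k)) agr₂ agr₂₄)
    it = iterated b f g ek h t bd z Z 0 σ₄ refl (trans (agree-map ek agr₄) eq) (trans (agreed agr₄ z) s)
           (trans (agreed agr₂₄ ℕ.≤-refl) val₂)
           (trans (↦-other σ₃ {3 + k} {2 + k} 0 (ℕ.1+n≢n ∘ sym)) (↦-same σ₂ {2 + k} 0))
           (trans (↦-same σ₃ {3 + k} 0) (sym (ℕ.⊓-zeroʳ (⟦ b ⟧ ρ))))
           (trans (agreed agr₂₄ (ℕ.n≤1+n _)) (trans (agreed agr₂ ℕ.≤-refl) (trans val₁ (cong (recur _ _) (sym (ℕ.⊓-zeroʳ (⟦ b ⟧ ρ)))))))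
  compiled (comp {m} f gs) {e} {ρ} {k} {σ} {M} ek eq h t bd z s
    with compiled* gs {k = suc k} (VecAll.map (λ p → ℕ.≤-trans p (ℕ.n≤1+n k)) ek) eq h
           (⊔-left (⊔-right {2 + (k + m)} t)) (ℕ.≤-trans (ℕ.+-monoʳ-≤ M (ℕ.m≤m+n _ _)) bd) (s≤s z≤n) s
  ... | results σ₁ run₁ agr₁ val₁
    with compiled f {k = suc (k + m)} (range-< m (suc k)) val₁ (value-bound* (symbolAt w) Z gs h)
           (⊔-right {top* gs (suc k)} (⊔-right {2 + (k + m)} t))
           (ℕ.≤-trans (ℕ.≤-reflexive (ℕ.+-assoc M _ _)) bd) (s≤s z≤n) (trans (agreed agr₁ (s≤s z≤n)) s)
  ... | result σ₂ run₂ agr₂ val₂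
    with copy-triple σ₂ (⊔-left {2 + (k + m)} {top* gs (suc k) ⊔ top f (suc (k + m))} t) (ℕ.≤-trans (s≤s (ℕ.m≤m+n k m)) (ℕ.≤-trans (ℕ.n≤1+n _) (⊔-left {2 + (k + m)} {top* gs (suc k) ⊔ top f (suc (k + m))} t)))
           (ℕ.<⇒≢ (s≤s (ℕ.m≤m+n k m)))
           (ℕ.≤-trans (ℕ.≤-reflexive val₂) (ℕ.≤-trans (value-bound (symbolAt w) Z (comp f gs) h) bd))
  ... | σ₃ , run₃ , same₃ , val₃ =
    result σ₃ (run₁ then run₂ then run₃)
      (agreeing λ j<k → trans (same₃ (ℕ.<⇒≢ j<k)) (trans (agreed agr₂ (ℕ.≤-trans j<k (ℕ.≤-trans (ℕ.m≤m+n k m) (ℕ.n≤1+n _)))) (agreed agr₁ (ℕ.≤-trans j<k (ℕ.n≤1+n k)))))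
      (trans val₃ val₂)
  compiled* [] ek eq h t b z s = results _ skip-triple (agreeing λ _ → refl) refl
  compiled* (g ∷ gs) {k = k} {σ} {M} ek eq h t b z s
    with compiled g ek eq h (⊔-left t) (ℕ.≤-trans (ℕ.+-monoʳ-≤ M (ℕ.m≤m+n _ _)) b) z s
  ... | result σ₁ run₁ agr₁ val₁
    with compiled* gs {k = suc k} (VecAll.map (λ p → ℕ.≤-trans p (ℕ.n≤1+n k)) ek) (trans (agree-map ek agr₁) eq) h
           (⊔-right {top g k} t) (ℕ.≤-trans (ℕ.+-monoʳ-≤ M (ℕ.m≤n+m _ (growth Z g))) b) (s≤s z≤n) (trans (agreed agr₁ z) s)
  ... | results σ₂ run₂ agr₂ val₂ =
    results σ₂ (run₁ then run₂) (agree-trans (ℕ.n≤1+n k) agr₁ agr₂) (cong₂ _∷_ (trans (agreed agr₂ ℕ.≤-refl) val₁) val₂)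
  iterated b f g {e} {ρ} {k} {M} ek h t bd z zero x σ x+d eq s vb vx vy va =
    result σ (while≢-end (k+ 2 (s≤s (s≤s (s≤s z≤n)))) (ℕ.≤-trans z (ℕ.≤-trans (ℕ.m≤n+m k 5) (⊔-left {5 + k} {top f k ⊔ (top b (suc k) ⊔ top g (4 + k))} t))) (λ ()) (trans vx (trans x≡Z (sym s))))
      (agreeing λ _ → refl) (trans va (cong (λ v → recur _ _ (⟦ b ⟧ ρ ⊓ v)) x≡Z))
    where
    x≡Z : x ≡ Z
    x≡Z = trans (sym (ℕ.+-identityʳ x)) x+d
    k+ : ∀ c → suc c ≤ 5 → c + k < T
    k+ c p = ℕ.≤-trans (ℕ.+-monoˡ-≤ k p) (⊔-left {5 + k} {top f k ⊔ (top b (suc k) ⊔ top g (4 + k))} t)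
  iterated b f g {e} {ρ} {k} {M} ek h t bd z (suc d) x σ x+d eq s vb vx vy va = finish (⟦ b ⟧ ρ ℕ.≤? x)
    where
    R : ℕ → ℕ
    R = recur (λ y a → ⟦ g ⟧ (y ∷ a ∷ ρ)) (⟦ f ⟧ ρ)
    k+ : ∀ c → suc c ≤ 5 → c + k < T
    k+ c p = ℕ.≤-trans (ℕ.+-monoˡ-≤ k p) (⊔-left {5 + k} {top f k ⊔ (top b (suc k) ⊔ top g (4 + k))} t)
    x<Z : x < Z
    x<Z = ℕ.≤-trans (s≤s (ℕ.m≤m+n x d)) (ℕ.≤-reflexive (trans (sym (ℕ.+-suc x d)) x+d))
    Z≤B : Z ≤ B
    Z≤B = ℕ.≤-trans (ℕ.≤-trans (ℕ.m≤m+n Z (growth Z b)) (ℕ.≤-trans (ℕ.m≤m+n _ (growth Z f)) (ℕ.≤-trans (ℕ.m≤m+n _ (Z * growth Z g)) (ℕ.m≤n+m _ M)))) bd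
    k<2+k : k < 2 + k
    k<2+k = ℕ.n≤1+n (suc k)
    loop-on : ¬ σ (2 + k) ≡ σ 0
    loop-on q = ℕ.<⇒≢ x<Z (trans (sym vx) (trans q s))
    0<T : 0 < T
    0<T = s≤s z≤n
    again : ∀ σ₁ → Agree k σ σ₁ → σ₁ (1 + k) ≡ σ (1 + k) → σ₁ (2 + k) ≡ σ (2 + k) →
            σ₁ (3 + k) ≡ ⟦ b ⟧ ρ ⊓ suc x → σ₁ k ≡ R (⟦ b ⟧ ρ ⊓ suc x) →
            (i₀ , σ) ⟨ if≡ (3 + k) (1 + k) skip
              (compile g (3 + k ∷ k ∷ e) (4 + k) ⨾ copy (4 + k) k ⨾ inc (3 + k)) ⟩ (i₀ , σ₁) →
            Result _ k σ (⟦ rec b f g ⟧ ρ)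
    again σ₁ a0 a1 a2 a3 a4 run with iterated b f g ek h t bd z d (suc x) (σ₁ [ 2 + k ↦ suc (σ₁ (2 + k)) ])
        (trans (sym (ℕ.+-suc x d)) x+d)
        (trans (agree-map ek (agree-trans {k} {k} ℕ.≤-refl a0 (agree-update (ℕ.m≤n+m k 2)))) eq)
        (trans (↦-other σ₁ {2 + k} {0} (suc (σ₁ (2 + k))) (λ ())) (trans (agreed a0 z) s))
        (trans (↦-other σ₁ _ (ℕ.1+n≢n ∘ sym)) (trans a1 vb))
        (trans (↦-same σ₁ _) (cong suc (trans a2 vx)))
        (trans (↦-other σ₁ _ ℕ.1+n≢n) a3)
        (trans (↦-other σ₁ _ (ℕ.<⇒≢ k<2+k)) a4)
    ... | result σ₂ run₂ agr₂ val₂ =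
      result σ₂
        (while≢-rep (k+ 2 (s≤s (s≤s (s≤s z≤n)))) 0<T (λ ()) loop-on
          (run then inc-triple (k+ 2 (s≤s (s≤s (s≤s z≤n)))) (ℕ.≤-trans (ℕ.≤-reflexive (cong suc (trans a2 vx))) (ℕ.≤-trans x<Z Z≤B))) run₂)
        (agree-trans {k} {k} ℕ.≤-refl (agree-trans {k} {k} ℕ.≤-refl a0 (agree-update (ℕ.m≤n+m k 2))) agr₂) val₂
    3≢1 : ¬ 3 + k ≡ 1 + k
    3≢1 q = ℕ.<⇒≢ k<2+k (sym (ℕ.suc-injective q))
    finish : _ → Result _ k σ (⟦ rec b f g ⟧ ρ)
    finish (yes b≤x) = again σ (agreeing λ _ → refl) refl refl
      (trans vy min) (trans va (cong R min))
      (if≡-true (k+ 3 (s≤s (s≤s (s≤s (s≤s z≤n))))) (k+ 1 (s≤s (s≤s z≤n))) 3≢1 (trans vy (trans (ℕ.m≤n⇒m⊓n≡m b≤x) (sym vb))) skip-triple)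
      where
      min : ⟦ b ⟧ ρ ⊓ x ≡ ⟦ b ⟧ ρ ⊓ suc x
      min = trans (ℕ.m≤n⇒m⊓n≡m b≤x) (sym (ℕ.m≤n⇒m⊓n≡m (ℕ.≤-trans b≤x (ℕ.n≤1+n x))))
    finish (no b≰x) = step₁ (compiled g {k = 4 + k} env-k env-val (step-env (symbolAt w) Z b f g h x (ℕ.<⇒≤ x<Z))
        (⊔-right {top b (suc k)} (⊔-right {top f k} (⊔-right {5 + k} t))) bound (s≤s z≤n) s)
      where
      min : ⟦ b ⟧ ρ ⊓ x ≡ x
      min = ℕ.m≥n⇒m⊓n≡n (ℕ.≰⇒≥ b≰x)
      min′ : ⟦ b ⟧ ρ ⊓ suc x ≡ suc x
      min′ = ℕ.m≥n⇒m⊓n≡n (ℕ.≰⇒> b≰x)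
      env-k : VecAll (_< 4 + k) (3 + k ∷ k ∷ e)
      env-k = ℕ.≤-refl ∷ ℕ.m≤n+m (suc k) 3 ∷ VecAll.map (λ p → ℕ.≤-trans p (ℕ.m≤n+m k 4)) ek
      env-val : Vec.map σ (3 + k ∷ k ∷ e) ≡ x ∷ R x ∷ ρ
      env-val = cong₂ _∷_ (trans vy min) (cong₂ _∷_ (trans va (cong R min)) eq)
      bound : step-bound (symbolAt w) Z b f g M x + growth Z g ≤ B
      bound = ℕ.≤-trans (ℕ.≤-reflexive (trans (ℕ.+-assoc M _ _) (cong (M +_) (trans (ℕ.+-assoc ((Z + growth Z b) + growth Z f) _ _) (cong (((Z + growth Z b) + growth Z f) +_) (ℕ.+-comm (x * growth Z g) (growth Z g)))))))
        (ℕ.≤-trans (ℕ.+-monoʳ-≤ M (ℕ.+-monoʳ-≤ ((Z + growth Z b) + growth Z f) (ℕ.*-monoˡ-≤ (growth Z g) x<Z))) bd)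
      step₁ : Result (compile g (3 + k ∷ k ∷ e) (4 + k)) (4 + k) σ (⟦ g ⟧ (x ∷ R x ∷ ρ)) → Result _ k σ (⟦ rec b f g ⟧ ρ)
      step₁ (result σ₁ run₁ agr₁ val₁)
        with copy-triple σ₁ (k+ 4 ℕ.≤-refl) (k+ 0 (s≤s z≤n)) (ℕ.<⇒≢ (ℕ.m≤n+m (suc k) 3))
               (ℕ.≤-trans (ℕ.≤-reflexive val₁) (ℕ.≤-trans (value-bound (symbolAt w) Z g (step-env (symbolAt w) Z b f g h x (ℕ.<⇒≤ x<Z))) bound))
      ... | σ₂ , run₂ , same₂ , val₂ =
        again (σ₂ [ 3 + k ↦ suc (σ₂ (3 + k)) ])
          (agreeing λ j<k → trans (↦-other σ₂ _ (ℕ.<⇒≢ (ℕ.≤-trans j<k (ℕ.m≤n+m k 3)))) (keep (ℕ.<⇒≢ j<k) (ℕ.≤-trans j<k (ℕ.m≤n+m k 4))))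
          (trans (↦-other σ₂ _ (3≢1 ∘ sym)) (keep ℕ.1+n≢n (ℕ.≤-trans (ℕ.n≤1+n _) (ℕ.n≤1+n _))))
          (trans (↦-other σ₂ _ (ℕ.1+n≢n ∘ sym)) (keep (ℕ.<⇒≢ k<2+k ∘ sym) (ℕ.n≤1+n _)))
          (trans (↦-same σ₂ _) (trans (cong suc y-val) (sym min′)))
          (trans (↦-other σ₂ _ (ℕ.<⇒≢ (ℕ.m≤n+m (suc k) 2))) (trans val₂ (trans val₁ (cong R (sym min′)))))
          (if≡-false (k+ 3 (s≤s (s≤s (s≤s (s≤s z≤n))))) (k+ 1 (s≤s (s≤s z≤n))) 3≢1
            (λ q → b≰x (ℕ.≤-reflexive (trans (sym vb) (trans (sym q) (trans vy min)))))
            (run₁ then run₂ then inc-triple (k+ 3 (s≤s (s≤s (s≤s (s≤s z≤n))))) (subst (λ v → suc v ≤ B) (sym y-val) (ℕ.≤-trans x<Z Z≤B))))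
        where
        keep : ∀ {j} → ¬ j ≡ k → j < 4 + k → σ₂ j ≡ σ j
        keep n p = trans (same₂ n) (agreed agr₁ p)
        y-val : σ₂ (3 + k) ≡ x
        y-val = trans (keep (ℕ.<⇒≢ (ℕ.m≤n+m (suc k) 2) ∘ sym) ℕ.≤-refl) (trans vy min)

-- Logarithms and input symbols by position

n<2^[1+⌊log₂n⌋] : ∀ n → n < 2 ^ suc ⌊log₂ n ⌋
n<2^[1+⌊log₂n⌋] n = ℕ.≰⇒> λ p →
  ℕ.1+n≰n (subst (_≤ ⌊log₂ n ⌋) (⌊log₂[2^n]⌋≡n (suc ⌊log₂ n ⌋)) (⌊log₂⌋-mono-≤ p))

2^⌊log₂n⌋≤n : ∀ n → 1 ≤ n → 2 ^ ⌊log₂ n ⌋ ≤ n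
2^⌊log₂n⌋≤n = <-rec _ go
  where
  go : ∀ n → (∀ {m} → m < n → 1 ≤ m → 2 ^ ⌊log₂ m ⌋ ≤ m) → 1 ≤ n → 2 ^ ⌊log₂ n ⌋ ≤ n
  go (suc zero)    ih p = s≤s z≤n
  go n@(suc (suc m)) ih p = begin
    2 ^ ⌊log₂ n ⌋             ≡⟨ cong (2 ^_) (sym (ℕ.m+[n∸m]≡n {1} (⌊log₂⌋-mono-≤ {2} {n} (s≤s (s≤s z≤n))))) ⟩
    2 ^ suc (⌊log₂ n ⌋ ℕ.∸ 1)  ≡⟨ cong (λ l → 2 ^ suc l) (sym (⌊log₂⌊n/2⌋⌋≡⌊log₂n⌋∸1 n)) ⟩
    2 * 2 ^ ⌊log₂ h ⌋          ≤⟨ ℕ.*-monoʳ-≤ 2 (ih (ℕ.⌊n/2⌋<n (suc m)) (s≤s z≤n)) ⟩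
    h + (h + 0)                ≡⟨ cong (h +_) (ℕ.+-identityʳ h) ⟩
    h + h                      ≤⟨ ℕ.+-monoʳ-≤ h (ℕ.⌊n/2⌋≤⌈n/2⌉ n) ⟩
    h + ℕ.⌈ n /2⌉              ≡⟨ ℕ.⌊n/2⌋+⌈n/2⌉≡n n ⟩
    n                          ∎
    where
    open ℕ.≤-Reasoning
    h = ℕ.⌊ n /2⌋

delimited : ∀ {A} → List A → List (Delimited A)
delimited w = ⊢ ∷ (List.map letter w ++ ⊣ ∷ [])

-- The default is the right delimiter, as the input head stays on it.
nth : ∀ {A} → List (Delimited A) → ℕ → Delimited A
nth []       p       = ⊣
nth (x ∷ xs) zero    = x
nth (x ∷ xs) (suc p) = nth xs p

nth-drop : ∀ {A} {r : Delimited A} {rs} p xs → drop p xs ≡ r ∷ rs → nth xs p ≡ r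
nth-drop zero    (x ∷ xs) refl = refl
nth-drop (suc p) (x ∷ xs) e    = nth-drop p xs e

drop-suc : ∀ {A : Set} {r : A} {rs} p xs → drop p xs ≡ r ∷ rs → drop (suc p) xs ≡ rs
drop-suc zero    (x ∷ xs) refl = refl
drop-suc (suc p) (x ∷ xs) e    = drop-suc p xs e

nth-beyond : ∀ {A} p (xs : List (Delimited A)) → drop p xs ≡ [] → nth xs p ≡ ⊣
nth-beyond zero    []       e = refl
nth-beyond (suc p) []       e = refl
nth-beyond (suc p) (x ∷ xs) e = nth-beyond p xs e

drop-suc-[] : ∀ {A : Set} p (xs : List A) → drop p xs ≡ [] → drop (suc p) xs ≡ []
drop-suc-[] zero    []       e = refl
drop-suc-[] (suc p) []       e = refl
drop-suc-[] (suc p) (x ∷ xs) e = drop-suc-[] p xs e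

nth-last : ∀ {A} p (xs : List (Delimited A)) → drop (suc p) (xs ++ ⊣ ∷ []) ≡ [] → nth (xs ++ ⊣ ∷ []) p ≡ ⊣
nth-last zero    []           e = refl
nth-last (suc p) []           e = refl
nth-last zero    (x ∷ [])     ()
nth-last zero    (x ∷ y ∷ xs) ()
nth-last (suc p) (x ∷ xs)     e = nth-last p xs e

-- The symbol under the head does not determine the next one, so the induction carries the cells to
-- its right along.
ahead-spec : ∀ {A} (w : List A) p →
             Tape.head (ahead p w) ≡ nth (delimited w) p × Tape.after (ahead p w) ≡ drop (suc p) (delimited w)
ahead-spec w zero    = refl , refl
ahead-spec w (suc p) with ahead p w | ahead-spec w p
... | tape ls x []       | h , a = trans h (trans (nth-last p (⊢ ∷ List.map letter w) (sym a)) (sym (nth-beyond (suc p) (delimited w) (sym a)))) ,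
                                   sym (drop-suc-[] (suc p) (delimited w) (sym a))
... | tape ls x (r ∷ rs) | h , a = sym (nth-drop (suc p) (delimited w) (sym a)) , sym (drop-suc (suc p) (delimited w) (sym a))

symbolAt-nth : ∀ {A} (w : List A) p → symbolAt w p ≡ nth (delimited w) p
symbolAt-nth w p = proj₁ (ahead-spec w p)

-- The complete machine and its space bound

module Startup (A : Set) (T′ : ℕ) where
  open Compilation A T′

  measure : Prog
  measure = whileSymbol (not ∘ atEnd) (inc 1 ⨾ moveHead right) ⨾ rewind

  -- Adds to register 0 the d-th power of register 1, by d nested loops
  -- with counters from c on.
  addPower : ℕ → ℕ → Prog
  addPower zero    c = inc 0
  addPower (suc d) c = clear c ⨾ while≢ c 1 (addPower d (suc c) ⨾ inc c)

  -- The first action writes the home marks. Register 1 first holds the length plus 1 and later the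
  -- value of `f`. A verdict sees only the symbols under the heads, so the answer is signalled by
  -- moving the input head off the left delimiter.
  whole : Fun A 0 → ℕ → Prog
  whole f d =
    act (λ _ _ → stay , Vec.replicate T (home , stay)) ⨾
    measure ⨾ addPower d 2 ⨾ compile f [] 1 ⨾ clear 2 ⨾ inc 2 ⨾ if≡ 1 2 (moveHead right) skip

  accepting : Observer Bool
  accepting x _ = not (atStart x)

  module _ (L B : ℕ) (fits : ∀ n → n ≤ B → suc (length (bits n)) ≤ L)
           (w : List A) (d : ℕ) (f : Fun A 0)
           (1≤B : 1 ≤ B) (N≤B : suc (length w) ≤ B) (Z≤B : suc (length w) ^ d ≤ B)
           (growth≤B : growth (suc (length w) ^ d) f ≤ B)
           (top≤T : top f 1 ≤ T) (d<T : 3 + d ≤ T) where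
    open Bounded L B fits
    open Compiled A T′ L B fits w (suc (length w) ^ d)
    open Semantics (symbolAt w) (suc (length w) ^ d)

    private
      n : ℕ
      n = suc (length w)

      1<T : 1 < T
      1<T = ℕ.≤-trans (s≤s (s≤s z≤n)) d<T

      2<T : 2 < T
      2<T = ℕ.≤-trans (s≤s (s≤s (s≤s z≤n))) d<T

      not-end : ∀ p → p < n → not (atEnd (symbolAt w p)) ≡ true
      not-end p q rewrite symbolAt-nth w p = lemma p q
        where
        inner : ∀ v p → p < length v → not (atEnd (nth (List.map letter v ++ ⊣ ∷ []) p)) ≡ true
        inner (x ∷ v) zero    q       = refl
        inner (x ∷ v) (suc p) (s≤s q) = inner v p q
        lemma : ∀ p → p < n → not (atEnd (nth (delimited w) p)) ≡ true
        lemma zero    q       = refl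
        lemma (suc p) (s≤s q) = inner w p q

      at-end : not (atEnd (symbolAt w n)) ≡ false
      at-end rewrite symbolAt-nth w n = lemma w
        where
        lemma : ∀ v → not (atEnd (nth (List.map letter v ++ ⊣ ∷ []) (length v))) ≡ false
        lemma []      = refl
        lemma (x ∷ v) = lemma v

    -- The left delimiter is counted too, which makes the base of the limit length + 1.
    measure-loop : ∀ d p σ → p + d ≡ n → σ 1 ≡ p →
                   ∃[ σ′ ] ((ahead p w , σ) ⟨ whileSymbol (not ∘ atEnd) (inc 1 ⨾ moveHead right) ⟩ (ahead n w , σ′) ×
                            (∀ {j} → ¬ j ≡ 1 → σ′ j ≡ σ j) × σ′ 1 ≡ n)
    measure-loop zero p σ e s with trans (sym (ℕ.+-identityʳ p)) e
    ... | refl = σ , whileSymbol-end at-end , (λ _ → refl) , s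
    measure-loop (suc d) p σ e s
      with measure-loop d (suc p) (σ [ 1 ↦ suc (σ 1) ]) (trans (sym (ℕ.+-suc p d)) e) (cong suc s)
    ... | σ′ , run , same , val =
      σ′ , whileSymbol-rep (not-end p p<n)
             (inc-triple 1<T (ℕ.≤-trans (subst (λ v → suc v ≤ n) (sym s) p<n) N≤B) then move-triple) run ,
      (λ j≢1 → trans (same j≢1) (↦-other σ _ j≢1)) , val
      where
      p<n : p < n
      p<n = ℕ.≤-trans (s≤s (ℕ.m≤m+n p d)) (ℕ.≤-reflexive (trans (sym (ℕ.+-suc p d)) e))

    -- Registers 1 to c - 1 hold the length and the counters of the enclosing loops and have to
    -- survive; only register 0 accumulates.
    PowerSpec : ℕ → Set
    PowerSpec d = ∀ c σ → 2 ≤ c → c + d ≤ T → σ 1 ≡ n → σ 0 + n ^ d ≤ B →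
                  ∃[ σ′ ] ((i₀ , σ) ⟨ addPower d c ⟩ (i₀ , σ′) ×
                           (∀ {j} → j < c → ¬ j ≡ 0 → σ′ j ≡ σ j) × σ′ 0 ≡ σ 0 + n ^ d)

    power-loop : ∀ d → PowerSpec d → ∀ r c x σ → 2 ≤ c → c + suc d ≤ T → σ 1 ≡ n → σ c ≡ x → x + r ≡ n →
                 σ 0 + r * n ^ d ≤ B →
                 ∃[ σ′ ] ((i₀ , σ) ⟨ while≢ c 1 (addPower d (suc c) ⨾ inc c) ⟩ (i₀ , σ′) ×
                          (∀ {j} → j < c → ¬ j ≡ 0 → σ′ j ≡ σ j) × σ′ 0 ≡ σ 0 + r * n ^ d)
    power-loop d spec zero c x σ 2≤c ct s1 sc e b =
      σ , while≢-end (ℕ.≤-trans (ℕ.m≤m+n (suc c) d) (ℕ.≤-trans (ℕ.≤-reflexive (sym (ℕ.+-suc c d))) ct)) 1<T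
            (λ { refl → ℕ.1+n≰n 2≤c }) (trans sc (trans (sym (ℕ.+-identityʳ x)) (trans e (sym s1)))) ,
      (λ _ _ → refl) , sym (ℕ.+-identityʳ _)
    power-loop d spec (suc r) c x σ 2≤c ct s1 sc e b = after-body
      (spec (suc c) σ (ℕ.≤-trans 2≤c (ℕ.n≤1+n c)) (ℕ.≤-trans (ℕ.≤-reflexive (sym (ℕ.+-suc c d))) ct) s1
        (ℕ.≤-trans (ℕ.+-monoʳ-≤ (σ 0) (ℕ.m≤m+n (n ^ d) (r * n ^ d))) b))
      where
      c<T : c < T
      c<T = ℕ.≤-trans (ℕ.m≤m+n (suc c) d) (ℕ.≤-trans (ℕ.≤-reflexive (sym (ℕ.+-suc c d))) ct)
      c≢1 : ¬ c ≡ 1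
      c≢1 refl = ℕ.1+n≰n 2≤c
      c≢0 : ¬ c ≡ 0
      c≢0 refl = contradiction 2≤c λ ()
      x<n : x < n
      x<n = ℕ.≤-trans (s≤s (ℕ.m≤m+n x r)) (ℕ.≤-reflexive (trans (sym (ℕ.+-suc x r)) e))
      after-body : ∃[ σ′ ] ((i₀ , σ) ⟨ addPower d (suc c) ⟩ (i₀ , σ′) ×
                            (∀ {j} → j < suc c → ¬ j ≡ 0 → σ′ j ≡ σ j) × σ′ 0 ≡ σ 0 + n ^ d) →
                   ∃[ σ′ ] ((i₀ , σ) ⟨ while≢ c 1 (addPower d (suc c) ⨾ inc c) ⟩ (i₀ , σ′) ×
                            (∀ {j} → j < c → ¬ j ≡ 0 → σ′ j ≡ σ j) × σ′ 0 ≡ σ 0 + suc r * n ^ d)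
      after-body (σ₁ , run₁ , same₁ , val₁) with power-loop d spec r c (suc x) (σ₁ [ c ↦ suc (σ₁ c) ]) 2≤c ct
          (trans (↦-other σ₁ {c} {1} _ (c≢1 ∘ sym)) (trans (same₁ (ℕ.≤-trans 2≤c (ℕ.n≤1+n c)) (λ ())) s1))
          (trans (↦-same σ₁ {c} _) (cong suc (trans (same₁ ℕ.≤-refl c≢0) sc)))
          (trans (sym (ℕ.+-suc x r)) e)
          (subst (λ v → v + r * n ^ d ≤ B) (sym (trans (↦-other σ₁ {c} {0} _ (c≢0 ∘ sym)) val₁))
            (ℕ.≤-trans (ℕ.≤-reflexive (ℕ.+-assoc (σ 0) _ _)) b))
      ... | σ₂ , run₂ , same₂ , val₂ =
        σ₂ , while≢-rep c<T 1<T c≢1 (λ q → ℕ.<⇒≢ x<n (trans (sym sc) (trans q s1)))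
               (run₁ then inc-triple c<T (subst (λ v → suc v ≤ B) (sym (trans (same₁ ℕ.≤-refl c≢0) sc)) (ℕ.≤-trans x<n N≤B))) run₂ ,
        (λ j<c j≢0 → trans (same₂ j<c j≢0) (trans (↦-other σ₁ _ (ℕ.<⇒≢ j<c)) (same₁ (ℕ.≤-trans j<c (ℕ.n≤1+n c)) j≢0))) ,
        trans val₂ (trans (cong (_+ r * n ^ d) (trans (↦-other σ₁ {c} {0} _ (c≢0 ∘ sym)) val₁)) (ℕ.+-assoc (σ 0) _ _))

    power : ∀ d → PowerSpec d
    power zero c σ 2≤c ct s1 b =
      σ [ 0 ↦ suc (σ 0) ] , inc-triple (s≤s z≤n) (ℕ.≤-trans (ℕ.≤-reflexive (sym (ℕ.+-comm (σ 0) 1))) b) ,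
      (λ _ j≢0 → ↦-other σ _ j≢0) , sym (ℕ.+-comm (σ 0) 1)
    power (suc d) c σ 2≤c ct s1 b with power-loop d (power d) n c 0 (σ [ c ↦ 0 ]) 2≤c ct
        (trans (↦-other σ {c} {1} 0 (c≢1 ∘ sym)) s1) (↦-same σ {c} 0) refl
        (subst (λ v → v + n ^ suc d ≤ B) (sym (↦-other σ {c} {0} 0 (c≢0 ∘ sym))) b)
      where
      c≢1 : ¬ c ≡ 1
      c≢1 refl = ℕ.1+n≰n 2≤c
      c≢0 : ¬ c ≡ 0
      c≢0 refl = contradiction 2≤c λ ()
    ... | σ₁ , run₁ , same₁ , val₁ =
      σ₁ , clear-triple c<T then run₁ ,
      (λ j<c j≢0 → trans (same₁ j<c j≢0) (↦-other σ 0 (ℕ.<⇒≢ j<c))) ,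
      trans val₁ (cong (_+ n ^ suc d) (↦-other σ {c} {0} 0 (λ { refl → contradiction 2≤c λ () })))
      where
      c<T : c < T
      c<T = ℕ.≤-trans (ℕ.m≤m+n (suc c) d) (ℕ.≤-trans (ℕ.≤-reflexive (sym (ℕ.+-suc c d))) ct)

    Outcome : Set
    Outcome = ∃[ ts ] (∃[ i ] (Exec N (whole f d) (i₀ , Vec.replicate T (tape [] (dig nothing) [])) (i , ts) ×
                               not (atStart (Tape.head i)) ≡ (⟦ f ⟧ [] ℕ.≡ᵇ 1)) ×
                       cellCount ts ≤ N)

    whole-run : Outcome
    whole-run with measure-loop n 0 (λ _ → 0) refl refl
    ... | σ₁ , run₁ , same₁ , val₁ with power d 2 σ₁ ℕ.≤-refl (ℕ.≤-trans (ℕ.n≤1+n (2 + d)) d<T) val₁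
                                          (subst (λ v → v + n ^ d ≤ B) (sym (same₁ (λ ()))) Z≤B)
    ... | σ₂ , run₂ , same₂ , val₂ with compiled f {[]} {[]} {1} {σ₂} {0} [] refl [] top≤T growth≤B (s≤s z≤n) (trans val₂ (cong (_+ n ^ d) (same₁ (λ ()))))
    ... | result σ₃ run₃ agr₃ val₃ = conclude
      where
      σ₄ = σ₃ [ 2 ↦ 0 ] [ 2 ↦ 1 ]
      P₀ = act (λ _ _ → stay , Vec.replicate T (home , stay))
      ts₀ = Vec.replicate T (tape [] (dig nothing) [])
      small₀ : Small ts₀
      small₀ = mkSmall λ j → subst (λ t → cells t ≤ suc L) (sym (Vec.lookup-replicate j _)) (s≤s z≤n)
      ts₁ = Vec.zipWith moveTape (Vec.replicate T (home , stay)) ts₀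
      ready : Rep (λ _ → 0) ts₁
      ready = mkRep λ {j} _ → counter 0
        (trans (Vec.lookup-zipWith moveTape (reg j) (Vec.replicate T (home , stay)) ts₀)
          (cong₂ moveTape (Vec.lookup-replicate (reg j) (home , stay)) (Vec.lookup-replicate (reg j) (tape [] (dig nothing) []))))
        z≤n z≤n
      start : Exec N P₀ (i₀ , ts₀) (i₀ , ts₁)
      start = act (small-space small₀)
      prefix : ∀ {S Q} → (i₀ , σ₄) ⟨ Q ⟩ S →
             (i₀ , λ _ → 0) ⟨ measure ⨾ addPower d 2 ⨾ compile f [] 1 ⨾ clear 2 ⨾ inc 2 ⨾ Q ⟩ S
      prefix q = (run₁ then proj₂ (rewinds n)) then run₂ then run₃ then clear-triple 2<T then inc-triple 2<T 1≤B then q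
      assemble : ∀ {i σ} → (i₀ , λ _ → 0) ⟨ measure ⨾ addPower d 2 ⨾ compile f [] 1 ⨾ clear 2 ⨾ inc 2 ⨾ if≡ 1 2 (moveHead right) skip ⟩ (i , σ) →
                 not (atStart (Tape.head i)) ≡ (⟦ f ⟧ [] ℕ.≡ᵇ 1) → Outcome
      assemble t e with t ready
      ... | ts , x , r = ts , _ , (start ⨾ x , e) , small-space (rep-small r)
      moved : not (atStart (symbolAt w 1)) ≡ true
      moved rewrite symbolAt-nth w 1 = lemma w
        where
        lemma : ∀ v → not (atStart (nth (List.map letter v ++ ⊣ ∷ []) 0)) ≡ true
        lemma []      = refl
        lemma (_ ∷ _) = refl
      conclude : Outcome
      conclude with ⟦ f ⟧ [] ℕ.≟ 1
      ... | yes e = assemble {σ = σ₄} (prefix (if≡-true 1<T 2<T (λ ()) (trans val₃ e) move-triple))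
                      (trans moved (cong (ℕ._≡ᵇ 1) (sym e)))
      ... | no ne = assemble {σ = σ₄} (prefix (if≡-false 1<T 2<T (λ ()) (ne ∘ trans (sym val₃)) skip-triple)) (sym (≢⇒≡ᵇ (⟦ f ⟧ []) ne))
        where
        ≢⇒≡ᵇ : ∀ m → ¬ m ≡ 1 → (m ℕ.≡ᵇ 1) ≡ false
        ≢⇒≡ᵇ zero          ne = refl
        ≢⇒≡ᵇ (suc zero)    ne = contradiction refl ne
        ≢⇒≡ᵇ (suc (suc _)) ne = refl

    whole-halts : HaltsWithin (machine finite-Mark (whole f d) accepting) N (⟦ f ⟧ [] ℕ.≡ᵇ 1)
                    (initial (machine finite-Mark (whole f d) accepting) w)
    whole-halts = halting whole-run
      where
      halting : Outcome → _
      halting (ts , i , (x , e) , s) =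
        subst (λ b → HaltsWithin (machine finite-Mark (whole f d) accepting) N b
                       (initial (machine finite-Mark (whole f d) accepting) w)) e
          (machine-halts finite-Mark (whole f d) accepting w x s)

-- An affine bound in the logarithm l becomes a multiple of l once l ≥ 1, that is, from input length
-- 2 on.
space-slope : ∀ T E l → 1 ≤ l → T * (3 + suc l * E) ≤ (T * (3 + 2 * E)) * l
space-slope T E l 1≤l = begin
  T * (3 + (E + l * E))       ≤⟨ ℕ.*-monoʳ-≤ T (begin
    3 + (E + l * E)             ≤⟨ ℕ.+-mono-≤ (ℕ.m≤m*n 3 l {{ℕ.>-nonZero 1≤l}}) (ℕ.+-monoˡ-≤ (l * E) (ℕ.m≤n*m E l {{ℕ.>-nonZero 1≤l}})) ⟩
    3 * l + (l * E + l * E)     ≡⟨ cong (λ v → 3 * l + (v + v)) (ℕ.*-comm l E) ⟩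
    3 * l + (E * l + E * l)     ≡⟨ cong (3 * l +_) (sym (trans (cong (λ v → (E + v) * l) (ℕ.+-identityʳ E)) (ℕ.*-distribʳ-+ l E E))) ⟩
    3 * l + (2 * E) * l         ≡⟨ sym (ℕ.*-distribʳ-+ l 3 (2 * E)) ⟩
    (3 + 2 * E) * l             ∎) ⟩
  T * ((3 + 2 * E) * l)       ≡⟨ sym (ℕ.*-assoc T (3 + 2 * E) l) ⟩
  (T * (3 + 2 * E)) * l       ∎
  where open ℕ.≤-Reasoning

-- Everything that occurs is at most Y ^ exponent f d.
exponent : ∀ {A} → Fun A 0 → ℕ → ℕ
exponent f d = (2 + d) * suc (growth-exponent f)

module _ {A : Set} (f : Fun A 0) (d : ℕ) {N Y : ℕ} (1≤N : 1 ≤ N) (N≤Y : N ≤ Y) (2≤Y : 2 ≤ Y) where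
  private
    instance
      Y≢0 : ℕ.NonZero Y
      Y≢0 = ℕ.>-nonZero (ℕ.≤-trans 1≤N N≤Y)

    2+d≤E : 2 + d ≤ exponent f d
    2+d≤E = ℕ.m≤m*n (2 + d) (suc (growth-exponent f))

    -- `growth≤` is applied with base Y ^ (2 + d), which has to be at least 2 and at least the limit
    -- N ^ d; bounding the sum gives both.
    X≤ : 2 + N ^ d ≤ Y ^ (2 + d)
    X≤ = begin
      2 + N ^ d             ≤⟨ ℕ.+-mono-≤ (ℕ.≤-trans 2≤Y (ℕ.m≤m*n Y (Y ^ d) {{ℕ.m^n≢0 Y d}})) (ℕ.≤-trans (ℕ.^-monoˡ-≤ d N≤Y) (ℕ.m≤n*m (Y ^ d) Y)) ⟩
      Y * Y ^ d + Y * Y ^ d ≡⟨ cong (Y * Y ^ d +_) (sym (ℕ.+-identityʳ _)) ⟩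
      2 * (Y * Y ^ d)       ≤⟨ ℕ.*-monoˡ-≤ (Y * Y ^ d) 2≤Y ⟩
      Y * (Y * Y ^ d)       ∎
      where open ℕ.≤-Reasoning

  1≤Y^E : 1 ≤ Y ^ exponent f d
  1≤Y^E = ℕ.m^n>0 Y (exponent f d)

  N≤Y^E : N ≤ Y ^ exponent f d
  N≤Y^E = ℕ.≤-trans N≤Y (ℕ.≤-trans (ℕ.≤-reflexive (sym (ℕ.*-identityʳ Y))) (ℕ.^-monoʳ-≤ Y (ℕ.≤-trans (s≤s z≤n) 2+d≤E)))

  N^d≤Y^E : N ^ d ≤ Y ^ exponent f d
  N^d≤Y^E = ℕ.≤-trans (ℕ.^-monoˡ-≤ d N≤Y) (ℕ.^-monoʳ-≤ Y (ℕ.≤-trans (ℕ.m≤n+m d 2) 2+d≤E))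

  growth≤Y^E : growth (N ^ d) f ≤ Y ^ exponent f d
  growth≤Y^E = begin
    growth (N ^ d) f                    ≤⟨ growth≤ {N ^ d} {Y ^ (2 + d)} (ℕ.≤-trans (ℕ.m≤n+m (N ^ d) 2) X≤) (ℕ.≤-trans (ℕ.m≤m+n 2 (N ^ d)) X≤) f ⟩
    (Y ^ (2 + d)) ^ growth-exponent f   ≡⟨ ℕ.^-*-assoc Y (2 + d) (growth-exponent f) ⟩
    Y ^ ((2 + d) * growth-exponent f)   ≤⟨ ℕ.^-monoʳ-≤ Y (ℕ.*-monoʳ-≤ (2 + d) (ℕ.n≤1+n (growth-exponent f))) ⟩
    Y ^ exponent f d                    ∎
    where open ℕ.≤-Reasoning

-- A value equal to 2 ^ (l * E) has l * E + 1 bits; the other successor is the cell for the blank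
-- behind them.
fits-power : ∀ l E m → m ≤ (2 ^ l) ^ E → suc (length (bits m)) ≤ suc (suc (l * E))
fits-power l E m m≤B = s≤s (length-bits (begin-strict
  m                 ≤⟨ m≤B ⟩
  (2 ^ l) ^ E       ≡⟨ ℕ.^-*-assoc 2 l E ⟩
  2 ^ (l * E)       <⟨ ℕ.^-monoʳ-< 2 (s≤s (s≤s z≤n)) (ℕ.n<1+n (l * E)) ⟩
  2 ^ suc (l * E)   ∎))
  where open ℕ.≤-Reasoning

module Decider {A : Set} (f : Fun A 0) (d T′ : ℕ) (top≤T : top f 1 ≤ suc T′) (d<T : 3 + d ≤ suc T′) where

  decider : Machine A
  decider = Compilation.machine A T′ finite-Mark (Startup.whole A T′ f d) (Startup.accepting A T′)

  bound : ℕ → ℕ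
  bound n = suc T′ * suc (suc (suc (suc ⌊log₂ n ⌋ * exponent f d)))

  -- The bound on values is a power of a power of two above the input length, so that the length of
  -- the counters is linear in the logarithm.
  decider-halts : ∀ w → HaltsWithin decider (bound (length w))
                          (Semantics.⟦_⟧ (symbolAt w) (suc (length w) ^ d) f [] ℕ.≡ᵇ 1) (initial decider w)
  decider-halts w =
    Startup.whole-halts A T′ (suc (suc (suc ⌊log₂ length w ⌋ * exponent f d))) ((2 ^ suc ⌊log₂ length w ⌋) ^ exponent f d)
      (fits-power (suc ⌊log₂ length w ⌋) (exponent f d)) w d f
      (1≤Y^E f d (s≤s z≤n) N≤Y 2≤Y) (N≤Y^E f d (s≤s z≤n) N≤Y 2≤Y) (N^d≤Y^E f d (s≤s z≤n) N≤Y 2≤Y)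
      (growth≤Y^E f d (s≤s z≤n) N≤Y 2≤Y) top≤T d<T
    where
    N≤Y : suc (length w) ≤ 2 ^ suc ⌊log₂ length w ⌋
    N≤Y = n<2^[1+⌊log₂n⌋] (length w)
    2≤Y : 2 ≤ 2 ^ suc ⌊log₂ length w ⌋
    2≤Y = ℕ.*-monoʳ-≤ 2 (ℕ.m^n>0 2 ⌊log₂ length w ⌋)

inL : ∀ {A : Set} {a} (P : DecisionProblem A a) (f : Fun A 0) (d : ℕ) → let open DecisionProblem P in
      (∀ x → Semantics.Holds (symbolAt (encode x)) (suc (length (encode x)) ^ d) f [] ⇔ Yes x) → InL P
inL P f d correct =
  decider , (λ x → bound (length (encode x))) ,
  (suc T′ * (3 + 2 * exponent f d) , 2 ,
   λ x p → space-slope (suc T′) (exponent f d) ⌊log₂ length (encode x) ⌋ (⌊log₂⌋-mono-≤ p)) ,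
  λ x → _ , decider-halts (encode x) , mk⇔
    (λ e → Equivalence.to (correct x) (Semantics.holding (ℕ.≡ᵇ⇒≡ _ 1 (Equivalence.from Bool.T-≡ e))))
    (λ y → Equivalence.to Bool.T-≡ (ℕ.≡⇒≡ᵇ _ 1 (Semantics.value-one (Equivalence.from (correct x) y))))
  where
  open DecisionProblem P
  T′ = top f 1 ⊔ (3 + d)
  open Decider f d T′ (ℕ.≤-trans (ℕ.m≤m⊔n (top f 1) (3 + d)) (ℕ.n≤1+n T′)) (ℕ.≤-trans (ℕ.m≤n⊔m (top f 1) (3 + d)) (ℕ.n≤1+n T′))

-- Bounded counting and formulas

open Equivalence using (to; from)

count : ℕ → (ℕ → Bool) → ℕ
count zero    p = 0
count (suc n) p = 𝟙 (p n) + count n p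

count-cong : ∀ n {p q} → (∀ {j} → j < n → p j ≡ q j) → count n p ≡ count n q
count-cong zero    h = refl
count-cong (suc n) h = cong₂ _+_ (cong 𝟙 (h ℕ.≤-refl)) (count-cong n (λ j<n → h (ℕ.m≤n⇒m≤1+n j<n)))

count-false : ∀ n {p} → (∀ {j} → j < n → p j ≡ false) → count n p ≡ 0
count-false zero    h = refl
count-false (suc n) h = cong₂ _+_ (cong 𝟙 (h ℕ.≤-refl)) (count-false n (λ j<n → h (ℕ.m≤n⇒m≤1+n j<n)))

count≡0 : ∀ n {p} → count n p ≡ 0 → ∀ {j} → j < n → p j ≡ false
count≡0 (suc n) {p} e {j} j<n with p n in pn
... | false with ℕ.m≤n⇒m<n∨m≡n (ℕ.≤-pred j<n)
...   | inj₁ j<n′ = count≡0 n e j<n′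
...   | inj₂ refl = pn

count≢0 : ∀ n {p} → ¬ count n p ≡ 0 → ∃[ j ] (j < n × p j ≡ true)
count≢0 zero        h = contradiction refl h
count≢0 (suc n) {p} h with p n in pn
... | true  = n , ℕ.≤-refl , pn
... | false with count≢0 n h
...   | j , j<n , e = j , ℕ.m≤n⇒m≤1+n j<n , e

count-+ : ∀ m n p → count (m + n) p ≡ count m (λ i → p (i + n)) + count n p
count-+ zero    n p = refl
count-+ (suc m) n p = trans (cong (𝟙 (p (m + n)) +_) (count-+ m n p)) (sym (ℕ.+-assoc (𝟙 (p (m + n))) _ _))

≡ᵇ-true : ∀ {m n} → m ≡ n → (m ≡ᵇ n) ≡ true
≡ᵇ-true {zero}  refl = refl
≡ᵇ-true {suc m} refl = ≡ᵇ-true {m} refl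

≡ᵇ-false : ∀ {m n} → ¬ m ≡ n → (m ≡ᵇ n) ≡ false
≡ᵇ-false {zero}  {zero}  h = contradiction refl h
≡ᵇ-false {zero}  {suc n} h = refl
≡ᵇ-false {suc m} {zero}  h = refl
≡ᵇ-false {suc m} {suc n} h = ≡ᵇ-false (h ∘ cong suc)

≡ᵇ-≡ : ∀ {m n} → (m ≡ᵇ n) ≡ true → m ≡ n
≡ᵇ-≡ {m} {n} e = ℕ.≡ᵇ⇒≡ m n (subst True (sym e) _)

𝟙-true : ∀ {b} → 𝟙 b ≡ 1 ⇔ b ≡ true
𝟙-true {true}  = mk⇔ (λ _ → refl) (λ _ → refl)
𝟙-true {false} = mk⇔ (λ ()) (λ ())

𝟙≡ᵇ1 : ∀ b → (𝟙 b ≡ᵇ 1) ≡ b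
𝟙≡ᵇ1 true  = refl
𝟙≡ᵇ1 false = refl

-- A formula is a function that has the value 1 where it holds.

module _ {A : Set} where

  const : ∀ {n} → ℕ → Fun A n
  const zero    = zero
  const (suc m) = suc (const m)

  notF : ∀ {n} → Fun A n → Fun A n
  notF a = ifeq a (const 1) zero (const 1)

  infixr 6 _∧F_
  infixr 5 _⇒F_
  infix 7 _≡F_
  _∧F_ _⇒F_ _≡F_ _∨F_ : ∀ {n} → Fun A n → Fun A n → Fun A n
  a ∧F b = ifeq a (const 1) b zero
  a ⇒F b = ifeq a (const 1) b (const 1)
  a ∨F b = ifeq a (const 1) (const 1) b
  a ≡F b = ifeq a b (const 1) zero

  -- Inside the recursion the accumulator stands between the counter and the arguments; the
  -- composition drops it, so that `f` sees its bound variable followed by the arguments.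
  -- Quantifiers are tests of a count against 0.
  countF allF existsF : ∀ {n} → Fun A n → Fun A (suc n) → Fun A n
  countF b f = rec b zero
    (ifeq (comp f (var Fin.zero ∷ Vec.tabulate (λ i → var (Fin.suc (Fin.suc i))))) (const 1)
      (suc (var (Fin.suc Fin.zero))) (var (Fin.suc Fin.zero)))
  allF b f = countF b (notF f) ≡F zero
  existsF b f = notF (countF b f ≡F zero)

module Formulas {A : Set} (symbol : ℕ → Delimited A) (Z : ℕ) where
  open Semantics symbol Z public

  holds? : ∀ {n} (f : Fun A n) ρ → Dec (Holds f ρ)
  holds? f ρ = map′ holding value-one (⟦ f ⟧ ρ ℕ.≟ 1)

  const-value : ∀ {n} m (ρ : Vec ℕ n) → ⟦ const m ⟧ ρ ≡ m
  const-value zero    ρ = refl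
  const-value (suc m) ρ = cong suc (const-value m ρ)

  vars-value : ∀ {n k} (g : Fin k → Fin n) (ρ : Vec ℕ n) →
               ⟦ Vec.tabulate (λ i → var (g i)) ⟧* ρ ≡ Vec.tabulate (λ i → lookup ρ (g i))
  vars-value {k = zero}  g ρ = refl
  vars-value {k = suc k} g ρ = cong (lookup ρ (g Fin.zero) ∷_) (vars-value (g ∘ Fin.suc) ρ)

  module _ {n : ℕ} {ρ : Vec ℕ n} where

    holds-not : ∀ {a} → Holds (notF a) ρ ⇔ (¬ Holds a ρ)
    holds-not {a} with ⟦ a ⟧ ρ ℕ.≟ 1
    ... | yes e = mk⇔ (λ (holding h) → contradiction (trans (sym (cong (λ v → if v then 0 else 1) (≡ᵇ-true e))) h) λ ())
                      (λ h → contradiction (holding e) h)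
    ... | no ne = mk⇔ (λ _ → ne ∘ value-one) (λ _ → holding (cong (λ v → if v then 0 else 1) (≡ᵇ-false ne)))

    private
      ifeq-true : ∀ {a b c d : Fun A n} → ⟦ a ⟧ ρ ≡ ⟦ b ⟧ ρ → Holds (ifeq a b c d) ρ ⇔ Holds c ρ
      ifeq-true {c = c} {d} e = mk⇔ (λ (holding h) → holding (trans (sym eq) h)) (λ (holding h) → holding (trans eq h))
        where eq = cong (λ v → if v then ⟦ c ⟧ ρ else ⟦ d ⟧ ρ) (≡ᵇ-true e)

      ifeq-false : ∀ {a b c d : Fun A n} → ¬ ⟦ a ⟧ ρ ≡ ⟦ b ⟧ ρ → Holds (ifeq a b c d) ρ ⇔ Holds d ρ
      ifeq-false {c = c} {d} e = mk⇔ (λ (holding h) → holding (trans (sym eq) h)) (λ (holding h) → holding (trans eq h))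
        where eq = cong (λ v → if v then ⟦ c ⟧ ρ else ⟦ d ⟧ ρ) (≡ᵇ-false e)

    holds-∧ : ∀ {a b} → Holds (a ∧F b) ρ ⇔ (Holds a ρ × Holds b ρ)
    holds-∧ {a} with ⟦ a ⟧ ρ ℕ.≟ 1
    ... | yes e = mk⇔ (λ h → holding e , to (ifeq-true e) h) (from (ifeq-true e) ∘ proj₂)
    ... | no ne = mk⇔ (λ h → contradiction (value-one (to (ifeq-false ne) h)) λ ()) (λ h → contradiction (value-one (proj₁ h)) ne)

    holds-⇒ : ∀ {a b} → Holds (a ⇒F b) ρ ⇔ (Holds a ρ → Holds b ρ)
    holds-⇒ {a} with ⟦ a ⟧ ρ ℕ.≟ 1
    ... | yes e = mk⇔ (λ h _ → to (ifeq-true e) h) (λ h → from (ifeq-true e) (h (holding e)))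
    ... | no ne = mk⇔ (λ _ h → contradiction (value-one h) ne) (λ _ → from (ifeq-false ne) (holding refl))

    holds-∨ : ∀ {a b} → Holds (a ∨F b) ρ ⇔ (Holds a ρ ⊎ Holds b ρ)
    holds-∨ {a} with ⟦ a ⟧ ρ ℕ.≟ 1
    ... | yes e = mk⇔ (λ _ → inj₁ (holding e)) (λ _ → from (ifeq-true e) (holding refl))
    ... | no ne = mk⇔ (inj₂ ∘ to (ifeq-false ne)) λ { (inj₁ h) → contradiction (value-one h) ne ; (inj₂ h) → from (ifeq-false ne) h }

    holds-≡ : ∀ {a b} → Holds (a ≡F b) ρ ⇔ ⟦ a ⟧ ρ ≡ ⟦ b ⟧ ρ
    holds-≡ {a} {b} with ⟦ a ⟧ ρ ℕ.≟ ⟦ b ⟧ ρ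
    ... | yes e = mk⇔ (λ _ → e) (λ _ → from (ifeq-true e) (holding refl))
    ... | no ne = mk⇔ (λ h → contradiction (value-one (to (ifeq-false ne) h)) λ ()) (λ h → contradiction h ne)

    countF-value : ∀ {b f} → ⟦ b ⟧ ρ ≤ Z →
                   ⟦ countF b f ⟧ ρ ≡ count (⟦ b ⟧ ρ) (λ j → ⟦ f ⟧ (j ∷ ρ) ≡ᵇ 1)
    countF-value {b} {f} h = trans (cong (recur _ _) (ℕ.m≤n⇒m⊓n≡m h)) (steps (⟦ b ⟧ ρ))
      where
      env : ∀ y a → ⟦ Vec.tabulate (λ i → var (Fin.suc (Fin.suc i))) ⟧* (y ∷ a ∷ ρ) ≡ ρ
      env y a = trans (vars-value (λ i → Fin.suc (Fin.suc i)) (y ∷ a ∷ ρ)) (Vec.tabulate∘lookup ρ)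
      choose : ∀ b c → (if b then suc c else c) ≡ 𝟙 b + c
      choose true  c = refl
      choose false c = refl
      body-value : ℕ → ℕ → ℕ
      body-value y a = if ⟦ f ⟧ (y ∷ ⟦ Vec.tabulate (λ i → var (Fin.suc (Fin.suc i))) ⟧* (y ∷ a ∷ ρ)) ≡ᵇ 1 then suc a else a
      steps : ∀ m → recur body-value 0 m ≡ count m (λ j → ⟦ f ⟧ (j ∷ ρ) ≡ᵇ 1)
      steps zero    = refl
      steps (suc m) =
        trans (cong (λ v → if ⟦ f ⟧ (m ∷ v) ≡ᵇ 1 then suc (recur body-value 0 m) else recur body-value 0 m)
                    (env m (recur body-value 0 m)))
          (trans (choose (⟦ f ⟧ (m ∷ ρ) ≡ᵇ 1) (recur body-value 0 m)) (cong (𝟙 (⟦ f ⟧ (m ∷ ρ) ≡ᵇ 1) +_) (steps m)))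

  module _ {n : ℕ} {ρ : Vec ℕ n} where

    holds-all : ∀ {b f} → ⟦ b ⟧ ρ ≤ Z → Holds (allF b f) ρ ⇔ (∀ {j} → j < ⟦ b ⟧ ρ → Holds f (j ∷ ρ))
    holds-all {b} {f} h = mk⇔
      (λ e {j} j<b → [ id , (λ nf →
        contradiction (trans (sym (count≡0 (⟦ b ⟧ ρ) (trans (sym (countF-value {b = b} {notF f} h)) (to holds-≡ e)) j<b))
                             (≡ᵇ-true (value-one (from holds-not nf)))) λ ()) ]′ (toSum (holds? f (j ∷ ρ))))
      (λ hf → from holds-≡ (trans (countF-value {b = b} {notF f} h)
        (count-false (⟦ b ⟧ ρ) (λ {j} j<b → ≡ᵇ-false (λ e → to holds-not (holding e) (hf j<b))))))

    holds-exists : ∀ {b f} → ⟦ b ⟧ ρ ≤ Z → Holds (existsF b f) ρ ⇔ (∃[ j ] (j < ⟦ b ⟧ ρ × Holds f (j ∷ ρ)))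
    holds-exists {b} {f} h = mk⇔
      (λ e → let j , j<b , t = count≢0 (⟦ b ⟧ ρ) (λ c → to holds-not e (from holds-≡ (trans (countF-value {b = b} {f} h) c)))
             in j , j<b , holding (≡ᵇ-≡ t))
      (λ (j , j<b , hf) → from holds-not λ c →
        contradiction (trans (sym (≡ᵇ-true (value-one hf))) (count≡0 (⟦ b ⟧ ρ) (trans (sym (countF-value {b = b} {f} h)) (to holds-≡ c)) j<b)) λ ())

-- Arithmetic

-- These follow the recursions of the formulas below, so that each formula agrees with its function
-- once the cap is removed.
mod3 div3 parity half : ℕ → ℕ
mod3   = recur (λ _ a → if a ≡ᵇ 2 then 0 else suc a) 0
div3   = recur (λ y a → if mod3 y ≡ᵇ 2 then suc a else a) 0
parity = recur (λ _ a → if a ≡ᵇ 0 then 1 else 0) 0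
half   = recur (λ y a → if parity y ≡ᵇ 1 then suc a else a) 0

mod3-+3 : ∀ m → mod3 m < 3 → mod3 (3 + m) ≡ mod3 m
mod3-+3 m h with mod3 m
... | 0 = refl
... | 1 = refl
... | 2 = refl
mod3-+3 m (s≤s (s≤s (s≤s ()))) | suc (suc (suc _))

mod3<3 : ∀ m → mod3 m < 3
mod3<3 zero    = s≤s z≤n
mod3<3 (suc m) with mod3 m | mod3<3 m
... | 0 | h = s≤s (s≤s z≤n)
... | 1 | h = s≤s (s≤s (s≤s z≤n))
... | 2 | h = s≤s z≤n
... | suc (suc (suc _)) | s≤s (s≤s (s≤s ()))

div3-+3 : ∀ m → div3 (3 + m) ≡ suc (div3 m)
div3-+3 m with mod3 m | mod3<3 m
... | 0 | h = refl
... | 1 | h = refl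
... | 2 | h = refl
... | suc (suc (suc _)) | s≤s (s≤s (s≤s ()))

mod3-digit : ∀ l m → l < 3 → mod3 (m * 3 + l) ≡ l
mod3-digit 0 zero h = refl
mod3-digit 1 zero h = refl
mod3-digit 2 zero h = refl
mod3-digit (suc (suc (suc l))) zero (s≤s (s≤s (s≤s ())))
mod3-digit l (suc m) h = trans (mod3-+3 (m * 3 + l) (mod3<3 (m * 3 + l))) (mod3-digit l m h)

div3-digit : ∀ l m → l < 3 → div3 (m * 3 + l) ≡ m
div3-digit 0 zero h = refl
div3-digit 1 zero h = refl
div3-digit 2 zero h = refl
div3-digit (suc (suc (suc l))) zero (s≤s (s≤s (s≤s ())))
div3-digit l (suc m) h = trans (div3-+3 (m * 3 + l)) (cong suc (div3-digit l m h))

div3≤ : ∀ m → div3 m ≤ m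
div3≤ zero    = z≤n
div3≤ (suc m) with mod3 m ≡ᵇ 2
... | true  = s≤s (div3≤ m)
... | false = ℕ.m≤n⇒m≤1+n (div3≤ m)

parity≤1 : ∀ m → parity m ≤ 1
parity≤1 zero    = z≤n
parity≤1 (suc m) with parity m ≡ᵇ 0
... | true  = ℕ.≤-refl
... | false = z≤n

parity-half : ∀ m → m ≡ parity m + (half m + half m)
parity-half zero    = refl
parity-half (suc m) with parity m | parity≤1 m | parity-half m
... | 0 | _ | e = cong suc e
... | 1 | _ | e = cong suc (trans e (sym (ℕ.+-suc (half m) (half m))))
... | suc (suc _) | s≤s () | e

parity-suc : ∀ m → suc (parity m + parity (suc m)) ≡ 2
parity-suc m with parity m | parity≤1 m
... | 0 | _ = refl
... | 1 | _ = refl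
... | suc (suc _) | s≤s ()

-- `half (suc m)` is half of m rounded up.
half-suc : ∀ m → m + parity m ≡ half (suc m) + half (suc m)
half-suc m = ℕ.suc-injective (ℕ.+-cancelʳ-≡ (parity (suc m)) _ _ (begin
  suc (m + parity m + parity (suc m))           ≡⟨ cong suc (ℕ.+-assoc m _ _) ⟩
  suc (m + (parity m + parity (suc m)))         ≡⟨ cong (λ v → suc (m + v)) (ℕ.suc-injective (parity-suc m)) ⟩
  suc (m + 1)                                   ≡⟨ cong suc (ℕ.+-comm m 1) ⟩
  suc (suc m)                                   ≡⟨ cong suc (parity-half (suc m)) ⟩
  suc (parity (suc m) + (half (suc m) + half (suc m))) ≡⟨ cong suc (ℕ.+-comm (parity (suc m)) _) ⟩
  suc (half (suc m) + half (suc m) + parity (suc m))   ∎))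
  where open ≡-Reasoning

-- Between even numbers a surplus of 1 on the right decides nothing.
double-≤ : ∀ {r u v} → r ≤ 1 → u + u ≤ r + (v + v) ⇔ u ≤ v
double-≤ {r} {u} {v} r≤1 = mk⇔
  (λ p → ℕ.≮⇒≥ λ v<u → ℕ.<-irrefl refl (begin-strict
    u + u         ≤⟨ p ⟩
    r + (v + v)   ≤⟨ ℕ.+-monoˡ-≤ (v + v) r≤1 ⟩
    suc (v + v)   <⟨ s≤s (ℕ.≤-reflexive (sym (ℕ.+-suc v v))) ⟩
    suc v + suc v ≤⟨ ℕ.+-mono-≤ v<u v<u ⟩
    u + u         ∎))
  (λ p → ℕ.≤-trans (ℕ.+-mono-≤ p p) (ℕ.m≤n+m (v + v) r))
  where open ℕ.≤-Reasoning

half≤ : ∀ {m k} → m ≤ suc (k + k) → half m ≤ k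
half≤ {m} {k} p = to (double-≤ {1} {half m} {k} ℕ.≤-refl)
  (ℕ.≤-trans (ℕ.≤-trans (ℕ.m≤n+m _ (parity m)) (ℕ.≤-reflexive (sym (parity-half m)))) p)

-- One step of the comparison of b + 2 y and a + 2 x from the lowest bit:
-- adding the parity of b on both sides makes the left side even.
compare-step : ∀ a b x y →
               b + (y + y) ≤ a + (x + x) ⇔ half (suc b) + y ≤ half (a + parity b) + x
compare-step a b x y = mk⇔
  (λ p → to (double-≤ (parity≤1 c)) (subst₂ _≤_ lhs rhs (ℕ.+-monoˡ-≤ (parity b) p)))
  (λ p → ℕ.+-cancelʳ-≤ (parity b) _ _ (subst₂ _≤_ (sym lhs) (sym rhs) (from (double-≤ (parity≤1 c)) p)))
  where
  c = a + parity b
  g = half c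
  h = half (suc b)
  shuffle : ∀ a y p → a + (y + y) + p ≡ (a + p) + (y + y)
  shuffle = solve-∀
  merge : ∀ h y → (h + h) + (y + y) ≡ (h + y) + (h + y)
  merge = solve-∀
  lhs : b + (y + y) + parity b ≡ (h + y) + (h + y)
  lhs = trans (shuffle b y (parity b)) (trans (cong (_+ (y + y)) (half-suc b)) (merge h y))
  rhs : a + (x + x) + parity b ≡ parity c + ((g + x) + (g + x))
  rhs = trans (shuffle a x (parity b)) (trans (cong (_+ (x + x)) (parity-half c))
          (trans (ℕ.+-assoc (parity c) _ _) (cong (parity c +_) (merge g x))))

module _ {A : Set} where

  v₀ : ∀ {n} → Fun A (1 + n)
  v₀ = var Fin.0F
  v₁ : ∀ {n} → Fun A (2 + n)
  v₁ = var Fin.1F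
  v₂ : ∀ {n} → Fun A (3 + n)
  v₂ = var Fin.2F
  v₃ : ∀ {n} → Fun A (4 + n)
  v₃ = var Fin.3F
  v₄ : ∀ {n} → Fun A (5 + n)
  v₄ = var Fin.4F
  v₅ : ∀ {n} → Fun A (6 + n)
  v₅ = var Fin.5F
  v₆ : ∀ {n} → Fun A (7 + n)
  v₆ = var Fin.6F
  v₇ : ∀ {n} → Fun A (8 + n)
  v₇ = var Fin.7F
  v₈ : ∀ {n} → Fun A (9 + n)
  v₈ = var Fin.8F

  mod3F div3F parityF halfF : Fun A 1
  mod3F   = rec v₀ zero (ifeq v₁ (const 2) zero (suc v₁))
  div3F   = rec v₀ zero (ifeq (comp mod3F (v₀ ∷ [])) (const 2) (suc v₁) v₁)
  parityF = rec v₀ zero (ifeq v₁ zero (const 1) zero)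
  halfF   = rec v₀ zero (ifeq (comp parityF (v₀ ∷ [])) (const 1) (suc v₁) v₁)

  addF leqF : Fun A 2
  addF = rec v₁ v₀ (suc v₁)
  leqF = existsF (suc v₁) (v₀ ≡F v₁)

  scaleF : ℕ → Fun A 1
  scaleF zero    = zero
  scaleF (suc c) = comp addF (scaleF c ∷ v₀ ∷ [])

  -- The position reached from the first argument by skipping symbols that
  -- satisfy p, at most as many as the second argument says.
  skipF : (Delimited A → Bool) → Fun A 2
  skipF p = rec v₁ v₀ (ifeq (read p v₁) (const 1) (suc v₁) v₁)

recur-cong : ∀ {g h : ℕ → ℕ → ℕ} a y → (∀ {x} b → x < y → g x b ≡ h x b) → recur g a y ≡ recur h a y
recur-cong a zero    e = refl
recur-cong {g} {h} a (suc y) e = trans (e _ ℕ.≤-refl) (cong (h y) (recur-cong a y (λ b x<y → e b (ℕ.m≤n⇒m≤1+n x<y))))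

recur-suc : ∀ x y → recur (λ _ → suc) x y ≡ x + y
recur-suc x zero    = sym (ℕ.+-identityʳ x)
recur-suc x (suc y) = trans (cong suc (recur-suc x y)) (sym (ℕ.+-suc x y))

skip-value : ∀ {A} → (ℕ → Delimited A) → (Delimited A → Bool) → ℕ → ℕ → ℕ
skip-value symbol p = recur (λ _ a → if p (symbol a) then suc a else a)

module Arithmetic {A : Set} (symbol : ℕ → Delimited A) (Z : ℕ) where
  open Formulas symbol Z public

  mod3F-value : ∀ {m} → m ≤ Z → ⟦ mod3F ⟧ (m ∷ []) ≡ mod3 m
  mod3F-value h = cong (recur _ _) (ℕ.m≤n⇒m⊓n≡m h)

  div3F-value : ∀ {m} → m ≤ Z → ⟦ div3F ⟧ (m ∷ []) ≡ div3 m
  div3F-value {m} h = trans (cong (recur _ _) (ℕ.m≤n⇒m⊓n≡m h))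
    (recur-cong 0 m (λ {x} b x<m → cong (λ v → if v ≡ᵇ 2 then suc b else b) (mod3F-value {x} (ℕ.≤-trans (ℕ.<⇒≤ x<m) h))))

  parityF-value : ∀ {m} → m ≤ Z → ⟦ parityF ⟧ (m ∷ []) ≡ parity m
  parityF-value h = cong (recur _ _) (ℕ.m≤n⇒m⊓n≡m h)

  halfF-value : ∀ {m} → m ≤ Z → ⟦ halfF ⟧ (m ∷ []) ≡ half m
  halfF-value {m} h = trans (cong (recur _ _) (ℕ.m≤n⇒m⊓n≡m h))
    (recur-cong 0 m (λ {x} b x<m → cong (λ v → if v ≡ᵇ 1 then suc b else b) (parityF-value {x} (ℕ.≤-trans (ℕ.<⇒≤ x<m) h))))

  addF-value : ∀ {x y} → y ≤ Z → ⟦ addF ⟧ (x ∷ y ∷ []) ≡ x + y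
  addF-value {x} {y} h = trans (cong (recur _ _) (ℕ.m≤n⇒m⊓n≡m h)) (recur-suc x y)

  scaleF-value : ∀ c {x} → x ≤ Z → ⟦ scaleF c ⟧ (x ∷ []) ≡ c * x
  scaleF-value zero    h = refl
  scaleF-value (suc c) {x} h = trans (addF-value h) (trans (cong (_+ x) (scaleF-value c h)) (ℕ.+-comm (c * x) x))

  holds-leq : ∀ {x y} → suc y ≤ Z → Holds leqF (x ∷ y ∷ []) ⇔ x ≤ y
  holds-leq {x} {y} h = mk⇔
    (λ e → let j , j<y , q = to (holds-exists h) e in ℕ.≤-trans (ℕ.≤-reflexive (sym (to holds-≡ q))) (ℕ.≤-pred j<y))
    (λ x≤y → from (holds-exists h) (x , s≤s x≤y , from holds-≡ refl))

  skipF-value : ∀ p {x y} → y ≤ Z → ⟦ skipF p ⟧ (x ∷ y ∷ []) ≡ skip-value symbol p x y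
  skipF-value p {x} {y} h = trans (cong (recur _ _) (ℕ.m≤n⇒m⊓n≡m h))
    (recur-cong x y (λ b _ → cong (λ v → if v then suc b else b) (𝟙≡ᵇ1 (p (symbol b)))))

-- Comparison with binary numbers read from the input

bitAt : List Bool → ℕ → Bool
bitAt []       i       = false
bitAt (b ∷ bs) zero    = b
bitAt (b ∷ bs) (suc i) = bitAt bs i

fromBits-drop : ∀ i bs → fromBits (drop i bs) ≡ 𝟙 (bitAt bs i) + (fromBits (drop (suc i) bs) + fromBits (drop (suc i) bs))
fromBits-drop zero    []           = refl
fromBits-drop zero    (false ∷ bs) = refl
fromBits-drop zero    (true ∷ bs)  = refl
fromBits-drop (suc i) []           = refl
fromBits-drop (suc i) (_ ∷ bs)     = fromBits-drop i bs

fromBits-drop-all : ∀ {i} bs → length bs ≤ i → fromBits (drop i bs) ≡ 0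
fromBits-drop-all {zero}  []       h       = refl
fromBits-drop-all {suc i} []       h       = refl
fromBits-drop-all {suc i} (_ ∷ bs) (s≤s h) = fromBits-drop-all bs h

sel : Bool → ℕ → ℕ
sel b v = if b then v else 0

sel≤ : ∀ b v → sel b v ≤ v
sel≤ true  v = ℕ.≤-refl
sel≤ false v = z≤n

*-fromBits : ∀ v i bs → v * fromBits (drop i bs) ≡
             sel (bitAt bs i) v + (v * fromBits (drop (suc i) bs) + v * fromBits (drop (suc i) bs))
*-fromBits v i bs = trans (cong (v *_) (fromBits-drop i bs)) (trans (ℕ.*-distribˡ-+ v (𝟙 (bitAt bs i)) _)
  (cong₂ _+_ (sel-* (bitAt bs i)) (ℕ.*-distribˡ-+ v _ _)))
  where
  sel-* : ∀ b → v * 𝟙 b ≡ sel b v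
  sel-* true  = ℕ.*-identityʳ v
  sel-* false = ℕ.*-zeroʳ v

-- The carries of a comparison of V * d + Y * n and P + U * d, where d and
-- n are given in binary and read from the lowest bit on.
module Carries (P U V Y : ℕ) (d n : List Bool) where

  lower : ℕ → ℕ → ℕ
  lower y a = (a + sel (bitAt d y) V) + sel (bitAt n y) Y

  carryˡ carryʳ : ℕ → ℕ
  carryˡ = recur (λ y a → half (suc (lower y a))) 0
  carryʳ = recur (λ y a → half ((a + sel (bitAt d y) U) + parity (lower y (carryˡ y)))) P

  -- The carries stand for the bits below i. Halving may change both sides by rounding, but not the
  -- truth of the inequality, as `compare-step` makes the left side even first.
  Compares : ℕ → Set
  Compares i = carryˡ i + (V * fromBits (drop i d) + Y * fromBits (drop i n)) ≤
               carryʳ i + U * fromBits (drop i d)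

  compares-suc : ∀ i → Compares i ⇔ Compares (suc i)
  compares-suc i = mk⇔ (λ p → to one-bit (subst₂ _≤_ lhs rhs p)) (λ p → subst₂ _≤_ (sym lhs) (sym rhs) (from one-bit p))
    where
    vd = V * fromBits (drop (suc i) d)
    yn = Y * fromBits (drop (suc i) n)
    ud = U * fromBits (drop (suc i) d)
    one-bit = compare-step (carryʳ i + sel (bitAt d i) U) (lower i (carryˡ i)) ud (vd + yn)
    shuffle : ∀ q s v t y → q + ((s + (v + v)) + (t + (y + y))) ≡ ((q + s) + t) + ((v + y) + (v + y))
    shuffle = solve-∀
    lhs : carryˡ i + (V * fromBits (drop i d) + Y * fromBits (drop i n)) ≡ lower i (carryˡ i) + ((vd + yn) + (vd + yn))
    lhs = trans (cong₂ (λ a b → carryˡ i + (a + b)) (*-fromBits V i d) (*-fromBits Y i n))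
            (shuffle (carryˡ i) (sel (bitAt d i) V) vd (sel (bitAt n i) Y) yn)
    rhs : carryʳ i + U * fromBits (drop i d) ≡ (carryʳ i + sel (bitAt d i) U) + (ud + ud)
    rhs = trans (cong (carryʳ i +_) (*-fromBits U i d)) (sym (ℕ.+-assoc (carryʳ i) _ _))

  compares : ∀ i → Compares 0 ⇔ Compares i
  compares zero    = ⇔-id _
  compares (suc i) = compares-suc i ⇔-∘ compares i

  -- Once both numerals are exhausted, only the carries are left to compare.
  carries-compare : ∀ i → length d ≤ i → length n ≤ i →
                    V * fromBits d + Y * fromBits n ≤ P + U * fromBits d ⇔ carryˡ i ≤ carryʳ i
  carries-compare i hd hn = mk⇔ (λ p → subst₂ _≤_ lhs rhs (to (compares i) p)) (λ p → from (compares i) (subst₂ _≤_ (sym lhs) (sym rhs) p))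
    where
    lhs : carryˡ i + (V * fromBits (drop i d) + Y * fromBits (drop i n)) ≡ carryˡ i
    lhs rewrite fromBits-drop-all d hd | fromBits-drop-all n hn | ℕ.*-zeroʳ V | ℕ.*-zeroʳ Y = ℕ.+-identityʳ _
    rhs : carryʳ i + U * fromBits (drop i d) ≡ carryʳ i
    rhs rewrite fromBits-drop-all d hd | ℕ.*-zeroʳ U = ℕ.+-identityʳ _

  module _ {K : ℕ} (P≤K : P ≤ K) (U≤K : U ≤ K) (VY≤K : V + Y ≤ K) where

    lower≤ : ∀ y {a} → a ≤ K → lower y a ≤ K + K
    lower≤ y {a} h = begin
      (a + sel (bitAt d y) V) + sel (bitAt n y) Y ≤⟨ ℕ.+-mono-≤ (ℕ.+-mono-≤ h (sel≤ (bitAt d y) V)) (sel≤ (bitAt n y) Y) ⟩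
      (K + V) + Y                                 ≡⟨ ℕ.+-assoc K V Y ⟩
      K + (V + Y)                                 ≤⟨ ℕ.+-monoʳ-≤ K VY≤K ⟩
      K + K                                       ∎
      where open ℕ.≤-Reasoning

    -- A carry of at most K plus the addends of one bit is at most 2 K, and half of that, even
    -- rounded up, is at most K again.
    carryˡ≤ : ∀ i → carryˡ i ≤ K
    carryˡ≤ zero    = z≤n
    carryˡ≤ (suc i) = half≤ (s≤s (lower≤ i (carryˡ≤ i)))

    upper≤ : ∀ i {a} → a ≤ K → (a + sel (bitAt d i) U) + parity (lower i (carryˡ i)) ≤ suc (K + K)
    upper≤ i h = ℕ.≤-trans (ℕ.+-mono-≤ (ℕ.+-mono-≤ h (ℕ.≤-trans (sel≤ (bitAt d i) U) U≤K)) (parity≤1 (lower i (carryˡ i)))) (ℕ.≤-reflexive (ℕ.+-comm (K + K) 1))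

    carryʳ≤ : ∀ i → carryʳ i ≤ K
    carryʳ≤ zero    = P≤K
    carryʳ≤ (suc i) = half≤ (upper≤ i (carryʳ≤ i))

module _ {A : Set} (isBit isOne : Delimited A → Bool) where

  bitF : Fun A 2
  bitF = read isOne (skipF isBit)

  selF : ∀ {k} → Fun A k → Fun A k → Fun A k → Fun A k
  selF p i v = ifeq (comp bitF (p ∷ i ∷ [])) (const 1) v zero

  lowerF : Fun A 8
  lowerF = comp addF (comp addF (v₁ ∷ selF v₆ v₀ v₄ ∷ []) ∷ selF v₇ v₀ v₅ ∷ [])

  carryˡF carryʳF : Fun A 7
  carryˡF = rec v₀ zero (comp halfF (suc (comp lowerF (v₀ ∷ v₁ ∷ v₃ ∷ v₄ ∷ v₅ ∷ v₆ ∷ v₇ ∷ v₈ ∷ [])) ∷ []))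
  carryʳF = rec v₀ v₁ (comp halfF (comp addF
    (comp addF (v₁ ∷ selF v₇ v₀ v₄ ∷ []) ∷
     comp parityF (comp lowerF (v₀ ∷ comp carryˡF (v₀ ∷ v₃ ∷ v₄ ∷ v₅ ∷ v₆ ∷ v₇ ∷ v₈ ∷ []) ∷ v₃ ∷ v₄ ∷ v₅ ∷ v₆ ∷ v₇ ∷ v₈ ∷ []) ∷ []) ∷ []) ∷ []))

  -- The arguments are P, U, V, Y and the positions of the numerals d and n. Reading as many bits as
  -- the limit says exhausts both.
  compareF : Fun A 6
  compareF = comp leqF (comp carryˡF (lim ∷ v₀ ∷ v₁ ∷ v₂ ∷ v₃ ∷ v₄ ∷ v₅ ∷ []) ∷
                        comp carryʳF (lim ∷ v₀ ∷ v₁ ∷ v₂ ∷ v₃ ∷ v₄ ∷ v₅ ∷ []) ∷ [])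

  module _ (symbol : ℕ → Delimited A) (Z : ℕ) where
    open Arithmetic symbol Z

    record BitsFrom (p : ℕ) (bs : List Bool) : Set where
      field
        length≤ : length bs ≤ Z
        bit-at  : ∀ i → isOne (symbol (skip-value symbol isBit p i)) ≡ bitAt bs i
    open BitsFrom

    module _ {P U V Y pd pn : ℕ} {d n : List Bool} (hd : BitsFrom pd d) (hn : BitsFrom pn n)
             {K : ℕ} (P≤K : P ≤ K) (U≤K : U ≤ K) (VY≤K : V + Y ≤ K) (K≤Z : suc (K + K) ≤ Z) where
      open Carries P U V Y d n

      private
        ≤K⇒≤Z : ∀ {a} → a ≤ K → a ≤ Z
        ≤K⇒≤Z h = ℕ.≤-trans h (ℕ.≤-trans (ℕ.m≤m+n K K) (ℕ.≤-trans (ℕ.n≤1+n _) K≤Z))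

        bit-value : ∀ {p bs} → BitsFrom p bs → ∀ {i} → i ≤ Z → ⟦ bitF ⟧ (p ∷ i ∷ []) ≡ 𝟙 (bitAt bs i)
        bit-value {p} h {i} i≤Z = cong 𝟙 (trans (cong (isOne ∘ symbol) (skipF-value isBit i≤Z)) (bit-at h i))

        sel-value : ∀ {p bs} → BitsFrom p bs → ∀ {i} v → i ≤ Z →
                    (if ⟦ bitF ⟧ (p ∷ i ∷ []) ≡ᵇ 1 then v else 0) ≡ sel (bitAt bs i) v
        sel-value {bs = bs} h {i} v i≤Z =
          cong (λ b → if b then v else 0) (trans (cong (_≡ᵇ 1) (bit-value h i≤Z)) (𝟙≡ᵇ1 (bitAt bs i)))

        V≤K : V ≤ K
        V≤K = ℕ.≤-trans (ℕ.m≤m+n V Y) VY≤K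

        Y≤K : Y ≤ K
        Y≤K = ℕ.≤-trans (ℕ.m≤n+m Y V) VY≤K

        add-value : ∀ {a a′ b b′} → a ≡ a′ → b ≡ b′ → b′ ≤ Z → ⟦ addF ⟧ (a ∷ b ∷ []) ≡ a′ + b′
        add-value refl refl h = addF-value h

        lower-value : ∀ y a → y ≤ Z → ⟦ lowerF ⟧ (y ∷ a ∷ P ∷ U ∷ V ∷ Y ∷ pd ∷ pn ∷ []) ≡ lower y a
        lower-value y a y≤Z =
          add-value (add-value refl (sel-value hd V y≤Z) (≤K⇒≤Z (ℕ.≤-trans (sel≤ (bitAt d y) V) V≤K)))
            (sel-value hn Y y≤Z) (≤K⇒≤Z (ℕ.≤-trans (sel≤ (bitAt n y) Y) Y≤K))

        half-value : ∀ {a a′} → a ≡ a′ → a′ ≤ Z → ⟦ halfF ⟧ (a ∷ []) ≡ half a′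
        half-value refl h = halfF-value h

        parity-value : ∀ {a a′} → a ≡ a′ → a′ ≤ Z → ⟦ parityF ⟧ (a ∷ []) ≡ parity a′
        parity-value refl h = parityF-value h

        left-value′ : ∀ i → i ≤ Z →
          recur (λ y a → ⟦ halfF ⟧ (suc (⟦ lowerF ⟧ (y ∷ a ∷ P ∷ U ∷ V ∷ Y ∷ pd ∷ pn ∷ [])) ∷ [])) 0 i ≡ carryˡ i
        left-value′ zero    h = refl
        left-value′ (suc i) h = half-value
          (cong suc (trans (lower-value i _ (ℕ.<⇒≤ h)) (cong (lower i) (left-value′ i (ℕ.<⇒≤ h)))))
          (ℕ.≤-trans (s≤s (lower≤ P≤K U≤K VY≤K i (carryˡ≤ P≤K U≤K VY≤K i))) K≤Z)

      left-value : ∀ i → i ≤ Z → ⟦ carryˡF ⟧ (i ∷ P ∷ U ∷ V ∷ Y ∷ pd ∷ pn ∷ []) ≡ carryˡ i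
      left-value i h = trans (cong (recur _ 0) (ℕ.m≤n⇒m⊓n≡m h)) (left-value′ i h)

      private
        upperF-value : ℕ → ℕ → ℕ
        upperF-value y a = ⟦ halfF ⟧ (⟦ addF ⟧ (⟦ addF ⟧ (a ∷ (if ⟦ bitF ⟧ (pd ∷ y ∷ []) ≡ᵇ 1 then U else 0) ∷ []) ∷
          ⟦ parityF ⟧ (⟦ lowerF ⟧ (y ∷ ⟦ carryˡF ⟧ (y ∷ P ∷ U ∷ V ∷ Y ∷ pd ∷ pn ∷ []) ∷ P ∷ U ∷ V ∷ Y ∷ pd ∷ pn ∷ []) ∷ []) ∷ []) ∷ [])

        right-value′ : ∀ i → i ≤ Z → recur upperF-value P i ≡ carryʳ i
        right-value′ zero    h = refl
        right-value′ (suc i) h = half-value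
          (add-value (add-value (right-value′ i (ℕ.<⇒≤ h)) (sel-value hd U (ℕ.<⇒≤ h)) (≤K⇒≤Z (ℕ.≤-trans (sel≤ (bitAt d i) U) U≤K)))
            (parity-value (trans (lower-value i _ (ℕ.<⇒≤ h)) (cong (lower i) (left-value i (ℕ.<⇒≤ h))))
              (ℕ.≤-trans (lower≤ P≤K U≤K VY≤K i (carryˡ≤ P≤K U≤K VY≤K i)) (ℕ.≤-trans (ℕ.n≤1+n _) K≤Z)))
            (ℕ.≤-trans (parity≤1 (lower i (carryˡ i))) (ℕ.≤-trans (s≤s z≤n) K≤Z)))
          (ℕ.≤-trans (upper≤ P≤K U≤K VY≤K i (carryʳ≤ P≤K U≤K VY≤K i)) K≤Z)

      right-value : ∀ i → i ≤ Z → ⟦ carryʳF ⟧ (i ∷ P ∷ U ∷ V ∷ Y ∷ pd ∷ pn ∷ []) ≡ carryʳ i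
      right-value i h = trans (cong (recur _ P) (ℕ.m≤n⇒m⊓n≡m h)) (right-value′ i h)

      holds-compare : Holds compareF (P ∷ U ∷ V ∷ Y ∷ pd ∷ pn ∷ []) ⇔
                      V * fromBits d + Y * fromBits n ≤ P + U * fromBits d
      holds-compare = mk⇔
        (λ h → from cc (to (holds-leq 1+right≤Z) (holding (trans (sym (cong₂ (λ a b → ⟦ leqF ⟧ (a ∷ b ∷ [])) l r)) (value-one h)))))
        (λ h → holding (trans (cong₂ (λ a b → ⟦ leqF ⟧ (a ∷ b ∷ [])) l r) (value-one (from (holds-leq 1+right≤Z) (to cc h)))))
        where
        cc = carries-compare Z (length≤ hd) (length≤ hn)
        l = left-value Z ℕ.≤-refl
        r = right-value Z ℕ.≤-refl
        1+right≤Z : suc (carryʳ Z) ≤ Z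
        1+right≤Z = ℕ.≤-trans (s≤s (ℕ.≤-trans (carryʳ≤ P≤K U≤K VY≤K Z) (ℕ.m≤m+n K K))) K≤Z

-- Symbols and numerals of the input

code : Symbol → ℕ
code bit₀ = 0
code bit₁ = 1
code plus = 2
code minus = 3
code slash = 4
code attr# = 5
code cat# = 6
code num# = 7
code row# = 8
code cell# = 9
code null# = 10
code size# = 11
code threshold# = 12

is : Symbol → Delimited Symbol → Bool
is s (letter x) = code s ≡ᵇ code x
is s _          = false

isNot : Symbol → Delimited Symbol → Bool
isNot s x = not (is s x)

isBit : Delimited Symbol → Bool
isBit (letter bit₀) = true
isBit (letter bit₁) = true
isBit _             = false

not-bit⇒not-one : ∀ x → isBit x ≡ false → is bit₁ x ≡ false
not-bit⇒not-one ⊢ e = refl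
not-bit⇒not-one ⊣ e = refl
not-bit⇒not-one (letter bit₀) e = refl
not-bit⇒not-one (letter plus) e = refl
not-bit⇒not-one (letter minus) e = refl
not-bit⇒not-one (letter slash) e = refl
not-bit⇒not-one (letter attr#) e = refl
not-bit⇒not-one (letter cat#) e = refl
not-bit⇒not-one (letter num#) e = refl
not-bit⇒not-one (letter row#) e = refl
not-bit⇒not-one (letter cell#) e = refl
not-bit⇒not-one (letter null#) e = refl
not-bit⇒not-one (letter size#) e = refl
not-bit⇒not-one (letter threshold#) e = refl

-- A symbol that can occur in the encoding of a number or of a value.
data Plain : Symbol → Set where
  bit₀  : Plain bit₀
  bit₁  : Plain bit₁
  plus  : Plain plus
  minus : Plain minus
  slash : Plain slash

plain-is : ∀ {s x} → 5 ≤ code s → Plain x → is s (letter x) ≡ false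
plain-is {s} h bit₀  = ≡ᵇ-false {code s} {0} λ e → ℕ.<⇒≱ (s≤s z≤n) (subst (5 ≤_) e h)
plain-is {s} h bit₁  = ≡ᵇ-false {code s} {1} λ e → ℕ.<⇒≱ (s≤s (s≤s z≤n)) (subst (5 ≤_) e h)
plain-is {s} h plus  = ≡ᵇ-false {code s} {2} λ e → ℕ.<⇒≱ (s≤s (s≤s (s≤s z≤n))) (subst (5 ≤_) e h)
plain-is {s} h minus = ≡ᵇ-false {code s} {3} λ e → ℕ.<⇒≱ (s≤s (s≤s (s≤s (s≤s z≤n)))) (subst (5 ≤_) e h)
plain-is {s} h slash = ≡ᵇ-false {code s} {4} λ e → ℕ.<⇒≱ (s≤s (s≤s (s≤s (s≤s (s≤s z≤n))))) (subst (5 ≤_) e h)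

Lacks : Symbol → List Symbol → Set
Lacks s = All (λ x → is s (letter x) ≡ false)

plain-lacks : ∀ {s v} → 5 ≤ code s → All Plain v → Lacks s v
plain-lacks {s} h = All.map (plain-is {s} h)

plain-bits : ∀ bs → All Plain (map bit bs)
plain-bits []           = []
plain-bits (false ∷ bs) = bit₀ ∷ plain-bits bs
plain-bits (true ∷ bs)  = bit₁ ∷ plain-bits bs

binary : ∀ n → ∃[ bs ] (encodeℕ n ≡ map bit bs × fromBits bs ≡ n)
binary n with toDigits 2 n
... | ds , e = go ds , enc ds , trans (val ds) e
  where
  toBool : Fin 2 → Bool
  toBool Fin.zero    = false
  toBool (Fin.suc _) = true
  go : List (Fin 2) → List Bool
  go = map toBool
  enc : ∀ ds → map digit ds ≡ map bit (go ds)
  enc []                = refl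
  enc (Fin.zero ∷ ds)   = cong (bit₀ ∷_) (enc ds)
  enc (Fin.suc _ ∷ ds)  = cong (bit₁ ∷_) (enc ds)
  double : ∀ v → v + v ≡ v * 2
  double v = trans (cong (v +_) (sym (ℕ.+-identityʳ v))) (ℕ.*-comm 2 v)
  val : ∀ ds → fromBits (go ds) ≡ fromDigits ds
  val []                       = refl
  val (Fin.zero ∷ ds)          = trans (cong (λ v → v + v) (val ds)) (double (fromDigits ds))
  val (Fin.suc Fin.zero ∷ ds)  = cong suc (trans (cong (λ v → v + v) (val ds)) (double (fromDigits ds)))

plain-ℕ : ∀ n → All Plain (encodeℕ n)
plain-ℕ n with binary n
... | bs , e , _ = subst (All Plain) (sym e) (plain-bits bs)

plain-ℚ : ∀ q → All Plain (encodeℚ q)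
plain-ℚ q with ↥ q
... | ℤ.+ n      = plus ∷ All.++⁺ (plain-ℕ n) (slash ∷ plain-ℕ (↧ₙ q))
... | ℤ.-[1+ n ] = minus ∷ All.++⁺ (plain-ℕ (suc n)) (slash ∷ plain-ℕ (↧ₙ q))

plain-value : ∀ k v → All Plain (encodeValue k v)
plain-value categorical v = plain-bits v
plain-value numeric     q = plain-ℚ q

-- Positions in the input

-- Position 0 is the left delimiter, so the word starts at position 1.
data Suffix {A : Set} (w : List A) : ℕ → List A → Set where
  start : Suffix w 1 w
  next  : ∀ {p x v} → Suffix w p (x ∷ v) → Suffix w (suc p) v

headD : ∀ {A} → List A → Delimited A
headD []      = ⊣
headD (x ∷ _) = letter x

module _ {A : Set} {w : List A} where

  suffix-drop : ∀ {p v} → Suffix w p v → drop p (delimited w) ≡ map letter v ++ ⊣ ∷ []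
  suffix-drop start = refl
  suffix-drop (next {p} s) = drop-suc p (delimited w) (suffix-drop s)

  suffix-symbol : ∀ {p v} → Suffix w p v → symbolAt w p ≡ headD v
  suffix-symbol {p} {[]}    s = trans (symbolAt-nth w p) (nth-drop p (delimited w) (suffix-drop s))
  suffix-symbol {p} {x ∷ v} s = trans (symbolAt-nth w p) (nth-drop p (delimited w) (suffix-drop s))

  suffix-++ : ∀ {p v} u → Suffix w p (u ++ v) → Suffix w (length u + p) v
  suffix-++ []      s = s
  suffix-++ {p} {v} (x ∷ u) s = subst (λ q → Suffix w q v) (ℕ.+-suc (length u) p) (suffix-++ u (next s))

  suffix-length : ∀ {p v} → Suffix w p v → p + length v ≡ suc (length w)
  suffix-length start = refl
  suffix-length (next {p} {v = v} s) = trans (sym (ℕ.+-suc p (length v))) (suffix-length s)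

  suffix-prefix≤ : ∀ {p} u {v} → Suffix w p (u ++ v) → length u ≤ suc (length w)
  suffix-prefix≤ {p} u {v} s = ℕ.≤-trans (ℕ.m≤m+n (length u) (length v))
    (ℕ.≤-trans (ℕ.≤-reflexive (sym (List.length-++ u))) (ℕ.≤-trans (ℕ.m≤n+m _ p) (ℕ.≤-reflexive (suffix-length s))))

  symbol-end : ∀ p → suc (length w) ≤ p → symbolAt w p ≡ ⊣
  symbol-end p h = trans (symbolAt-nth w p) (beyond p (delimited w) refl h)
    where
    len : length (delimited w) ≡ suc (suc (length w))
    len = cong suc (trans (List.length-++ (map letter w)) (trans (ℕ.+-comm _ 1) (cong suc (List.length-map letter w))))
    last : ∀ v → nth (map letter v ++ ⊣ ∷ []) (length v) ≡ ⊣
    last []      = refl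
    last (x ∷ v) = last v
    beyond : ∀ p D → D ≡ delimited w → suc (length w) ≤ p → nth D p ≡ ⊣
    beyond p D refl h with ℕ.m≤n⇒m<n∨m≡n h
    ... | inj₁ q = nth-beyond p D (List.drop-all p D (ℕ.≤-trans (ℕ.≤-reflexive len) q))
    ... | inj₂ refl = last w

  -- `recur` adds its steps on the outside; this peels off the innermost one, which is the first
  -- symbol skipped.
  skip-shift : ∀ q p i → skip-value (symbolAt w) q p (suc i) ≡
               skip-value (symbolAt w) q (if q (symbolAt w p) then suc p else p) i
  skip-shift q p zero    = refl
  skip-shift q p (suc i) = cong (λ a → if q (symbolAt w a) then suc a else a) (skip-shift q p i)

  skip-here : ∀ q p i → q (symbolAt w p) ≡ false → skip-value (symbolAt w) q p i ≡ p
  skip-here q p zero    e = refl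
  skip-here q p (suc i) e = trans (cong (λ a → if q (symbolAt w a) then suc a else a) (skip-here q p i e))
                                  (cong (λ b → if b then suc p else p) e)

  skip-to : ∀ q {p} u {v} i → Suffix w p (u ++ v) → All (λ x → q (letter x) ≡ true) u → q (headD v) ≡ false →
            length u ≤ i → skip-value (symbolAt w) q p i ≡ length u + p
  skip-to q []      i s hu hv h = skip-here q _ i (trans (cong q (suffix-symbol s)) hv)
  skip-to q {p} (x ∷ u) (suc i) s (hx ∷ hu) hv (s≤s h) = begin
    skip-value (symbolAt w) q p (suc i)                               ≡⟨ skip-shift q p i ⟩
    skip-value (symbolAt w) q (if q (symbolAt w p) then suc p else p) i ≡⟨ cong (λ b → skip-value (symbolAt w) q (if b then suc p else p) i) (trans (cong q (suffix-symbol s)) hx) ⟩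
    skip-value (symbolAt w) q (suc p) i                               ≡⟨ skip-to q u i (next s) hu hv h ⟩
    length u + suc p                                                  ≡⟨ ℕ.+-suc (length u) p ⟩
    suc (length u + p)                                                ∎
    where open ≡-Reasoning

  gap : ∀ mark (φ : ℕ → Bool) {p} u {v} → Suffix w p (u ++ v) → All (λ x → mark (letter x) ≡ false) u →
        count (length u) (λ i → mark (symbolAt w (i + p)) ∧ φ (i + p)) ≡ 0
  gap mark φ {p} u s h = count-false (length u) (λ {i} i<u → cong (_∧ φ (i + p)) (at i u i<u s h))
    where
    at : ∀ {p v} i u → i < length u → Suffix w p (u ++ v) → All (λ x → mark (letter x) ≡ false) u →
         mark (symbolAt w (i + p)) ≡ false
    at zero    (x ∷ u) i<u       s (e ∷ _) = trans (cong mark (suffix-symbol s)) e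
    at {p} (suc i) (x ∷ u) (s≤s i<u) s (_ ∷ h) =
      subst (λ q → mark (symbolAt w q) ≡ false) (ℕ.+-suc i p) (at i u i<u (next s) h)

countIn : ∀ {X : Set} → (X → Bool) → List X → ℕ
countIn φ []       = 0
countIn φ (x ∷ xs) = 𝟙 (φ x) + countIn φ xs

-- Each element of a list is encoded by a block that contains its mark
-- exactly once, in front.
module Blocks {A : Set} (w : List A) (mark : Delimited A → Bool) {X : Set} (lead : A) (lead-mark : mark (letter lead) ≡ true)
              (rest-of : X → List A) (unmarked : ∀ x → All (λ y → mark (letter y) ≡ false) (rest-of x))
              (Good : List A → Set) (good-lead : ∀ v → Good (lead ∷ v)) where

  block : X → List A
  block x = lead ∷ rest-of x

  good-blocks : ∀ xs {v} → Good v → Good (concatMap block xs ++ v)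
  good-blocks []       h = h
  good-blocks (x ∷ xs) h = good-lead _

  positions : List X → ℕ → List ℕ
  positions []       p = []
  positions (x ∷ xs) p = p ∷ positions xs (length (block x) + p)

  At : X → ℕ → Set
  At x p = ∃[ v ] (Good v × Suffix w p (block x ++ v))

  at-positions : ∀ xs {p v} → Good v → Suffix w p (concatMap block xs ++ v) → Pointwise At xs (positions xs p)
  at-positions []       g s = []
  at-positions (x ∷ xs) {p} {v} g s =
    (_ , good-blocks xs g , s′) ∷ at-positions xs g (suffix-++ (block x) s′)
    where
    s′ : Suffix w p (block x ++ (concatMap block xs ++ v))
    s′ = subst (Suffix w p) (List.++-assoc (block x) (concatMap block xs) v) s

  module _ (φ : ℕ → Bool) where

    count-blocks : ∀ xs {p v} → Suffix w p (concatMap block xs ++ v) →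
                   count (length (concatMap block xs)) (λ i → mark (symbolAt w (i + p)) ∧ φ (i + p)) ≡ countIn φ (positions xs p)
    count-blocks [] s = refl
    count-blocks (x ∷ xs) {p} {v} s = begin
      count (length (block x ++ concatMap block xs)) f
        ≡⟨ cong (λ l → count l f) (trans (List.length-++ (block x)) (ℕ.+-comm (length (block x)) _)) ⟩
      count (length (concatMap block xs) + length (block x)) f
        ≡⟨ count-+ (length (concatMap block xs)) (length (block x)) f ⟩
      count (length (concatMap block xs)) (λ i → f (i + length (block x))) + count (length (block x)) f
        ≡⟨ cong₂ _+_ (trans (count-cong (length (concatMap block xs)) (λ {i} _ → cong (λ q → mark (symbolAt w q) ∧ φ q) (ℕ.+-assoc i (length (block x)) p)))
             (count-blocks xs s″)) first ⟩
      countIn φ (positions xs (length (block x) + p)) + 𝟙 (φ p)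
        ≡⟨ ℕ.+-comm (countIn φ (positions xs (length (block x) + p))) _ ⟩
      𝟙 (φ p) + countIn φ (positions xs (length (block x) + p)) ∎
      where
      open ≡-Reasoning
      f : ℕ → Bool
      f i = mark (symbolAt w (i + p)) ∧ φ (i + p)
      s′ : Suffix w p (block x ++ (concatMap block xs ++ v))
      s′ = subst (Suffix w p) (List.++-assoc (block x) (concatMap block xs) v) s
      s″ : Suffix w (length (block x) + p) (concatMap block xs ++ v)
      s″ = suffix-++ (block x) s′
      at-lead : f 0 ≡ φ p
      at-lead = cong (_∧ φ p) (trans (cong mark (suffix-symbol s′)) lead-mark)
      first : count (length (block x)) f ≡ 𝟙 (φ p)
      first = trans (cong (λ l → count l f) (ℕ.+-comm 1 (length (rest-of x)))) (trans (count-+ (length (rest-of x)) 1 f)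
        (cong₂ _+_ (trans (count-cong (length (rest-of x)) (λ {i} _ → cong (λ q → mark (symbolAt w q) ∧ φ q) (ℕ.+-assoc i 1 p)))
          (gap mark φ (rest-of x) (next s′) (unmarked x))) (trans (ℕ.+-identityʳ _) (cong 𝟙 at-lead))))

    -- The positions below Z split into the left delimiter, the three parts of the word, and the
    -- rest, which shows only the right delimiter. Marks occur in the blocks alone.
    count-all : ∀ {pre xs post Z} → w ≡ pre ++ (concatMap block xs ++ post) →
                All (λ y → mark (letter y) ≡ false) pre → All (λ y → mark (letter y) ≡ false) post →
                mark ⊢ ≡ false → mark ⊣ ≡ false → suc (length w) ≤ Z →
                count Z (λ p → mark (symbolAt w p) ∧ φ p) ≡ countIn φ (positions xs (length pre + 1))
    count-all {pre} {xs} {post} {Z} e hpre hpost h⊢ h⊣ w≤Z = begin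
      count Z f                                      ≡⟨ cong (λ z → count z f) (sym (ℕ.m∸n+n≡m w≤Z)) ⟩
      count ((Z ℕ.∸ suc (length w)) + suc (length w)) f ≡⟨ count-+ (Z ℕ.∸ suc (length w)) (suc (length w)) f ⟩
      count (Z ℕ.∸ suc (length w)) (λ i → f (i + suc (length w))) + count (suc (length w)) f
        ≡⟨ cong₂ _+_ (count-false (Z ℕ.∸ suc (length w)) (λ {i} _ → cong (_∧ φ (i + suc (length w)))
             (trans (cong mark (symbol-end (i + suc (length w)) (ℕ.m≤n+m _ i))) h⊣)))
             (cong (λ l → count l f) lengths) ⟩
      count (length post + (length bs + (length pre + 1))) f
        ≡⟨ trans (count-+ (length post) _ f) (cong (_+ count (length bs + (length pre + 1)) f) (gap mark φ post (subst (Suffix w _) (sym (List.++-identityʳ post)) s₂) hpost)) ⟩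
      count (length bs + (length pre + 1)) f
        ≡⟨ trans (count-+ (length bs) _ f) (cong₂ _+_ (count-blocks xs s₁)
             (trans (count-+ (length pre) 1 f) (cong₂ _+_ (gap mark φ pre s₀ hpre) (cong (λ b → 𝟙 (b ∧ φ 0) + 0) h⊢)))) ⟩
      countIn φ (positions xs (length pre + 1)) + 0 ≡⟨ ℕ.+-identityʳ _ ⟩
      countIn φ (positions xs (length pre + 1)) ∎
      where
      open ≡-Reasoning
      f : ℕ → Bool
      f p = mark (symbolAt w p) ∧ φ p
      bs = concatMap block xs
      s₀ : Suffix w 1 (pre ++ (bs ++ post))
      s₀ = subst (Suffix w 1) e start
      s₁ : Suffix w (length pre + 1) (bs ++ post)
      s₁ = suffix-++ pre s₀
      s₂ : Suffix w (length bs + (length pre + 1)) post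
      s₂ = suffix-++ bs s₁
      lengths : suc (length w) ≡ length post + (length bs + (length pre + 1))
      lengths = trans (sym (suffix-length s₂)) (ℕ.+-comm _ (length post))

findF : Symbol → Fun Symbol 1
findF s = comp (skipF (isNot s)) (v₀ ∷ lim ∷ [])

-- The position of the content of the cell with number v₁ of the row at v₀.
cellF nonnullF : Fun Symbol 2
cellF = rec (suc v₁) v₀ (suc (comp (findF cell#) (v₁ ∷ [])))
nonnullF = notF (read (is null#) cellF)

module Positions (w : List Symbol) (Z : ℕ) (w≤Z : suc (length w) ≤ Z) where
  open Arithmetic (symbolAt w) Z

  -- Skipping stops at the symbol that ends the numeral. It is no bit and reads as 0, which extends
  -- the numeral by zeros as `bitAt` does.
  bits-from : ∀ {p} bs {v} → Suffix w p (map bit bs ++ v) → isBit (headD v) ≡ false →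
              BitsFrom isBit (is bit₁) (symbolAt w) Z p bs
  bits-from {p} bs {v} s h = record
    { length≤ = ℕ.≤-trans (subst (_≤ suc (length w)) (List.length-map bit bs) (suffix-prefix≤ (map bit bs) s)) w≤Z
    ; bit-at  = λ i → go i bs s }
    where
    go : ∀ {p} i bs → Suffix w p (map bit bs ++ v) →
         is bit₁ (symbolAt w (skip-value (symbolAt w) isBit p i)) ≡ bitAt bs i
    go {p} i [] s = trans (cong (is bit₁ ∘ symbolAt w) (skip-here isBit p i (trans (cong isBit (suffix-symbol s)) h)))
                          (trans (cong (is bit₁) (suffix-symbol s)) (not-bit⇒not-one (headD v) h))
    go zero (false ∷ bs) s = cong (is bit₁) (suffix-symbol s)
    go zero (true ∷ bs)  s = cong (is bit₁) (suffix-symbol s)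
    go {p} (suc i) (b ∷ bs) s = trans (cong (is bit₁ ∘ symbolAt w)
      (trans (skip-shift isBit p i) (cong (λ c → skip-value (symbolAt w) isBit (if c then suc p else p) i) (trans (cong isBit (suffix-symbol s)) (bit-is b)))))
      (go i bs (next s))
      where
      bit-is : ∀ b → isBit (letter (bit b)) ≡ true
      bit-is false = refl
      bit-is true  = refl

  find-value : ∀ m {p} u {v} → Suffix w p (u ++ m ∷ v) → Lacks m u →
               ⟦ findF m ⟧ (p ∷ []) ≡ length u + p
  find-value m {p} u {v} s h = trans (skipF-value (isNot m) {p} {Z} ℕ.≤-refl)
    (skip-to (isNot m) u Z s (All.map (cong not) h) (cong not (≡ᵇ-true {code m} refl)) (ℕ.≤-trans (suffix-prefix≤ u s) w≤Z))

  find-suffix : ∀ m {p} u {v} → Suffix w p (u ++ m ∷ v) → Lacks m u → Suffix w (suc (⟦ findF m ⟧ (p ∷ []))) v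
  find-suffix m {p} u s h = subst (λ q → Suffix w (suc q) _) (sym (find-value m u s h)) (next (suffix-++ u s))

  private
    cellAt : ℕ → ℕ → ℕ
    cellAt = recur (λ _ a → suc (⟦ findF cell# ⟧ (a ∷ [])))

    cellAt-suc : ∀ p j → cellAt p (suc j) ≡ cellAt (suc (⟦ findF cell# ⟧ (p ∷ []))) j
    cellAt-suc p zero    = refl
    cellAt-suc p (suc j) = cong (λ a → suc (⟦ findF cell# ⟧ (a ∷ []))) (cellAt-suc p j)

  -- The induction varies `u`, the symbols before the next `cell#` mark: the mark of the row at
  -- first, then the content of the preceding cell.
  cell-suffix : ∀ {X : Set} (content : X → List Symbol) → (∀ x → Lacks cell# (content x)) →
                ∀ {p} u pre x post {v} → Lacks cell# u →
                Suffix w p (u ++ (concatMap (λ x → cell# ∷ content x) (pre ++ x ∷ post) ++ v)) →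
                Suffix w (cellAt p (suc (length pre))) (content x ++ (concatMap (λ x → cell# ∷ content x) post ++ v))
  cell-suffix content hc {p} u [] x post {v} hu s =
    subst (λ l → Suffix w _ l) (List.++-assoc (content x) _ v) (find-suffix cell# u s hu)
  cell-suffix content hc {p} u (y ∷ pre) x post {v} hu s =
    subst (λ q → Suffix w q (content x ++ (concatMap (λ x → cell# ∷ content x) post ++ v))) (sym (cellAt-suc p (suc (length pre))))
      (cell-suffix content hc (content y) pre x post (hc y)
        (subst (λ l → Suffix w _ l) (List.++-assoc (content y) _ v) (find-suffix cell# u s hu)))

-- A categorical value may be the empty word; then the first symbol found in its cell belongs to
-- whatever follows, which must not look like a null value.
NotNull : List Symbol → Set
NotNull v = is null# (headD v) ≡ false

cellContent : ∀ A → Cell A → List Symbol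
cellContent A nothing  = null# ∷ []
cellContent A (just v) = encodeValue (kind A) v

encodeCell-content : ∀ A c → encodeCell A c ≡ cell# ∷ cellContent A c
encodeCell-content A nothing  = refl
encodeCell-content A (just v) = refl

content-lacks : ∀ {s} A c → 5 ≤ code s → is s (letter null#) ≡ false → Lacks s (cellContent A c)
content-lacks A nothing  h e = e ∷ []
content-lacks {s} A (just v) h e = plain-lacks {s} h (plain-value (kind A) v)

allFin-split : ∀ {n} (i : Fin n) → ∃[ pre ] (∃[ post ] (allFin n ≡ pre ++ i ∷ post × length pre ≡ toℕ i))
allFin-split {suc n} Fin.zero = [] , _ , refl , refl
allFin-split {suc n} (Fin.suc i) with allFin-split i
... | pre , post , e , l =
  Fin.zero ∷ map Fin.suc pre , map Fin.suc post ,
  cong (Fin.zero ∷_) (trans (sym (List.map-tabulate id Fin.suc)) (trans (cong (map Fin.suc) e) (List.map-++ Fin.suc pre (i ∷ post)))) ,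
  cong suc (trans (List.length-map Fin.suc pre) l)

tupleRest : ∀ I → Tuple I → List Symbol
tupleRest I t = concatMap (λ i → cell# ∷ cellContent (attribute I i) (t i)) (allFin (size I))

encodeTuple-rest : ∀ I t → encodeTuple I t ≡ row# ∷ tupleRest I t
encodeTuple-rest I t = cong (λ l → row# ∷ List.concat l) (List.map-cong (λ i → encodeCell-content (attribute I i) (t i)) (allFin (size I)))

lacks-concatMap : ∀ {X : Set} {s} (f : X → List Symbol) → (∀ x → Lacks s (f x)) → ∀ xs → Lacks s (concatMap f xs)
lacks-concatMap         f h []       = []
lacks-concatMap {s = s} f h (x ∷ xs) = All.++⁺ (h x) (lacks-concatMap {s = s} f h xs)

tupleRest-lacks : ∀ {s} I t → 5 ≤ code s → is s (letter cell#) ≡ false → is s (letter null#) ≡ false → Lacks s (tupleRest I t)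
tupleRest-lacks {s} I t h c n =
  lacks-concatMap {s = s} _ (λ i → c ∷ content-lacks {s} (attribute I i) (t i) h n) (allFin (size I))

module _ (w : List Symbol) (Z : ℕ) (w≤Z : suc (length w) ≤ Z) where
  open Positions w Z w≤Z
  open Arithmetic (symbolAt w) Z

  nonnull-value : ∀ I (t : Tuple I) i {p v} → suc (toℕ i) ≤ Z → NotNull v → Suffix w p ((row# ∷ tupleRest I t) ++ v) →
                  ⟦ nonnullF ⟧ (p ∷ toℕ i ∷ []) ≡ 𝟙 (is-just (t i))
  nonnull-value I t i {p} {v} i<Z hv s with allFin-split i
  ... | pre , post , e , l = trans (cong (λ b → if 𝟙 b ≡ᵇ 1 then 0 else 1) (trans (cong (is null#) at-cell) (null? (t i)))) (flip (is-just (t i)))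
    where
    A = attribute I i
    enc = λ j → cell# ∷ cellContent (attribute I j) (t j)
    after : List Symbol
    after = concatMap enc post ++ v
    s′ : Suffix w p ((row# ∷ []) ++ (concatMap enc (pre ++ i ∷ post) ++ v))
    s′ = subst (λ is → Suffix w p ((row# ∷ []) ++ (concatMap enc is ++ v))) e s
    position : ⟦ cellF ⟧ (p ∷ toℕ i ∷ []) ≡ recur (λ _ a → suc (⟦ findF cell# ⟧ (a ∷ []))) p (suc (length pre))
    position = trans (cong (recur _ p) (ℕ.m≤n⇒m⊓n≡m i<Z)) (cong (λ j → recur (λ _ a → suc (⟦ findF cell# ⟧ (a ∷ []))) p (suc j)) (sym l))
    at-cell : symbolAt w (⟦ cellF ⟧ (p ∷ toℕ i ∷ [])) ≡ headD (cellContent A (t i) ++ after)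
    at-cell = trans (cong (symbolAt w) position)
      (suffix-symbol (cell-suffix (λ j → cellContent (attribute I j) (t j)) (λ j → content-lacks {cell#} (attribute I j) (t j) (ℕ.m≤m+n 5 4) refl) (row# ∷ []) pre i post (refl ∷ []) s′))
    after-ok : ∀ post → is null# (headD (concatMap enc post ++ v)) ≡ false
    after-ok []      = hv
    after-ok (_ ∷ _) = refl
    value-ok : ∀ u → All Plain u → is null# (headD (u ++ after)) ≡ false
    value-ok []      h       = after-ok post
    value-ok (x ∷ u) (h ∷ _) = plain-is {null#} (ℕ.m≤m+n 5 5) h
    null? : ∀ c → is null# (headD (cellContent A c ++ after)) ≡ not (is-just c)
    null? nothing  = refl
    null? (just x) = value-ok (encodeValue (kind A) x) (plain-value (kind A) x)
    flip : ∀ b → (if 𝟙 (not b) ≡ᵇ 1 then 0 else 1) ≡ 𝟙 b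
    flip true  = refl
    flip false = refl

-- The rule is accepted if v |T_B| d + (y₀ + y₁ |T_B| + y₂ |T|) n is at most
-- (u₀ + u₁ |T_{B ∧ H}|) d, where the threshold is n / d.  A rule that no
-- tuple satisfies can be accepted only for the index laplace h, and then
-- the last component is h.
record Coefficients : Set where
  field
    u₀ u₁ v y₀ y₁ y₂ : ℕ
    vacuous : Maybe ℕ

  -- The sum of all coefficients, so that `weight` times a bound on the counts dominates both sides
  -- of each comparison. The successor lets it dominate the counts themselves.
  weight : ℕ
  weight = suc (u₀ + u₁ + (v + (y₀ + y₁ + y₂)) + maybe′ id 0 vacuous)

-- The formula for the existence of a rule

ncolsF : ∀ {k} → Fun Symbol k
ncolsF = countF lim (read (is attr#) v₀)

rowF : ∀ {k} → Fun Symbol (suc k)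
rowF = read (is row#) v₀

-- A rule with body and head satisfied by the tuple at position p is coded
-- by a number m, whose ternary digits are the labels (0 if unused, 1 if in
-- the body, 2 if in the head) of the columns where that tuple is not null.
-- The arguments are column, code and position.
residueF labelF : Fun Symbol 3
residueF = rec v₀ v₁ (ifeq (comp nonnullF (v₄ ∷ v₀ ∷ [])) (const 1) (comp div3F (v₁ ∷ [])) v₁)
labelF = ifeq (comp nonnullF (v₂ ∷ v₀ ∷ [])) (const 1) (comp mod3F (residueF ∷ [])) zero

-- The first argument is the row to be tested; the code and the position of the row that decodes it
-- follow.
bodyF ruleF : Fun Symbol 3
bodyF = allF ncolsF (comp labelF (v₀ ∷ v₂ ∷ v₃ ∷ []) ≡F const 1 ⇒F comp nonnullF (v₁ ∷ v₀ ∷ []))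
ruleF = allF ncolsF (notF (comp labelF (v₀ ∷ v₂ ∷ v₃ ∷ []) ≡F zero) ⇒F comp nonnullF (v₁ ∷ v₀ ∷ []))

-- `usableF` expresses nontriviality: an atom that some tuple satisfies selects all tuples unless
-- its column is null somewhere.
bodyCountF ruleCountF rowCountF sizeF usableF : Fun Symbol 2
bodyCountF = countF lim (rowF ∧F bodyF)
ruleCountF = countF lim (rowF ∧F ruleF)
rowCountF  = countF lim (rowF ∧F const 1)
sizeF      = countF ncolsF (notF (labelF ≡F zero))
usableF    = allF ncolsF (notF (labelF ≡F zero) ⇒F existsF lim (rowF ∧F notF (comp nonnullF (v₀ ∷ v₁ ∷ []))))

-- The numerator begins behind the sign. The search for `slash` starts at the threshold, since
-- numeric values before it contain that symbol too.
sizeAt thresholdAt numeratorAt denominatorAt : Fun Symbol 0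
sizeAt        = suc (comp (findF size#) (const 1 ∷ []))
thresholdAt   = suc (comp (findF threshold#) (const 1 ∷ []))
numeratorAt   = suc thresholdAt
denominatorAt = suc (comp (findF slash) (thresholdAt ∷ []))

fieldCompareF : Fun Symbol 6
fieldCompareF = compareF isBit (is bit₁)

-- The comparison says h * s ≤ 1. A column with number 1 exists iff there are two columns, one for
-- the body and one for the head, and with some tuple present an atom that nothing satisfies is
-- nontrivial.
vacuousF : Maybe ℕ → Fun Symbol 0
vacuousF nothing  = zero
vacuousF (just h) =
  comp fieldCompareF (zero ∷ const 1 ∷ zero ∷ const h ∷ denominatorAt ∷ numeratorAt ∷ []) ∧F
  existsF ncolsF (v₀ ≡F const 1) ∧F existsF lim (rowF ∧F const 1)

module _ (c : Coefficients) where
  open Coefficients c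

  leftF rightF bodyWeightF candidateF : Fun Symbol 2
  leftF       = comp addF (comp addF (comp (scaleF y₁) (bodyCountF ∷ []) ∷ const y₀ ∷ []) ∷ comp (scaleF y₂) (rowCountF ∷ []) ∷ [])
  rightF      = comp addF (comp (scaleF u₁) (ruleCountF ∷ []) ∷ const u₀ ∷ [])
  bodyWeightF = comp (scaleF v) (bodyCountF ∷ [])
  candidateF  =
    existsF ncolsF (labelF ≡F const 1) ∧F existsF ncolsF (labelF ≡F const 2) ∧F usableF ∧F
    -- With U = V = 0 and Y = 1 the comparison says that k, read in place, is at most the size of
    -- the rule.
    comp fieldCompareF (sizeF ∷ zero ∷ zero ∷ const 1 ∷ comp sizeAt [] ∷ comp sizeAt [] ∷ []) ∧F
    comp fieldCompareF (zero ∷ rightF ∷ bodyWeightF ∷ leftF ∷ comp denominatorAt [] ∷ comp numeratorAt [] ∷ [])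

  ruleExistsF : Fun Symbol 0
  ruleExistsF = existsF lim (rowF ∧F existsF lim candidateF) ∨F vacuousF vacuous

-- Coding labellings in base 3

residue : (ℕ → Bool) → ℕ → ℕ → ℕ
residue c = recur (λ y a → if c y then div3 a else a)

label : (ℕ → Bool) → ℕ → ℕ → ℕ
label c m j = if c j then mod3 (residue c m j) else 0

label<3 : ∀ c m j → label c m j < 3
label<3 c m j with c j
... | true  = mod3<3 (residue c m j)
... | false = s≤s z≤n

label-supported : ∀ c m j → ¬ label c m j ≡ 0 → c j ≡ true
label-supported c m j h with c j
... | true  = refl
... | false = contradiction refl h

residue≤ : ∀ c m j → residue c m j ≤ m
residue≤ c m zero    = ℕ.≤-refl
residue≤ c m (suc j) with c j
... | true  = ℕ.≤-trans (div3≤ (residue c m j)) (residue≤ c m j)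
... | false = residue≤ c m j

-- The code of the labels l of the columns from j on, for r columns.
labelCode : (ℕ → Bool) → (ℕ → ℕ) → ℕ → ℕ → ℕ
labelCode c l j zero    = 0
labelCode c l j (suc r) = if c j then labelCode c l (suc j) r * 3 + l j else labelCode c l (suc j) r

module _ (c : ℕ → Bool) (l : ℕ → ℕ) (l<3 : ∀ j → l j < 3) where

  -- Each present column below j strips its own digit, which leaves the code of the columns from j
  -- on.
  residue-code : ∀ j r → residue c (labelCode c l 0 (j + r)) j ≡ labelCode c l j r
  residue-code zero    r = refl
  residue-code (suc j) r with residue-code j (suc r)
  ... | e rewrite ℕ.+-suc j r with c j
  ...   | true  = trans (cong div3 e) (div3-digit (l j) (labelCode c l (suc j) r) (l<3 j))
  ...   | false = e

  label-code : ∀ j r → c j ≡ true → label c (labelCode c l 0 (j + suc r)) j ≡ l j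
  label-code j r cj with residue-code j (suc r)
  ... | e with c j
  ...   | true = trans (cong mod3 e) (mod3-digit (l j) (labelCode c l (suc j) r) (l<3 j))

  -- Absent columns take no digit, so the number of codes depends on the size of the tuple and not
  -- on the number of columns; this is what sparseness is for.
  labelCode< : ∀ j r → labelCode c l j r < 3 ^ count r (λ i → c (i + j))
  labelCode< j zero    = s≤s z≤n
  labelCode< j (suc r) = subst (λ e → labelCode c l j (suc r) < 3 ^ e) (sym split) step-bound′
    where
    e = count r (λ i → c (i + suc j))
    split : count (suc r) (λ i → c (i + j)) ≡ 𝟙 (c j) + e
    split = trans (cong (λ k → count k (λ i → c (i + j))) (ℕ.+-comm 1 r)) (trans (count-+ r 1 (λ i → c (i + j)))
      (trans (ℕ.+-comm (count r (λ i → c (i + 1 + j))) _) (cong₂ _+_ (ℕ.+-identityʳ (𝟙 (c j)))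
        (count-cong r (λ {i} _ → cong c (ℕ.+-assoc i 1 j))))))
    step-bound′ : labelCode c l j (suc r) < 3 ^ (𝟙 (c j) + e)
    step-bound′ with c j
    ... | false = labelCode< (suc j) r
    ... | true  = begin-strict
      m * 3 + l j   <⟨ ℕ.+-monoʳ-< (m * 3) (l<3 j) ⟩
      m * 3 + 3     ≡⟨ ℕ.+-comm (m * 3) 3 ⟩
      suc m * 3     ≤⟨ ℕ.*-monoˡ-≤ 3 (labelCode< (suc j) r) ⟩
      3 ^ e * 3     ≡⟨ ℕ.*-comm (3 ^ e) 3 ⟩
      3 ^ suc e     ∎
      where
      open ℕ.≤-Reasoning
      m = labelCode c l (suc j) r

count-card : ∀ n c → count n c ≡ ∣ Vec.tabulate {n = n} (λ i → c (toℕ i)) ∣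
count-card zero    c = refl
count-card (suc n) c = trans (cong (λ k → count k c) (ℕ.+-comm 1 n)) (trans (count-+ n 1 c)
  (trans (ℕ.+-comm (count n (λ i → c (i + 1))) _) (trans (cong (𝟙 (c 0) + 0 +_)
    (trans (count-cong n (λ {i} _ → cong c (ℕ.+-comm i 1))) (count-card n (c ∘ suc)))) (head-card (c 0) (Vec.tabulate (λ i → c (suc (toℕ i))))))))
  where
  head-card : ∀ b (p : Vec Bool n) → 𝟙 b + 0 + ∣ p ∣ ≡ ∣ b ∷ p ∣
  head-card true  p = refl
  head-card false p = refl

all-Fin : ∀ {n} {P : ℕ → Set} → (∀ j → j < n → P j) ⇔ (∀ (i : Fin n) → P (toℕ i))
all-Fin {P = P} = mk⇔ (λ h i → h (toℕ i) (Fin.toℕ<n i)) (λ h j j<n → subst P (Fin.toℕ-fromℕ< j<n) (h (fromℕ< j<n)))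

exists-Fin : ∀ {n} {P : ℕ → Set} → (∃[ j ] (j < n × P j)) ⇔ (∃ λ (i : Fin n) → P (toℕ i))
exists-Fin {P = P} = mk⇔ (λ (j , j<n , h) → fromℕ< j<n , subst P (sym (Fin.toℕ-fromℕ< j<n)) h) (λ (i , h) → toℕ i , Fin.toℕ<n i , h)

countIn-filter : ∀ {X Y : Set} {R : X → Y → Set} {P : X → Set} (P? : ∀ x → Dec (P x)) {φ xs ys} →
                 (∀ {x y} → R x y → φ y ≡ does (P? x)) → Pointwise R xs ys → countIn φ ys ≡ length (filter P? xs)
countIn-filter P? h [] = refl
countIn-filter P? {φ} {x ∷ xs} {y ∷ ys} h (r ∷ rs) with φ y | P? x | h r
... | .true  | yes _ | refl = cong suc (countIn-filter P? h rs)
... | .false | no  _ | refl = countIn-filter P? h rs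

countIn≢0 : ∀ {X Y : Set} {R : X → Y → Set} {φ xs ys} → Pointwise R xs ys → ¬ countIn φ ys ≡ 0 →
            ∃[ x ] (∃[ y ] (x ∈ xs × R x y × φ y ≡ true))
countIn≢0 [] h = contradiction refl h
countIn≢0 {φ = φ} {ys = y ∷ ys} (r ∷ rs) h with φ y in e
... | true = _ , _ , here refl , r , e
... | false with countIn≢0 rs h
...   | x , y , m , s , e = x , y , there m , s , e

countIn≡0 : ∀ {X Y : Set} {R : X → Y → Set} {φ xs ys} → Pointwise R xs ys → countIn φ ys ≡ 0 →
            ∀ {x} → x ∈ xs → ∃[ y ] (R x y × φ y ≡ false)
countIn≡0 {φ = φ} {ys = y ∷ ys} (r ∷ rs) e (here refl) with φ y in e′
... | false = y , r , e′
countIn≡0 {φ = φ} {ys = y ∷ ys} (r ∷ rs) e (there m) with φ y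
... | false = countIn≡0 rs e m

-- Rules as labellings of the columns by 0 (unused), 1 (body) and 2 (head),
-- over rows of which only the columns without null are known.
module Labelled {n : ℕ} {X : Set} (nonnull : X → Fin n → Bool) (rows : List X) (k num den : ℕ) where

  SatBody SatRule : (Fin n → ℕ) → X → Set
  SatBody l x = ∀ i → l i ≡ 1 → nonnull x i ≡ true
  SatRule l x = ∀ i → ¬ l i ≡ 0 → nonnull x i ≡ true

  satBody? : ∀ l x → Dec (SatBody l x)
  satBody? l x = Fin.all? λ i → (l i ℕ.≟ 1) →-dec (nonnull x i Bool.≟ true)

  satRule? : ∀ l x → Dec (SatRule l x)
  satRule? l x = Fin.all? λ i → ¬? (l i ℕ.≟ 0) →-dec (nonnull x i Bool.≟ true)

  bodyCount ruleCount : (Fin n → ℕ) → ℕ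
  bodyCount l = length (filter (satBody? l) rows)
  ruleCount l = length (filter (satRule? l) rows)

  labelSize : (Fin n → ℕ) → ℕ
  labelSize l = ∣ Vec.tabulate (λ i → not (l i ≡ᵇ 0)) ∣

  module _ (c : Coefficients) where
    open Coefficients c

    Accepts : ℕ → ℕ → Set
    Accepts b r = (v * b) * den + ((y₁ * b + y₀) + y₂ * length rows) * num ≤ (u₁ * r + u₀) * den

    record Candidate (l : Fin n → ℕ) : Set where
      field
        some-body : ∃[ i ] l i ≡ 1
        some-head : ∃[ i ] l i ≡ 2
        usable    : ∀ i → ¬ l i ≡ 0 → ∃[ x ] (x ∈ rows × nonnull x i ≡ false)
        large     : k ≤ labelSize l
        accepted  : Accepts (bodyCount l) (ruleCount l)

    Vacuous : Maybe ℕ → Set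
    Vacuous nothing  = ⊥
    Vacuous (just h) = h * num ≤ den × 1 < n × (∃[ x ] x ∈ rows)

    RuleExists : Set
    RuleExists = (∃[ x ] (x ∈ rows × (∃[ l ] ((∀ i → l i < 3) × SatRule l x × Candidate l)))) ⊎ Vacuous vacuous

-- Correctness of the formula over an abstract input

module Correctness (symbol : ℕ → Delimited Symbol) (Z : ℕ) where
  open Arithmetic symbol Z

  Bits : ℕ → List Bool → Set
  Bits = BitsFrom isBit (is bit₁) symbol Z

  RowAt : ∀ {n} → (Fin n → Bool) → ℕ → Set
  RowAt b p = ∀ i → ⟦ nonnullF ⟧ (p ∷ toℕ i ∷ []) ≡ 𝟙 (b i)

  -- What the formula has to know of the input: the positions of the rows, where the numerals of k
  -- and of the threshold stand, and a common bound N on the numbers of columns and rows.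
  record Layout {n : ℕ} {X : Set} (nonnull : X → Fin n → Bool) (rows : List X) (k num den : ℕ) : Set where
    field
      columns    : ∀ {m} (ρ : Vec ℕ m) → ⟦ ncolsF ⟧ ρ ≡ n
      places     : List ℕ
      rows-at    : Pointwise (RowAt ∘ nonnull) rows places
      count-rows : ∀ φ → count Z (λ p → is row# (symbol p) ∧ φ p) ≡ countIn φ places
      k-bits num-bits den-bits : List Bool
      k-at       : Bits (⟦ sizeAt ⟧ []) k-bits
      num-at     : Bits (⟦ numeratorAt ⟧ []) num-bits
      den-at     : Bits (⟦ denominatorAt ⟧ []) den-bits
      k-value    : fromBits k-bits ≡ k
      num-value  : fromBits num-bits ≡ num
      den-value  : fromBits den-bits ≡ den
      N          : ℕ
      1≤N        : 1 ≤ N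
      n≤N        : n ≤ N
      rows≤N     : length rows ≤ N

  holds-≡ᵇ : ∀ {n} {f : Fun Symbol n} {ρ} {P : Set} (d : Dec P) → (Holds f ρ ⇔ P) → (⟦ f ⟧ ρ ≡ᵇ 1) ≡ does d
  holds-≡ᵇ (yes p) e = ≡ᵇ-true (value-one (from e p))
  holds-≡ᵇ (no np) e = ≡ᵇ-false (λ h → np (to e (holding h)))

  ∧F-≡ᵇ : ∀ {n} (a b : Fun Symbol n) ρ → (⟦ a ∧F b ⟧ ρ ≡ᵇ 1) ≡ (⟦ a ⟧ ρ ≡ᵇ 1) ∧ (⟦ b ⟧ ρ ≡ᵇ 1)
  ∧F-≡ᵇ a b ρ with ⟦ a ⟧ ρ ≡ᵇ 1
  ... | true  = refl
  ... | false = refl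

  module _ {n : ℕ} {X : Set} {nonnull : X → Fin n → Bool} {rows : List X} {k num den : ℕ}
           (layout : Layout nonnull rows k num den) (c : Coefficients) where
    open Layout layout
    open Coefficients c
    open Labelled nonnull rows k num den

    private
      K : ℕ
      K = weight * N

    module _ (K≤Z : suc (K + K) ≤ Z) where
      private
        within-Z : ∀ {a} → a ≤ K → a ≤ Z
        within-Z h = ℕ.≤-trans h (ℕ.≤-trans (ℕ.m≤m+n K K) (ℕ.≤-trans (ℕ.n≤1+n _) K≤Z))

        N≤K : N ≤ K
        N≤K = ℕ.m≤n*m N weight

        n≤Z : n ≤ Z
        n≤Z = within-Z (ℕ.≤-trans n≤N N≤K)

        ncols≤Z : ∀ {m} (ρ : Vec ℕ m) → ⟦ ncolsF ⟧ ρ ≤ Z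
        ncols≤Z ρ = ℕ.≤-trans (ℕ.≤-reflexive (columns ρ)) n≤Z

        holds-all-columns : ∀ {m f} {ρ : Vec ℕ m} → Holds (allF ncolsF f) ρ ⇔ (∀ (i : Fin n) → Holds f (toℕ i ∷ ρ))
        holds-all-columns {f = f} {ρ} = mk⇔
          (λ h → to all-Fin (λ j j<n → to (holds-all (ncols≤Z ρ)) h (ℕ.≤-trans j<n (ℕ.≤-reflexive (sym (columns ρ))))))
          (λ h → from (holds-all (ncols≤Z ρ)) (λ {j} j<n → from (all-Fin {P = λ j → Holds f (j ∷ ρ)}) h j (ℕ.≤-trans j<n (ℕ.≤-reflexive (columns ρ)))))

        holds-exists-column : ∀ {m f} {ρ : Vec ℕ m} → Holds (existsF ncolsF f) ρ ⇔ (∃ λ (i : Fin n) → Holds f (toℕ i ∷ ρ))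
        holds-exists-column {f = f} {ρ} = mk⇔
          (λ h → let j , j<n , e = to (holds-exists (ncols≤Z ρ)) h in
                 to (exists-Fin {P = λ j → Holds f (j ∷ ρ)}) (j , ℕ.≤-trans j<n (ℕ.≤-reflexive (columns ρ)) , e))
          (λ h → let j , j<n , e = from (exists-Fin {P = λ j → Holds f (j ∷ ρ)}) h in
                 from (holds-exists (ncols≤Z ρ)) (j , ℕ.≤-trans j<n (ℕ.≤-reflexive (sym (columns ρ))) , e))

        count-row : ∀ {m} (f : Fun Symbol (suc m)) ρ →
                    ⟦ countF lim (rowF ∧F f) ⟧ ρ ≡ countIn (λ q → ⟦ f ⟧ (q ∷ ρ) ≡ᵇ 1) places
        count-row f ρ = trans (countF-value {b = lim} {rowF ∧F f} ℕ.≤-refl)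
          (trans (count-cong Z (λ {q} _ → trans (∧F-≡ᵇ rowF f (q ∷ ρ)) (cong (_∧ (⟦ f ⟧ (q ∷ ρ) ≡ᵇ 1)) (𝟙≡ᵇ1 (is row# (symbol q))))))
            (count-rows (λ q → ⟦ f ⟧ (q ∷ ρ) ≡ᵇ 1)))

        holds-exists-row : ∀ {m f} {ρ : Vec ℕ m} {P : X → Set} →
                           (∀ {x q} → RowAt (nonnull x) q → Holds f (q ∷ ρ) ⇔ P x) →
                           Holds (existsF lim (rowF ∧F f)) ρ ⇔ (∃[ x ] (x ∈ rows × P x))
        holds-exists-row {f = f} {ρ} h = mk⇔
          (λ e → let x , q , m , r , t = countIn≢0 rows-at (λ z → to holds-not e (from holds-≡ (trans (count-row f ρ) z)))
                 in x , m , to (h r) (holding (≡ᵇ-≡ t)))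
          (λ (x , m , p) → from holds-not λ z →
            let q , r , t = countIn≡0 rows-at (trans (sym (count-row f ρ)) (to holds-≡ z)) m
            in contradiction (trans (sym (≡ᵇ-true (value-one (from (h r) p)))) t) λ ())

        holds-nonnull : ∀ {x q} {i : Fin n} → RowAt (nonnull x) q → Holds nonnullF (q ∷ toℕ i ∷ []) ⇔ nonnull x i ≡ true
        holds-nonnull {i = i} r = mk⇔ (λ h → to 𝟙-true (trans (sym (r i)) (value-one h))) (λ h → holding (trans (r i) (from 𝟙-true h)))

        holds-comp : ∀ {m m′ f} {gs : Vec (Fun Symbol m) m′} {ρ} → Holds (comp f gs) ρ ⇔ Holds f (⟦ gs ⟧* ρ)
        holds-comp = mk⇔ (λ h → holding (value-one h)) (λ h → holding (value-one h))

        notnull-false : ∀ {b} → (¬ b ≡ true) ⇔ b ≡ false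
        notnull-false {true}  = mk⇔ (λ h → contradiction refl h) (λ ())
        notnull-false {false} = mk⇔ (λ _ → refl) (λ _ ())

      module _ {m p : ℕ} {l : Fin n → ℕ} (labels : ∀ i → ⟦ labelF ⟧ (toℕ i ∷ m ∷ p ∷ []) ≡ l i) where
        private
          ρ : Vec ℕ 2
          ρ = m ∷ p ∷ []

          holds-label : ∀ {i} a → Holds (labelF ≡F const a) (toℕ i ∷ m ∷ p ∷ []) ⇔ l i ≡ a
          holds-label {i} a = mk⇔ (λ h → trans (sym (labels i)) (trans (to holds-≡ h) (const-value a (toℕ i ∷ m ∷ p ∷ []))))
                                  (λ e → from holds-≡ (trans (labels i) (trans e (sym (const-value a (toℕ i ∷ m ∷ p ∷ []))))))

          holds-label′ : ∀ {i q} a → Holds (comp labelF (v₀ ∷ v₂ ∷ v₃ ∷ []) ≡F const a) (toℕ i ∷ q ∷ m ∷ p ∷ []) ⇔ l i ≡ a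
          holds-label′ {i} {q} a = mk⇔ (λ h → trans (sym (labels i)) (trans (to holds-≡ h) (const-value a (toℕ i ∷ q ∷ m ∷ p ∷ []))))
                                  (λ e → from holds-≡ (trans (labels i) (trans e (sym (const-value a (toℕ i ∷ q ∷ m ∷ p ∷ []))))))

          holds-used : ∀ {i} → Holds (notF (labelF ≡F zero)) (toℕ i ∷ m ∷ p ∷ []) ⇔ (¬ l i ≡ 0)
          holds-used = mk⇔ (λ h e → to holds-not h (from (holds-label 0) e)) (λ h → from holds-not (h ∘ to (holds-label 0)))

        holds-body : ∀ {x q} → RowAt (nonnull x) q → Holds bodyF (q ∷ m ∷ p ∷ []) ⇔ SatBody l x
        holds-body r = mk⇔
          (λ h i e → to (holds-nonnull r) (to holds-comp (to holds-⇒ (to holds-all-columns h i) (from (holds-label′ 1) e))))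
          (λ h → from holds-all-columns λ i → from holds-⇒ λ e → from holds-comp (from (holds-nonnull r) (h i (to (holds-label′ 1) e))))

        holds-rule : ∀ {x q} → RowAt (nonnull x) q → Holds ruleF (q ∷ m ∷ p ∷ []) ⇔ SatRule l x
        holds-rule r = mk⇔
          (λ h i e → to (holds-nonnull r) (to holds-comp (to holds-⇒ (to holds-all-columns h i) (from holds-not (e ∘ to (holds-label′ 0))))))
          (λ h → from holds-all-columns λ i → from holds-⇒ λ e → from holds-comp (from (holds-nonnull r) (h i (to holds-not e ∘ from (holds-label′ 0)))))

        bodyCount-value : ⟦ bodyCountF ⟧ ρ ≡ bodyCount l
        bodyCount-value = trans (count-row bodyF ρ) (countIn-filter (satBody? l) (λ r → holds-≡ᵇ (satBody? l _) (holds-body r)) rows-at)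

        ruleCount-value : ⟦ ruleCountF ⟧ ρ ≡ ruleCount l
        ruleCount-value = trans (count-row ruleF ρ) (countIn-filter (satRule? l) (λ r → holds-≡ᵇ (satRule? l _) (holds-rule r)) rows-at)

        rowCount-value : ⟦ rowCountF ⟧ ρ ≡ length rows
        rowCount-value = trans (count-row (const 1) ρ) (lengths rows-at)
          where
          lengths : ∀ {xs ys} → Pointwise (RowAt ∘ nonnull) xs ys → countIn (λ _ → true) ys ≡ length xs
          lengths []       = refl
          lengths (_ ∷ rs) = cong suc (lengths rs)

        size-value : ⟦ sizeF ⟧ ρ ≡ labelSize l
        size-value = trans (countF-value {ρ = ρ} {b = ncolsF} {notF (labelF ≡F zero)} (ncols≤Z ρ)) (trans (cong (λ z → count z used) (columns ρ))
          (trans (count-card n used) (cong ∣_∣ (Vec.tabulate-cong λ i → trans (flip (⟦ labelF ⟧ (toℕ i ∷ ρ) ≡ᵇ 0)) (cong (λ v → not (v ≡ᵇ 0)) (labels i))))))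
          where
          used : ℕ → Bool
          used j = ⟦ notF (labelF ≡F zero) ⟧ (j ∷ ρ) ≡ᵇ 1
          flip : ∀ b → ((if (if b then 1 else 0) ≡ᵇ 1 then 0 else 1) ≡ᵇ 1) ≡ not b
          flip true  = refl
          flip false = refl

        holds-usable : Holds usableF ρ ⇔ (∀ i → ¬ l i ≡ 0 → ∃[ x ] (x ∈ rows × nonnull x i ≡ false))
        holds-usable = mk⇔
          (λ h i e → to (holds-exists-row (null i)) (to holds-⇒ (to holds-all-columns h i) (from holds-used e)))
          (λ h → from holds-all-columns λ i → from holds-⇒ λ e → from (holds-exists-row (null i)) (h i (to holds-used e)))
          where
          null : ∀ i {x q} → RowAt (nonnull x) q → Holds (notF (comp nonnullF (v₀ ∷ v₁ ∷ []))) (q ∷ toℕ i ∷ ρ) ⇔ nonnull x i ≡ false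
          null i r = mk⇔ (λ h → to notnull-false (to holds-not h ∘ from holds-comp ∘ from (holds-nonnull r)))
                         (λ e → from holds-not (from notnull-false e ∘ to (holds-nonnull r) ∘ to holds-comp))

        private
          ≤N⇒≤Z : ∀ {a} → a ≤ N → a ≤ Z
          ≤N⇒≤Z h = within-Z (ℕ.≤-trans h N≤K)

          body≤N : bodyCount l ≤ N
          body≤N = ℕ.≤-trans (List.length-filter (satBody? l) rows) rows≤N

          rule≤N : ruleCount l ≤ N
          rule≤N = ℕ.≤-trans (List.length-filter (satRule? l) rows) rows≤N

          size≤K : labelSize l ≤ K
          size≤K = ℕ.≤-trans (∣p∣≤n (Vec.tabulate (λ i → not (l i ≡ᵇ 0)))) (ℕ.≤-trans n≤N N≤K)

          scaled : ∀ a {b} → b ≤ N → a * b ≤ a * N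
          scaled a = ℕ.*-monoʳ-≤ a

          ≤*N : ∀ a → a ≤ a * N
          ≤*N a = ℕ.m≤m*n a N {{ℕ.>-nonZero 1≤N}}

          right≤ : u₁ * ruleCount l + u₀ ≤ (u₀ + u₁) * N
          right≤ = ℕ.≤-trans (ℕ.+-mono-≤ (scaled u₁ rule≤N) (≤*N u₀))
            (ℕ.≤-reflexive (trans (ℕ.+-comm (u₁ * N) (u₀ * N)) (sym (ℕ.*-distribʳ-+ N u₀ u₁))))

          left≤ : v * bodyCount l + ((y₁ * bodyCount l + y₀) + y₂ * length rows) ≤ (v + (y₀ + y₁ + y₂)) * N
          left≤ = begin
            v * bodyCount l + ((y₁ * bodyCount l + y₀) + y₂ * length rows)
              ≤⟨ ℕ.+-mono-≤ (scaled v body≤N) (ℕ.+-mono-≤ (ℕ.+-mono-≤ (scaled y₁ body≤N) (≤*N y₀)) (scaled y₂ rows≤N)) ⟩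
            v * N + ((y₁ * N + y₀ * N) + y₂ * N)   ≡⟨ cong (λ z → v * N + (z + y₂ * N)) (trans (ℕ.+-comm (y₁ * N) _) (sym (ℕ.*-distribʳ-+ N y₀ y₁))) ⟩
            v * N + ((y₀ + y₁) * N + y₂ * N)       ≡⟨ cong (v * N +_) (sym (ℕ.*-distribʳ-+ N (y₀ + y₁) y₂)) ⟩
            v * N + (y₀ + y₁ + y₂) * N             ≡⟨ sym (ℕ.*-distribʳ-+ N v (y₀ + y₁ + y₂)) ⟩
            (v + (y₀ + y₁ + y₂)) * N               ∎
            where open ℕ.≤-Reasoning

          weight-right : (u₀ + u₁) * N ≤ K
          weight-right = ℕ.*-monoˡ-≤ N (ℕ.≤-trans (ℕ.m≤m+n (u₀ + u₁) (v + (y₀ + y₁ + y₂))) (ℕ.≤-trans (ℕ.m≤m+n _ (maybe′ id 0 vacuous)) (ℕ.n≤1+n _)))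

          weight-left : (v + (y₀ + y₁ + y₂)) * N ≤ K
          weight-left = ℕ.*-monoˡ-≤ N (ℕ.≤-trans (ℕ.m≤n+m (v + (y₀ + y₁ + y₂)) (u₀ + u₁)) (ℕ.≤-trans (ℕ.m≤m+n _ (maybe′ id 0 vacuous)) (ℕ.n≤1+n _)))

          left≤K : v * bodyCount l + ((y₁ * bodyCount l + y₀) + y₂ * length rows) ≤ K
          left≤K = ℕ.≤-trans left≤ weight-left

          part≤K : (y₁ * bodyCount l + y₀) + y₂ * length rows ≤ K
          part≤K = ℕ.≤-trans (ℕ.m≤n+m _ (v * bodyCount l)) left≤K

          sum-value : ∀ {a a′ b b′} → a ≡ a′ → b ≡ b′ → b′ ≤ Z → ⟦ addF ⟧ (a ∷ b ∷ []) ≡ a′ + b′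
          sum-value refl refl h = addF-value h

          scale-value : ∀ a {b b′} → b ≡ b′ → b′ ≤ Z → ⟦ scaleF a ⟧ (b ∷ []) ≡ a * b′
          scale-value a refl h = scaleF-value a h

        left-formula : ⟦ leftF c ⟧ ρ ≡ (y₁ * bodyCount l + y₀) + y₂ * length rows
        left-formula = sum-value
          (sum-value (scale-value y₁ bodyCount-value (≤N⇒≤Z body≤N)) (const-value y₀ ρ)
            (within-Z (ℕ.≤-trans (ℕ.m≤n+m y₀ (y₁ * bodyCount l)) (ℕ.≤-trans (ℕ.m≤m+n _ (y₂ * length rows)) part≤K))))
          (scale-value y₂ rowCount-value (≤N⇒≤Z rows≤N))
          (within-Z (ℕ.≤-trans (ℕ.m≤n+m _ (y₁ * bodyCount l + y₀)) part≤K))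

        right-formula : ⟦ rightF c ⟧ ρ ≡ u₁ * ruleCount l + u₀
        right-formula = sum-value (scale-value u₁ ruleCount-value (≤N⇒≤Z rule≤N)) (const-value u₀ ρ)
          (within-Z (ℕ.≤-trans (ℕ.m≤n+m u₀ (u₁ * ruleCount l)) (ℕ.≤-trans right≤ weight-right)))

        bodyWeight-formula : ⟦ bodyWeightF c ⟧ ρ ≡ v * bodyCount l
        bodyWeight-formula = scale-value v bodyCount-value (≤N⇒≤Z body≤N)

        holds-large : Holds (comp fieldCompareF (sizeF ∷ zero ∷ zero ∷ const 1 ∷ comp sizeAt [] ∷ comp sizeAt [] ∷ [])) ρ ⇔ k ≤ labelSize l
        holds-large = mk⇔
          (λ h → subst₂ _≤_ left-eq (ℕ.+-identityʳ _)
            (to compared (subst (λ s → Holds fieldCompareF (s ∷ 0 ∷ 0 ∷ 1 ∷ ⟦ sizeAt ⟧ [] ∷ ⟦ sizeAt ⟧ [] ∷ [])) size-value (to holds-comp h))))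
          (λ h → from holds-comp (subst (λ s → Holds fieldCompareF (s ∷ 0 ∷ 0 ∷ 1 ∷ ⟦ sizeAt ⟧ [] ∷ ⟦ sizeAt ⟧ [] ∷ [])) (sym size-value)
            (from compared (subst₂ _≤_ (sym left-eq) (sym (ℕ.+-identityʳ _)) h))))
          where
          left-eq : 0 * fromBits k-bits + 1 * fromBits k-bits ≡ k
          left-eq = trans (ℕ.+-identityʳ _) k-value
          compared = holds-compare isBit (is bit₁) symbol Z {U = 0} {V = 0} {Y = 1} k-at k-at size≤K z≤n (ℕ.≤-trans 1≤N N≤K) K≤Z

        holds-accepted : Holds (comp fieldCompareF (zero ∷ rightF c ∷ bodyWeightF c ∷ leftF c ∷ comp denominatorAt [] ∷ comp numeratorAt [] ∷ [])) ρ ⇔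
                         Accepts c (bodyCount l) (ruleCount l)
        holds-accepted = mk⇔
          (λ h → subst₂ _≤_ left-eq right-eq (to compared (subst₃ right-formula bodyWeight-formula left-formula (to holds-comp h))))
          (λ h → from holds-comp (subst₃ (sym right-formula) (sym bodyWeight-formula) (sym left-formula) (from compared (subst₂ _≤_ (sym left-eq) (sym right-eq) h))))
          where
          subst₃ : ∀ {U U′ V V′ Y Y′} → U ≡ U′ → V ≡ V′ → Y ≡ Y′ →
                   Holds fieldCompareF (0 ∷ U ∷ V ∷ Y ∷ ⟦ denominatorAt ⟧ [] ∷ ⟦ numeratorAt ⟧ [] ∷ []) →
                   Holds fieldCompareF (0 ∷ U′ ∷ V′ ∷ Y′ ∷ ⟦ denominatorAt ⟧ [] ∷ ⟦ numeratorAt ⟧ [] ∷ [])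
          subst₃ refl refl refl h = h
          left-eq : (v * bodyCount l) * fromBits den-bits + ((y₁ * bodyCount l + y₀) + y₂ * length rows) * fromBits num-bits ≡
                    (v * bodyCount l) * den + ((y₁ * bodyCount l + y₀) + y₂ * length rows) * num
          left-eq = cong₂ (λ a b → (v * bodyCount l) * a + ((y₁ * bodyCount l + y₀) + y₂ * length rows) * b) den-value num-value
          right-eq : 0 + (u₁ * ruleCount l + u₀) * fromBits den-bits ≡ (u₁ * ruleCount l + u₀) * den
          right-eq = cong ((u₁ * ruleCount l + u₀) *_) den-value
          compared = holds-compare isBit (is bit₁) symbol Z {P = 0} {u₁ * ruleCount l + u₀} {v * bodyCount l} {(y₁ * bodyCount l + y₀) + y₂ * length rows}
                       den-at num-at z≤n (ℕ.≤-trans right≤ weight-right) left≤K K≤Z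

        holds-candidate : Holds (candidateF c) ρ ⇔ Candidate c l
        holds-candidate = mk⇔
          (λ h → let h₁ , h′ = to holds-∧ h ; h₂ , h″ = to holds-∧ h′ ; h₃ , h‴ = to holds-∧ h″ ; h₄ , h₅ = to holds-∧ h‴
                     i , e = to holds-exists-column h₁ ; j , e′ = to holds-exists-column h₂ in record
            { some-body = i , to (holds-label 1) e
            ; some-head = j , to (holds-label 2) e′
            ; usable = to holds-usable h₃
            ; large = to holds-large h₄
            ; accepted = to holds-accepted h₅ })
          (λ cand → let open Candidate cand in
            from holds-∧ (from holds-exists-column (proj₁ some-body , from (holds-label 1) (proj₂ some-body)) ,
            from holds-∧ (from holds-exists-column (proj₁ some-head , from (holds-label 2) (proj₂ some-head)) ,
            from holds-∧ (from holds-usable usable ,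
            from holds-∧ (from holds-large large , from holds-accepted accepted)))))

      module _ {x : X} {p : ℕ} (r : RowAt (nonnull x) p) where
        private
          present : ℕ → Bool
          present j = ⟦ nonnullF ⟧ (p ∷ j ∷ []) ≡ᵇ 1

          present-row : ∀ i → present (toℕ i) ≡ nonnull x i
          present-row i = trans (cong (_≡ᵇ 1) (r i)) (𝟙≡ᵇ1 (nonnull x i))

        residue-value : ∀ {m} j → m ≤ Z → j ≤ Z → ⟦ residueF ⟧ (j ∷ m ∷ p ∷ []) ≡ residue present m j
        residue-value {m} j m≤Z j≤Z = trans (cong (recur _ m) (ℕ.m≤n⇒m⊓n≡m j≤Z)) (go j)
          where
          go : ∀ j → recur (λ y a → if present y then ⟦ div3F ⟧ (a ∷ []) else a) m j ≡ residue present m j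
          go zero    = refl
          go (suc j) = trans (cong (λ a → if present j then ⟦ div3F ⟧ (a ∷ []) else a) (go j))
            (cong (λ a → if present j then a else residue present m j) (div3F-value (ℕ.≤-trans (residue≤ present m j) m≤Z)))

        label-value : ∀ {m} j → m ≤ Z → j ≤ Z → ⟦ labelF ⟧ (j ∷ m ∷ p ∷ []) ≡ label present m j
        label-value {m} j m≤Z j≤Z = cong (λ a → if present j then a else 0)
          (trans (cong (λ a → ⟦ mod3F ⟧ (a ∷ [])) (residue-value j m≤Z j≤Z)) (mod3F-value (ℕ.≤-trans (residue≤ present m j) m≤Z)))

        toℕ≤Z : ∀ (i : Fin n) → toℕ i ≤ Z
        toℕ≤Z i = ℕ.≤-trans (ℕ.<⇒≤ (Fin.toℕ<n i)) n≤Z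

        -- Every number decodes to a labelling that the row satisfies, so codes need no test of
        -- validity. Conversely a labelling satisfied by the row is recovered from its code, which
        -- is below 3 to the size of the row.
        holds-some-code : 3 ^ ∣ Vec.tabulate (nonnull x) ∣ ≤ Z →
                          Holds (existsF lim (candidateF c)) (p ∷ []) ⇔ (∃[ l ] ((∀ i → l i < 3) × SatRule l x × Candidate c l))
        holds-some-code 3^≤Z = mk⇔
          (λ h → let m , m<Z , e = to (holds-exists ℕ.≤-refl) h in
            (λ i → label present m (toℕ i)) , (λ i → label<3 present m (toℕ i)) ,
            (λ i ne → trans (sym (present-row i)) (label-supported present m (toℕ i) ne)) ,
            to (holds-candidate (λ i → label-value (toℕ i) (ℕ.<⇒≤ m<Z) (toℕ≤Z i))) e)
          (λ (l , l<3 , sat , cand) → from (holds-exists ℕ.≤-refl) (code-of l l<3 , code< l l<3 , from (holds-candidate (decoded l l<3 sat)) cand))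
          where
          module _ (l : Fin n → ℕ) (l<3 : ∀ i → l i < 3) where
            extended : ℕ → ℕ
            extended j with j ℕ.<? n
            ... | yes j<n = l (fromℕ< j<n)
            ... | no  _   = 0
            extended<3 : ∀ j → extended j < 3
            extended<3 j with j ℕ.<? n
            ... | yes j<n = l<3 (fromℕ< j<n)
            ... | no  _   = s≤s z≤n
            extended-Fin : ∀ i → extended (toℕ i) ≡ l i
            extended-Fin i with toℕ i ℕ.<? n
            ... | yes j<n = cong l (Fin.fromℕ<-toℕ i j<n)
            ... | no  ne  = contradiction (Fin.toℕ<n i) ne
            code-of : ℕ
            code-of = labelCode present extended 0 n
            code< : code-of < Z
            code< = ℕ.<-≤-trans (labelCode< present extended extended<3 0 n)
              (ℕ.≤-trans (ℕ.≤-reflexive (cong (3 ^_) (trans (count-cong n (λ {i} _ → cong present (ℕ.+-identityʳ i)))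
                (trans (count-card n present) (cong ∣_∣ (Vec.tabulate-cong present-row)))))) 3^≤Z)
            decoded : SatRule l x → ∀ i → ⟦ labelF ⟧ (toℕ i ∷ code-of ∷ p ∷ []) ≡ l i
            decoded sat i = trans (label-value (toℕ i) (ℕ.<⇒≤ code<) (toℕ≤Z i)) (decide (nonnull x i) refl)
              where
              rest : ∃[ e ] (toℕ i + suc e ≡ n)
              rest = n ℕ.∸ suc (toℕ i) , trans (ℕ.+-suc (toℕ i) _) (ℕ.m+[n∸m]≡n (Fin.toℕ<n i))
              decide : ∀ b → nonnull x i ≡ b → label present code-of (toℕ i) ≡ l i
              decide true  e = trans (cong (λ z → label present (labelCode present extended 0 z) (toℕ i)) (sym (proj₂ rest)))
                (trans (label-code present extended extended<3 (toℕ i) (proj₁ rest) (trans (present-row i) e)) (extended-Fin i))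
              -- A null column decodes to label 0, and no other label is possible as the row
              -- satisfies the rule.
              decide false e with l i ℕ.≟ 0
              ... | yes z = trans (cong (λ b → if b then mod3 (residue present code-of (toℕ i)) else 0) (trans (present-row i) e)) (sym z)
              ... | no ne = contradiction (trans (sym e) (sat i ne)) λ ()

      holds-vacuous : ∀ h → h ≤ weight → Holds (vacuousF (just h)) [] ⇔ Vacuous c (just h)
      holds-vacuous h h≤ = mk⇔
        (λ e → let e₁ , e′ = to holds-∧ e ; e₂ , e₃ = to holds-∧ e′ ; i , q = to holds-exists-column e₂
                   x , m , _ = to (holds-exists-row {P = λ _ → ⊤} (λ _ → mk⇔ (λ _ → tt) (λ _ → holding refl))) e₃ in
          subst₂ _≤_ left-eq right-eq (to compared (subst (λ z → Holds fieldCompareF (0 ∷ 1 ∷ 0 ∷ z ∷ ⟦ denominatorAt ⟧ [] ∷ ⟦ numeratorAt ⟧ [] ∷ [])) (const-value h []) (to holds-comp e₁))) ,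
          subst (_< n) (to holds-≡ q) (Fin.toℕ<n i) , x , m)
        (λ (le , 1<n , x , m) → from holds-∧ (from holds-comp
            (subst (λ z → Holds fieldCompareF (0 ∷ 1 ∷ 0 ∷ z ∷ ⟦ denominatorAt ⟧ [] ∷ ⟦ numeratorAt ⟧ [] ∷ [])) (sym (const-value h [])) (from compared (subst₂ _≤_ (sym left-eq) (sym right-eq) le))) ,
          from holds-∧ (from holds-exists-column (fromℕ< 1<n , from holds-≡ (Fin.toℕ-fromℕ< 1<n)) ,
            from (holds-exists-row {P = λ _ → ⊤} (λ _ → mk⇔ (λ _ → tt) (λ _ → holding refl))) (x , m , tt))))
        where
        left-eq : 0 * fromBits den-bits + h * fromBits num-bits ≡ h * num
        left-eq = cong (h *_) num-value
        right-eq : 0 + 1 * fromBits den-bits ≡ den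
        right-eq = trans (ℕ.+-identityʳ _) den-value
        compared = holds-compare isBit (is bit₁) symbol Z {P = 0} {1} {0} {h} den-at num-at z≤n (ℕ.≤-trans 1≤N N≤K)
          (ℕ.≤-trans h≤ (ℕ.m≤m*n weight N {{ℕ.>-nonZero 1≤N}})) K≤Z

      holds-ruleExists : (∀ {x} → x ∈ rows → 3 ^ ∣ Vec.tabulate (nonnull x) ∣ ≤ Z) → Holds (ruleExistsF c) [] ⇔ RuleExists c
      holds-ruleExists 3^≤Z = mk⇔
        (λ h → [ inj₁ ∘ found , inj₂ ∘ to (vac vacuous (weight-vacuous vacuous refl)) ]′ (to holds-∨ h))
        (λ { (inj₁ r) → from holds-∨ (inj₁ (locate r)) ; (inj₂ r) → from holds-∨ (inj₂ (from (vac vacuous (weight-vacuous vacuous refl)) r)) })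
        where
        P : X → Set
        P x = ∃[ l ] ((∀ i → l i < 3) × SatRule l x × Candidate c l)
        found : Holds (existsF lim (rowF ∧F existsF lim (candidateF c))) [] → ∃[ x ] (x ∈ rows × P x)
        found e =
          let x , q , m , r , t = countIn≢0 (remember rows-at) (λ z → to holds-not e (from holds-≡ (trans (count-row (existsF lim (candidateF c)) []) z)))
          in x , m , to (holds-some-code (proj₂ r) (3^≤Z (proj₁ r))) (holding (≡ᵇ-≡ t))
          where
          -- The bound on the number of codes is given only for rows of the database, so membership
          -- is kept next to the position.
          remember : ∀ {xs ys} → Pointwise (RowAt ∘ nonnull) xs ys → Pointwise (λ x p → x ∈ xs × RowAt (nonnull x) p) xs ys
          remember []       = []
          remember (r ∷ rs) = (here refl , r) ∷ Pointwise.map (λ (m , s) → there m , s) (remember rs)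
        locate : ∃[ x ] (x ∈ rows × P x) → Holds (existsF lim (rowF ∧F existsF lim (candidateF c))) []
        locate (x , m , p) = from holds-not λ z →
          let q , r , t = countIn≡0 rows-at (trans (sym (count-row (existsF lim (candidateF c)) [])) (to holds-≡ z)) m
          in contradiction (trans (sym (≡ᵇ-true (value-one (from (holds-some-code r (3^≤Z m)) p)))) t) λ ()
        weight-vacuous : ∀ o → vacuous ≡ o → maybe′ id 0 o ≤ weight
        weight-vacuous o refl = ℕ.≤-trans (ℕ.m≤n+m _ (u₀ + u₁ + (v + (y₀ + y₁ + y₂)))) (ℕ.n≤1+n _)
        vac : ∀ o → maybe′ id 0 o ≤ weight → Holds (vacuousF o) [] ⇔ Vacuous c o
        vac nothing  _ = mk⇔ (λ h → contradiction (value-one h) λ ()) (λ ())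
        vac (just h) w = holds-vacuous h w

-- Index values as inequalities between naturals

numerator denominator : ℚ → ℕ
numerator s = ℤ.∣ ↥ s ∣
denominator s = ↧ₙ s

positive-numerator : ∀ {s} → 0ℚ ℚ.< s → ↥ s ≡ ℤ.+ numerator s × 1 ≤ numerator s
positive-numerator {mkℚ (ℤ.+ zero) d _}  (ℚ.*<* (ℤ.+<+ ()))
positive-numerator {mkℚ (ℤ.+ suc n) d _} h = refl , s≤s z≤n
positive-numerator {mkℚ ℤ.-[1+ n ] d _}  (ℚ.*<* ())

-- This reduces the equivalence of two inequalities to one polynomial identity, which the ring
-- solver can prove.
≤-difference : ∀ {a b c d : ℤ} → b ℤ.- a ≡ d ℤ.- c → a ℤ.≤ b ⇔ c ℤ.≤ d
≤-difference e = mk⇔ (λ p → ℤ.0≤i-j⇒j≤i (subst (ℤ.0ℤ ℤ.≤_) e (ℤ.i≤j⇒0≤j-i p)))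
                     (λ p → ℤ.0≤i-j⇒j≤i (subst (ℤ.0ℤ ℤ.≤_) (sym e) (ℤ.i≤j⇒0≤j-i p)))

+≤+-⇔ : ∀ {m n} → (ℤ.+ m ℤ.≤ ℤ.+ n) ⇔ m ≤ n
+≤+-⇔ = mk⇔ ℤ.drop‿+≤+ ℤ.+≤+

≤-toℚᵘ : ∀ {s p u} → toℚᵘ p ℚᵘ.≃ u → s ℚ.≤ p ⇔ toℚᵘ s ℚᵘ.≤ u
≤-toℚᵘ e = mk⇔ (λ h → ℚᵘ.≤-respʳ-≃ e (ℚ.toℚᵘ-mono-≤ h)) (λ h → ℚ.toℚᵘ-cancel-≤ (ℚᵘ.≤-respʳ-≃ (ℚᵘ.≃-sym e) h))

*≤*-⇔ : ∀ {p q} → p ℚᵘ.≤ q ⇔ ℚᵘ.↥ p ℤ.* ℚᵘ.↧ q ℤ.≤ ℚᵘ.↥ q ℤ.* ℚᵘ.↧ p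
*≤*-⇔ = mk⇔ ℚᵘ.drop-*≤* ℚᵘ.*≤*

-- Unnormalised rationals keep numerators and denominators explicit, so the inequality can be
-- cross-multiplied without gcds.
≤-÷₀ : ∀ {s} → 0ℚ ℚ.< s → ∀ x n →
       s ℚ.≤ fromℕ x ÷₀ suc n ⇔ suc n * numerator s ≤ x * denominator s
≤-÷₀ {s@(mkℚ i d c)} 0<s x n with positive-numerator {s} 0<s
... | e , _ = +≤+-⇔ ⇔-∘ (≤-difference (trans (ring i (ℤ.+ x) (ℤ.+ suc n) (ℤ.+ suc d))
                (cong₂ ℤ._-_ (sym (ℤ.pos-* x (suc d))) (trans (cong (ℤ.+ suc n ℤ.*_) e) (sym (ℤ.pos-* (suc n) ℤ.∣ i ∣)))))
              ⇔-∘ (*≤*-⇔ ⇔-∘ ≤-toℚᵘ value))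
  where
  value : toℚᵘ (fromℕ x ℚ.* (ℤ.+ 1 / suc n)) ℚᵘ.≃ mkℚᵘ (ℤ.+ x) 0 ℚᵘ.* mkℚᵘ (ℤ.+ 1) n
  value = ℚᵘ.≃-trans (ℚ.toℚᵘ-homo-* (fromℕ x) (ℤ.+ 1 / suc n))
    (ℚᵘ.*-cong (ℚ.toℚᵘ-fromℚᵘ (mkℚᵘ (ℤ.+ x) 0)) (ℚ.toℚᵘ-fromℚᵘ (mkℚᵘ (ℤ.+ 1) n)))
  ring : ∀ i x n d → (x ℤ.* ℤ.+ 1) ℤ.* d ℤ.- i ℤ.* (ℤ.+ 1 ℤ.* n) ≡ x ℤ.* d ℤ.- n ℤ.* i
  ring = ℤ-Solver.solve-∀

≤-gain : ∀ {s θ} → 0ℚ ℚ.< s → 0ℚ ℚ.< θ → ∀ x y n →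
         s ℚ.≤ (fromℕ x ℚ.- θ ℚ.* fromℕ y) ÷₀ suc n ⇔
         (numerator θ * y) * denominator s + (denominator θ * suc n) * numerator s ≤ (denominator θ * x) * denominator s
≤-gain {s@(mkℚ i d c)} {θ@(mkℚ j f c′)} 0<s 0<θ x y n with positive-numerator {s} 0<s | positive-numerator {θ} 0<θ
... | e , _ | e′ , _ = +≤+-⇔ ⇔-∘ (≤-difference (trans (ring i j (ℤ.+ x) (ℤ.+ y) (ℤ.+ suc n) (ℤ.+ suc d) (ℤ.+ suc f))
                (cong₂ ℤ._-_ (sym (trans (ℤ.pos-* (suc f * x) (suc d)) (cong (ℤ._* ℤ.+ suc d) (ℤ.pos-* (suc f) x))))
                             (sym (cong₂ ℤ._+_ (trans (ℤ.pos-* (ℤ.∣ j ∣ * y) (suc d)) (cong (ℤ._* ℤ.+ suc d) (trans (ℤ.pos-* ℤ.∣ j ∣ y) (cong (ℤ._* ℤ.+ y) (sym e′)))))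
                                               (trans (ℤ.pos-* (suc f * suc n) ℤ.∣ i ∣) (cong₂ ℤ._*_ (ℤ.pos-* (suc f) (suc n)) (sym e)))))))
              ⇔-∘ (*≤*-⇔ ⇔-∘ ≤-toℚᵘ value))
  where
  value : toℚᵘ ((fromℕ x ℚ.- θ ℚ.* fromℕ y) ℚ.* (ℤ.+ 1 / suc n)) ℚᵘ.≃
          (mkℚᵘ (ℤ.+ x) 0 ℚᵘ.- mkℚᵘ j f ℚᵘ.* mkℚᵘ (ℤ.+ y) 0) ℚᵘ.* mkℚᵘ (ℤ.+ 1) n
  value = ℚᵘ.≃-trans (ℚ.toℚᵘ-homo-* (fromℕ x ℚ.- θ ℚ.* fromℕ y) (ℤ.+ 1 / suc n))
    (ℚᵘ.*-cong (ℚᵘ.≃-trans (ℚ.toℚᵘ-homo-+ (fromℕ x) (ℚ.- (θ ℚ.* fromℕ y)))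
      (ℚᵘ.+-cong (ℚ.toℚᵘ-fromℚᵘ (mkℚᵘ (ℤ.+ x) 0))
        (ℚᵘ.≃-trans (ℚ.toℚᵘ-homo‿- (θ ℚ.* fromℕ y))
          (ℚᵘ.-‿cong (ℚᵘ.≃-trans (ℚ.toℚᵘ-homo-* θ (fromℕ y)) (ℚᵘ.*-cong (ℚᵘ.≃-refl {mkℚᵘ j f}) (ℚ.toℚᵘ-fromℚᵘ (mkℚᵘ (ℤ.+ y) 0))))))))
      (ℚ.toℚᵘ-fromℚᵘ (mkℚᵘ (ℤ.+ 1) n)))
  ring : ∀ i j x y n d f →
         ((x ℤ.* (f ℤ.* ℤ.+ 1) ℤ.+ (ℤ.- (j ℤ.* y)) ℤ.* ℤ.+ 1) ℤ.* ℤ.+ 1) ℤ.* d ℤ.- i ℤ.* ((ℤ.+ 1 ℤ.* (f ℤ.* ℤ.+ 1)) ℤ.* n) ≡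
         (f ℤ.* x) ℤ.* d ℤ.- ((j ℤ.* y) ℤ.* d ℤ.+ (f ℤ.* n) ℤ.* i)
  ring = ℤ-Solver.solve-∀

-- With s = p / q, T_B of size b, T_{B ∧ H} of size r and θ = a / f, the conditions are b p ≤ r q
-- for the confidence, a b q + f |T| p ≤ f r q for the gain, and (b + h) p ≤ (r + 1) q for laplace.
coefficients : Index → Coefficients
coefficients cnf           = record { u₀ = 0 ; u₁ = 1 ; v = 0 ; y₀ = 0 ; y₁ = 1 ; y₂ = 0 ; vacuous = nothing }
coefficients (gain θ _ _)  = record { u₀ = 0 ; u₁ = denominator θ ; v = numerator θ ; y₀ = 0 ; y₁ = 0 ; y₂ = denominator θ ; vacuous = nothing }
coefficients (laplace h _) = record { u₀ = 1 ; u₁ = 1 ; v = 0 ; y₀ = h ; y₁ = 1 ; y₂ = 0 ; vacuous = just h }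

-- The arguments are the numbers of tuples that satisfy the whole rule and
-- its body, and of all tuples.
indexAt : Index → ℕ → ℕ → ℕ → ℚ
indexAt cnf           r b n = fromℕ r ÷₀ b
indexAt (gain θ _ _)  r b n = (fromℕ r ℚ.- θ ℚ.* fromℕ b) ÷₀ n
indexAt (laplace h _) r b n = fromℕ (r + 1) ÷₀ (b + h)

indexValue-at : ∀ ρ T R → indexValue ρ T R ≡
                indexAt ρ (length (select T (body∧head R))) (length (select T (body R)))
                          (length (tuples T))
indexValue-at cnf           T R = refl
indexValue-at (gain θ _ _)  T R = refl
indexValue-at (laplace h _) T R = refl

AcceptsAt : Coefficients → ℚ → ℕ → ℕ → ℕ → Set
AcceptsAt c s r b n =
  (v * b) * denominator s + ((y₁ * b + y₀) + y₂ * n) * numerator s ≤ (u₁ * r + u₀) * denominator s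
  where open Coefficients c

≤-cong-⇔ : ∀ {a b c d} → a ≡ c → b ≡ d → a ≤ b ⇔ c ≤ d
≤-cong-⇔ refl refl = mk⇔ id id

module _ {s : ℚ} (0<s : 0ℚ ℚ.< s) where

  laplace-accepts : ∀ {h} (2≤h : 2 ≤ h) r b n →
                    s ℚ.≤ indexAt (laplace h 2≤h) r b n ⇔ AcceptsAt (coefficients (laplace h 2≤h)) s r b n
  laplace-accepts {suc h} 2≤h r b n = ≤-cong-⇔ (cong (_* numerator s) (lhs b h)) (cong (_* denominator s) (cong (_+ 1) (sym (ℕ.*-identityˡ r))))
    ⇔-∘ subst (λ m → s ℚ.≤ fromℕ (r + 1) ÷₀ m ⇔ suc (b + h) * numerator s ≤ (r + 1) * denominator s) (sym (ℕ.+-suc b h)) (≤-÷₀ 0<s (r + 1) (b + h))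
    where
    lhs : ∀ b h → suc (b + h) ≡ (1 * b + suc h) + 0
    lhs b h = trans (sym (ℕ.+-suc b h)) (trans (cong (_+ suc h) (sym (ℕ.*-identityˡ b))) (sym (ℕ.+-identityʳ _)))

  -- The lower bounds on b and n ensure that `÷₀` is a true division.
  index-accepts : ∀ ρ r b n → 1 ≤ b → 1 ≤ n → s ℚ.≤ indexAt ρ r b n ⇔ AcceptsAt (coefficients ρ) s r b n
  index-accepts cnf r (suc b) n _ _ =
    ≤-cong-⇔ (cong (_* numerator s) (lhs (suc b))) (cong (_* denominator s) (rhs r)) ⇔-∘ ≤-÷₀ 0<s r b
    where
    lhs : ∀ b → b ≡ (1 * b + 0) + 0
    lhs = solve-∀
    rhs : ∀ r → r ≡ 1 * r + 0
    rhs = solve-∀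
  index-accepts (gain θ 0<θ _) r b (suc n) _ _ =
    ≤-cong-⇔ refl (cong (_* denominator s) (sym (ℕ.+-identityʳ (denominator θ * r)))) ⇔-∘ ≤-gain 0<s 0<θ r b n
  index-accepts (laplace h 2≤h) r b n _ _ = laplace-accepts 2≤h r b n

  private
    1≤num : 1 ≤ numerator s
    1≤num = proj₂ (positive-numerator 0<s)

    absurd : ∀ {a} {P : Set} → 1 ≤ a → a * numerator s ≤ 0 → P
    absurd {suc a} _ h = contradiction (ℕ.≤-trans (ℕ.≤-trans 1≤num (ℕ.m≤m+n _ (a * numerator s))) h) λ ()

  -- If no tuple satisfies the rule, confidence and gain are at most 0 and thus below s, while
  -- laplace is 1 / (b + h) ≤ 1 / h.
  index-vacuous : ∀ ρ b n → 1 ≤ n → s ℚ.≤ indexAt ρ 0 b n →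
                  ∃[ h ] (Coefficients.vacuous (coefficients ρ) ≡ just h × h * numerator s ≤ denominator s)
  -- With an unsatisfied body the confidence is 0 by convention.
  index-vacuous cnf zero n 1≤n h = contradiction (ℚ.<-≤-trans 0<s h) (ℚ.<-irrefl refl)
  index-vacuous cnf (suc b) n 1≤n h = absurd {suc b} (s≤s z≤n) (to (≤-÷₀ 0<s 0 b) h)
  index-vacuous (gain θ 0<θ θ≤1) b (suc n) 1≤n h =
    absurd {denominator θ * suc n} (s≤s z≤n)
      (ℕ.≤-trans (ℕ.m≤n+m _ ((numerator θ * b) * denominator s))
        (ℕ.≤-trans (to (≤-gain 0<s 0<θ 0 b n) h) (ℕ.≤-reflexive (cong (_* denominator s) (ℕ.*-zeroʳ (denominator θ))))))
  index-vacuous (laplace h 2≤h) b n 1≤n p = h , refl ,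
    ℕ.≤-trans (ℕ.*-monoˡ-≤ (numerator s) (ℕ.≤-trans (ℕ.m≤n+m h (1 * b)) (ℕ.m≤m+n _ 0)))
      (ℕ.≤-trans (to (laplace-accepts 2≤h 0 b n) p) (ℕ.≤-reflexive (ℕ.*-identityˡ (denominator s))))

  vacuous-index : ∀ ρ {h} n → Coefficients.vacuous (coefficients ρ) ≡ just h → h * numerator s ≤ denominator s →
                  s ℚ.≤ indexAt ρ 0 0 n
  vacuous-index cnf n ()
  vacuous-index (gain θ _ _) n ()
  vacuous-index (laplace h 2≤h) n refl p = from (laplace-accepts 2≤h 0 0 n)
    (ℕ.≤-trans (ℕ.≤-reflexive (cong (_* numerator s) (ℕ.+-identityʳ h)))
      (ℕ.≤-trans p (ℕ.≤-reflexive (sym (ℕ.*-identityˡ (denominator s))))))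

-- Rules over a boolean database and their labellings

length-filter-cong : ∀ {X : Set} {P Q : X → Set} (P? : ∀ x → Dec (P x)) (Q? : ∀ x → Dec (Q x)) xs →
                     (∀ {x} → x ∈ xs → P x ⇔ Q x) → length (filter P? xs) ≡ length (filter Q? xs)
length-filter-cong P? Q? []       h = refl
length-filter-cong P? Q? (x ∷ xs) h with P? x | Q? x
... | yes p | yes q = cong suc (length-filter-cong P? Q? xs (h ∘ there))
... | no np | no nq = length-filter-cong P? Q? xs (h ∘ there)
... | yes p | no nq = contradiction (to (h (here refl)) p) nq
... | no np | yes q = contradiction (from (h (here refl)) q) np

length-filter≥1 : ∀ {X : Set} {P : X → Set} (P? : ∀ x → Dec (P x)) {x xs} → x ∈ xs → P x → 1 ≤ length (filter P? xs)
length-filter≥1 P? {xs = xs} m p = nonempty (∈-filter⁺ P? m p)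
  where
  nonempty : ∀ {X : Set} {x : X} {xs} → x ∈ xs → 1 ≤ length xs
  nonempty (here _)  = s≤s z≤n
  nonempty (there _) = s≤s z≤n

length-filter≡0 : ∀ {X : Set} {P : X → Set} (P? : ∀ x → Dec (P x)) xs → (∀ {x} → x ∈ xs → ¬ P x) → length (filter P? xs) ≡ 0
length-filter≡0 P? xs h = cong length (List.filter-none P? (All.tabulate h))

card-disjoint : ∀ n (f g : Fin n → Bool) → (∀ i → f i ≡ true → g i ≡ true → ⊥) →
                ∣ Vec.tabulate f ∣ + ∣ Vec.tabulate g ∣ ≡ ∣ Vec.tabulate (λ i → f i ∨ g i) ∣
card-disjoint zero    f g h = refl
card-disjoint (suc n) f g h with f Fin.zero | g Fin.zero | h Fin.zero | card-disjoint n (f ∘ Fin.suc) (g ∘ Fin.suc) (h ∘ Fin.suc)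
... | true  | true  | e | _ = contradiction (e refl refl) λ ()
... | true  | false | _ | ih = cong suc ih
... | false | true  | _ | ih = trans (ℕ.+-suc _ _) (cong suc ih)
... | false | false | _ | ih = ih

card-all : ∀ n → ∣ Vec.tabulate {n = n} (λ _ → true) ∣ ≡ n
card-all zero    = refl
card-all (suc n) = cong suc (card-all n)

module _ {n : ℕ} {F : Fin n → Set} (f : (i : Fin n) → Maybe (F i)) where

  ∈-support : ∀ {i} → i Subset.∈ support f ⇔ is-just (f i) ≡ true
  ∈-support {i} = mk⇔ (λ m → trans (sym (Vec.lookup∘tabulate (is-just ∘ f) i)) (Vec.[]=⇒lookup m))
                      (λ e → Vec.lookup⇒[]= i (support f) (trans (Vec.lookup∘tabulate (is-just ∘ f) i) e))

just-value : ∀ {X : Set} {m : Maybe X} → is-just m ≡ true → ∃[ x ] m ≡ just x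
just-value {m = just x} _ = x , refl

-- Atoms over the value c that is the only element of the domain

onlyAtom exceptAtom : ∀ k {D : Pred (Value k) _} c → D c → AtomOn k D
onlyAtom categorical c d = equal c d
onlyAtom numeric     c d = inside c c ℚ.≤-refl
exceptAtom categorical c d = notEqual c d
exceptAtom numeric     c d = outside c c ℚ.≤-refl

onlyAtom-fulfilled : ∀ k {D : Pred (Value k) _} c (d : D c) → Fulfils k {D} (onlyAtom k c d) c
onlyAtom-fulfilled categorical c d = refl
onlyAtom-fulfilled numeric     c d = ℚ.≤-refl , ℚ.≤-refl

exceptAtom-not-fulfilled : ∀ k {D : Pred (Value k) _} c (d : D c) → ¬ Fulfils k {D} (exceptAtom k c d) c
exceptAtom-not-fulfilled categorical c d h = h refl
exceptAtom-not-fulfilled numeric     c d h = h (ℚ.≤-refl , ℚ.≤-refl)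

module Rules (T : Database) (bool : Boolean T) where

  I : AttributeSet
  I = attributes T

  n : ℕ
  n = size I

  nonnull : Tuple I → Fin n → Bool
  nonnull t i = is-just (t i)

  constant : ∀ i → Value (kind (attribute I i))
  constant i = proj₁ (bool i)

  constant∈ : ∀ i → Dom (attribute I i) (constant i)
  constant∈ i = from (proj₂ (bool i) (constant i)) refl

  onlyAtomAt exceptAtomAt : ∀ i → Atom (attribute I i)
  onlyAtomAt i = onlyAtom (kind (attribute I i)) (constant i) (constant∈ i)
  exceptAtomAt i = exceptAtom (kind (attribute I i)) (constant i) (constant∈ i)

  nonnull-cell : ∀ {t} → t ∈ tuples T → ∀ {i} → nonnull t i ≡ true → t i ≡ just (constant i)
  nonnull-cell {t} m {i} e with t i | in-domain T m i
  ... | just v | Maybe.just d = cong just (to (proj₂ (bool i) v) d)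

  satisfies-nonnull : ∀ {t i a} → SatisfiesAtom (attribute I i) a (t i) → nonnull t i ≡ true
  satisfies-nonnull {t} {i} h with t i
  satisfies-nonnull (satisfies _) | just v = refl

  -- Two cells of a column that are not null hold the same value.
  satisfied-atom : ∀ {t x i a} → t ∈ tuples T → x ∈ tuples T → SatisfiesAtom (attribute I i) a (t i) →
                   nonnull x i ≡ true → SatisfiesAtom (attribute I i) a (x i)
  satisfied-atom {t} {x} {i} {a} mt mx h e =
    subst (SatisfiesAtom (attribute I i) a) (trans (nonnull-cell mt (satisfies-nonnull {t} h)) (sym (nonnull-cell mx e))) h

  onlyAtomAt-satisfied : ∀ {x i} → x ∈ tuples T → nonnull x i ≡ true → SatisfiesAtom (attribute I i) (onlyAtomAt i) (x i)
  onlyAtomAt-satisfied {x} {i} m e = subst (SatisfiesAtom (attribute I i) (onlyAtomAt i)) (sym (nonnull-cell m e))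
    (satisfies (onlyAtom-fulfilled (kind (attribute I i)) (constant i) (constant∈ i)))

  exceptAtomAt-unsatisfied : ∀ {x i} → x ∈ tuples T → ¬ SatisfiesAtom (attribute I i) (exceptAtomAt i) (x i)
  exceptAtomAt-unsatisfied {x} {i} m h with subst (SatisfiesAtom (attribute I i) (exceptAtomAt i)) (nonnull-cell m (satisfies-nonnull {x} h)) h
  ... | satisfies f = exceptAtom-not-fulfilled (kind (attribute I i)) (constant i) (constant∈ i) f

  module _ (R : Rule I) where

    in-body : ∀ {i a} → body R i ≡ just a → body∧head R i ≡ just a
    in-body e rewrite e = refl

    not-both : ∀ i → is-just (body R i) ≡ true → is-just (head R i) ≡ true → ⊥
    not-both i b h = disjoint R (i , x∈p∩q⁺ (from (∈-support (body R)) b , from (∈-support (head R)) h))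

    ruleSize-∨ : ruleSize R ≡ ∣ Vec.tabulate (λ i → is-just (body R i) ∨ is-just (head R i)) ∣
    ruleSize-∨ = card-disjoint n _ _ not-both

    -- Over an empty database every atom selects all tuples, namely none.
    nontrivial-rows : ¬ Trivial T R → ∃[ x ] x ∈ tuples T
    nontrivial-rows nt = rows (tuples T) refl
      where
      i = proj₁ (body-nonempty R)
      trivial : tuples T ≡ [] → ∃[ a ] body R i ≡ just a → Trivial T R
      trivial e (a , q) = i , a , in-body q ,
        ↭-reflexive (trans (cong (filter (λ t → satisfiesAtom? (attribute I i) a (t i))) e) (sym e))
      rows : ∀ ts → tuples T ≡ ts → ∃[ x ] x ∈ tuples T
      rows (x ∷ _) e = x , subst (x ∈_) (sym e) (here refl)
      rows []      e = contradiction (trivial e (just-value (to (∈-support (body R)) (proj₂ (body-nonempty R))))) nt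

    labelOf : Bool → Bool → ℕ
    labelOf true  _     = 1
    labelOf false true  = 2
    labelOf false false = 0

    labels : Fin n → ℕ
    labels i = labelOf (is-just (body R i)) (is-just (head R i))

    labels<3 : ∀ i → labels i < 3
    labels<3 i with is-just (body R i) | is-just (head R i)
    ... | true  | _     = s≤s (s≤s z≤n)
    ... | false | true  = s≤s (s≤s (s≤s z≤n))
    ... | false | false = s≤s z≤n

    labels-body : ∀ {i} → labels i ≡ 1 ⇔ is-just (body R i) ≡ true
    labels-body {i} with is-just (body R i) | is-just (head R i)
    ... | true  | _     = mk⇔ (λ _ → refl) (λ _ → refl)
    ... | false | true  = mk⇔ (λ ()) (λ ())
    ... | false | false = mk⇔ (λ ()) (λ ())

    labels-used : ∀ {i} → (¬ labels i ≡ 0) ⇔ is-just (body∧head R i) ≡ true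
    labels-used {i} with body R i | head R i
    ... | just _  | _       = mk⇔ (λ _ → refl) (λ _ ())
    ... | nothing | just _  = mk⇔ (λ _ → refl) (λ _ ())
    ... | nothing | nothing = mk⇔ (λ h → contradiction refl h) (λ ())

    labels-size : ruleSize R ≡ ∣ Vec.tabulate (λ i → not (labels i ≡ᵇ 0)) ∣
    labels-size = trans ruleSize-∨ (cong ∣_∣ (Vec.tabulate-cong λ i → used (is-just (body R i)) (is-just (head R i))))
      where
      used : ∀ b h → b ∨ h ≡ not (labelOf b h ≡ᵇ 0)
      used true  h     = refl
      used false true  = refl
      used false false = refl

  -- The tuple `t` witnesses that each atom of C accepts the only value of its column; all that can
  -- fail in another tuple is that a cell is null.
  condition-nonnull : ∀ {C : Condition I} {t x} → t ∈ tuples T → x ∈ tuples T → Satisfies I C t →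
                      (∀ i → is-just (C i) ≡ true → nonnull x i ≡ true) → Satisfies I C x
  condition-nonnull {C} {t} {x} mt mx sat h i with C i in e | sat i | h i
  ... | nothing | _              | _  = Maybe.nothing
  ... | just a  | Maybe.just p   | h′ = Maybe.just (satisfied-atom mt mx p (h′ refl))

  satisfied-columns : ∀ {C : Condition I} {x} → Satisfies I C x → ∀ i → is-just (C i) ≡ true → nonnull x i ≡ true
  satisfied-columns {C} {x} sat i e with C i | sat i
  ... | just a | Maybe.just p = satisfies-nonnull {x} p

  module _ (atom : ∀ i → Atom (attribute I i)) (l : Fin n → ℕ) where

    pick : ℕ → Condition I
    pick a i = if l i ≡ᵇ a then just (atom i) else nothing

    pick-just : ∀ a i → is-just (pick a i) ≡ (l i ≡ᵇ a)
    pick-just a i with l i ≡ᵇ a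
    ... | true  = refl
    ... | false = refl

    pick⇔ : ∀ a i → is-just (pick a i) ≡ true ⇔ l i ≡ a
    pick⇔ a i = mk⇔ (λ e → ℕ.≡ᵇ⇒≡ (l i) a (subst True (sym (trans (sym (pick-just a i)) e)) _))
                    (λ e → trans (pick-just a i) (to Bool.T-≡ (ℕ.≡⇒≡ᵇ (l i) a e)))

    module _ (some-body : ∃[ i ] l i ≡ 1) (some-head : ∃[ i ] l i ≡ 2) where

      -- With `onlyAtomAt` it realises a labelling that some tuple satisfies, with `exceptAtomAt` a
      -- rule that none does.
      labelledRule : Rule I
      labelledRule = record
        { body = pick 1
        ; head = pick 2
        ; body-nonempty = proj₁ some-body , from (∈-support (pick 1)) (from (pick⇔ 1 _) (proj₂ some-body))
        ; head-nonempty = proj₁ some-head , from (∈-support (pick 2)) (from (pick⇔ 2 _) (proj₂ some-head))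
        ; disjoint = λ { (i , m) → let p , q = x∈p∩q⁻ (support (pick 1)) (support (pick 2)) m in
            contradiction (trans (sym (to (pick⇔ 1 i) (to (∈-support (pick 1)) p))) (to (pick⇔ 2 i) (to (∈-support (pick 2)) q))) λ () }
        }

      labelledRule-atom : ∀ {i a} → body∧head labelledRule i ≡ just a → a ≡ atom i × ¬ l i ≡ 0
      labelledRule-atom {i} e with l i
      labelledRule-atom refl | suc zero       = refl , λ ()
      labelledRule-atom refl | suc (suc zero) = refl , λ ()

      labelledRule-size : (∀ i → l i < 3) → ruleSize labelledRule ≡ ∣ Vec.tabulate (λ i → not (l i ≡ᵇ 0)) ∣
      labelledRule-size l<3 = trans (ruleSize-∨ labelledRule) (cong ∣_∣ (Vec.tabulate-cong λ i →
        trans (cong₂ _∨_ (pick-just 1 i) (pick-just 2 i)) (used (l i) (l<3 i))))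
        where
        used : ∀ a → a < 3 → (a ≡ᵇ 1) ∨ (a ≡ᵇ 2) ≡ not (a ≡ᵇ 0)
        used 0 _ = refl
        used 1 _ = refl
        used 2 _ = refl
        used (suc (suc (suc _))) (s≤s (s≤s (s≤s ())))

      used⇔ : (∀ i → l i < 3) → ∀ i → is-just (body∧head labelledRule i) ≡ true ⇔ (¬ l i ≡ 0)
      used⇔ l<3 i with l i | l<3 i
      ... | 0 | _ = mk⇔ (λ ()) (λ h → contradiction refl h)
      ... | 1 | _ = mk⇔ (λ _ ()) (λ _ → refl)
      ... | 2 | _ = mk⇔ (λ _ ()) (λ _ → refl)
      ... | suc (suc (suc _)) | s≤s (s≤s (s≤s ()))

  module _ (ρ : Index) (k : ℕ) (s : ℚ) (0<s : 0ℚ ℚ.< s) (k≤n : k ≤ n) where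
    open Labelled nonnull (tuples T) k (numerator s) (denominator s)

    private
      c : Coefficients
      c = coefficients ρ

      rows≥1 : ∀ {x} → x ∈ tuples T → 1 ≤ length (tuples T)
      rows≥1 m with tuples T
      rows≥1 (here _)  | _ ∷ _ = s≤s z≤n
      rows≥1 (there _) | _ ∷ _ = s≤s z≤n

      vacuous-exists : ∀ {h} → Coefficients.vacuous c ≡ just h → Vacuous c (just h) → Vacuous c (Coefficients.vacuous c)
      vacuous-exists e = subst (Vacuous c) (sym e)

    module _ (R : Rule I) (nontrivial : ¬ Trivial T R) (large : k ≤ ruleSize R) (accepted : s ℚ.≤ indexValue ρ T R) where
      private
        l = labels R
        b = length (select T (body R))

        accepted′ : s ℚ.≤ indexAt ρ (length (select T (body∧head R))) b (length (tuples T))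
        accepted′ = subst (s ℚ.≤_) (indexValue-at ρ T R) accepted

        two-columns : 1 < n
        two-columns = distinct⇒1<n i j λ { refl → not-both R i bi hj }
          where
          i = proj₁ (body-nonempty R)
          j = proj₁ (head-nonempty R)
          bi = to (∈-support (body R)) (proj₂ (body-nonempty R))
          hj = to (∈-support (head R)) (proj₂ (head-nonempty R))
          distinct⇒1<n : ∀ {n} (i j : Fin n) → ¬ i ≡ j → 1 < n
          distinct⇒1<n {suc zero}    Fin.zero Fin.zero ne = contradiction refl ne
          distinct⇒1<n {suc (suc n)} i j ne = s≤s (s≤s z≤n)

      unsatisfied-rule : length (select T (body∧head R)) ≡ 0 → RuleExists c
      unsatisfied-rule e with nontrivial-rows R nontrivial
      ... | x , m with index-vacuous 0<s ρ b (length (tuples T)) (rows≥1 m) (subst (λ r → s ℚ.≤ indexAt ρ r b (length (tuples T))) e accepted′)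
      ...   | h , v , le = inj₂ (vacuous-exists v (le , two-columns , x , m))

      satisfied-rule : ∀ {t} → t ∈ tuples T → Satisfies I (body∧head R) t → RuleExists c
      satisfied-rule {t} mt sat = inj₁ (t , mt , l , labels<3 R , sat-rule , record
        { some-body = proj₁ (body-nonempty R) , from (labels-body R) (to (∈-support (body R)) (proj₂ (body-nonempty R)))
        ; some-head = proj₁ (head-nonempty R) , head-label (to (∈-support (head R)) (proj₂ (head-nonempty R)))
        ; usable    = usable
        ; large     = ℕ.≤-trans large (ℕ.≤-reflexive (labels-size R))
        ; accepted  = subst₂ (λ b r → AcceptsAt c s r b (length (tuples T))) body-count rule-count
            (to (index-accepts 0<s ρ (length (select T (body∧head R))) b (length (tuples T)) (length-filter≥1 (satisfies? I (body R)) mt sat-body) (rows≥1 mt)) accepted′)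
        })
        where
        sat-rule : SatRule l t
        sat-rule i ne = satisfied-columns {C = body∧head R} sat i (to (labels-used R) ne)
        sat-body : Satisfies I (body R) t
        sat-body i with body R i | sat i
        ... | nothing | _ = Maybe.nothing
        ... | just a  | p = p
        head-label : ∀ {i} → is-just (head R i) ≡ true → labels R i ≡ 2
        head-label {i} e with is-just (body R i) in eb | is-just (head R i) in eh
        ... | true  | true = contradiction (not-both R i eb eh) λ ()
        ... | false | true = refl
        usable : ∀ i → ¬ l i ≡ 0 → ∃[ x ] (x ∈ tuples T × nonnull x i ≡ false)
        -- Were the column nowhere null, every tuple would satisfy the atom that `t` satisfies, and
        -- the rule would be trivial.
        usable i ne with All.all? (λ x → nonnull x i Bool.≟ true) (tuples T)
        ... | yes all = contradiction (trivial (just-value (to (labels-used R) ne))) nontrivial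
          where
          trivial : ∃[ a ] body∧head R i ≡ just a → Trivial T R
          trivial (a , e) = i , a , e , ↭-reflexive (List.filter-all _ (All.tabulate λ {x} mx →
            satisfied-atom mt mx (atom-at e (sat i)) (All.lookup all mx)))
            where
            atom-at : ∀ {m} → m ≡ just a → Maybe.All (λ a → SatisfiesAtom (attribute I i) a (t i)) m → SatisfiesAtom (attribute I i) a (t i)
            atom-at refl (Maybe.just p) = p
        ... | no nall with find (All.¬All⇒Any¬ (λ x → nonnull x i Bool.≟ true) (tuples T) nall)
        ...   | x , mx , nx = x , mx , Bool.¬-not nx
        body-count : b ≡ bodyCount l
        body-count = length-filter-cong (satisfies? I (body R)) (satBody? l) (tuples T) λ {x} mx → mk⇔
          (λ h i e → satisfied-columns {C = body R} h i (to (labels-body R) e))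
          (λ h → condition-nonnull {C = body R} mt mx sat-body λ i e → h i (from (labels-body R) e))
        rule-count : length (select T (body∧head R)) ≡ ruleCount l
        rule-count = length-filter-cong (satisfies? I (body∧head R)) (satRule? l) (tuples T) λ {x} mx → mk⇔
          (λ h i e → satisfied-columns {C = body∧head R} h i (to (labels-used R) e))
          (λ h → condition-nonnull {C = body∧head R} mt mx sat λ i e → h i (from (labels-used R) e))

    hasRule⇒ : HasRule ρ T k s → RuleExists c
    hasRule⇒ (R , nt , lg , ac) with select T (body∧head R) in e
    ... | []    = unsatisfied-rule R nt lg ac (cong length e)
    ... | t ∷ _ with ∈-filter⁻ (satisfies? I (body∧head R)) {xs = tuples T} (subst (t ∈_) (sym e) (here refl))
    ...   | mt , sat = satisfied-rule R nt lg ac mt sat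

    candidate-rule : ∀ {x l} → x ∈ tuples T → (∀ i → l i < 3) → SatRule l x → Candidate c l → HasRule ρ T k s
    candidate-rule {x} {l} mx l<3 sat cand = R , nontrivial , large′ , accepted′
      where
      open Candidate cand
      R = labelledRule onlyAtomAt l some-body some-head
      nontrivial : ¬ Trivial T R
      nontrivial (i , a , e , perm) with labelledRule-atom onlyAtomAt l some-body some-head e
      ... | refl , ne with usable i ne
      ...   | y , my , null = contradiction (trans (sym (satisfies-nonnull {y} (proj₂ (∈-filter⁻ (λ t → satisfiesAtom? (attribute I i) (onlyAtomAt i) (t i)) {xs = tuples T} (∈-resp-↭ (↭-sym perm) my))))) null) λ ()
      large′ : k ≤ ruleSize R
      large′ = ℕ.≤-trans large (ℕ.≤-reflexive (sym (labelledRule-size onlyAtomAt l some-body some-head l<3)))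
      columns⇒ : ∀ {C : Condition I} → (∀ {i a} → C i ≡ just a → a ≡ onlyAtomAt i) → ∀ {y} → y ∈ tuples T →
                 (∀ i → is-just (C i) ≡ true → nonnull y i ≡ true) → Satisfies I C y
      columns⇒ {C} only {y} my h i with C i in e | h i
      ... | nothing | _  = Maybe.nothing
      ... | just a  | h′ with only e
      ...   | refl = Maybe.just (onlyAtomAt-satisfied my (h′ refl))
      only-body : ∀ {i a} → body R i ≡ just a → a ≡ onlyAtomAt i
      only-body {i} e with l i ≡ᵇ 1
      only-body refl | true = refl
      body⇔ : ∀ {y} → y ∈ tuples T → Satisfies I (body R) y ⇔ SatBody l y
      body⇔ my = mk⇔ (λ h i e → satisfied-columns {C = body R} h i (from (pick⇔ onlyAtomAt l 1 i) e))
                     (λ h → columns⇒ {C = body R} only-body my λ i e → h i (to (pick⇔ onlyAtomAt l 1 i) e))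
      rule⇔ : ∀ {y} → y ∈ tuples T → Satisfies I (body∧head R) y ⇔ SatRule l y
      rule⇔ my = mk⇔ (λ h i e → satisfied-columns {C = body∧head R} h i (from (used⇔ onlyAtomAt l some-body some-head l<3 i) e))
                     (λ h → columns⇒ {C = body∧head R} (proj₁ ∘ labelledRule-atom onlyAtomAt l some-body some-head) my
                              λ i e → h i (to (used⇔ onlyAtomAt l some-body some-head l<3 i) e))
      body-count : length (select T (body R)) ≡ bodyCount l
      body-count = length-filter-cong (satisfies? I (body R)) (satBody? l) (tuples T) body⇔
      rule-count : length (select T (body∧head R)) ≡ ruleCount l
      rule-count = length-filter-cong (satisfies? I (body∧head R)) (satRule? l) (tuples T) rule⇔
      accepted′ : s ℚ.≤ indexValue ρ T R
      accepted′ = subst (s ℚ.≤_) (sym (indexValue-at ρ T R))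
        (subst₂ (λ r b → s ℚ.≤ indexAt ρ r b (length (tuples T))) (sym rule-count) (sym body-count)
          (from (index-accepts 0<s ρ (ruleCount l) (bodyCount l) (length (tuples T))
            (length-filter≥1 (satBody? l) mx (λ i e → sat i λ z → contradiction (trans (sym z) e) λ ())) (rows≥1 mx)) accepted))

    -- The first column is the body and all others are the head, so the size of the rule is the
    -- number of columns and k cannot exceed it. Neither rule nor body is satisfied, which gives
    -- laplace its value 1 / h.
    vacuous-rule : ∀ {h} → Coefficients.vacuous c ≡ just h → Vacuous c (just h) → HasRule ρ T k s
    vacuous-rule {h} v (le , 1<n , x , mx) = R , nontrivial , large , accepted
      where
      l : Fin n → ℕ
      l i = if toℕ i ≡ᵇ 0 then 1 else 2
      l<3 : ∀ i → l i < 3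
      l<3 i with toℕ i ≡ᵇ 0
      ... | true  = s≤s (s≤s z≤n)
      ... | false = s≤s (s≤s (s≤s z≤n))
      at : ∀ {j} → j < n → ∃[ i ] toℕ {n} i ≡ j
      at j<n = fromℕ< j<n , Fin.toℕ-fromℕ< j<n
      some-body : ∃[ i ] l i ≡ 1
      some-body with at (ℕ.<-trans (s≤s z≤n) 1<n)
      ... | i , e = i , cong (λ j → if j ≡ᵇ 0 then 1 else 2) e
      some-head : ∃[ i ] l i ≡ 2
      some-head with at 1<n
      ... | i , e = i , cong (λ j → if j ≡ᵇ 0 then 1 else 2) e
      R = labelledRule exceptAtomAt l some-body some-head
      nontrivial : ¬ Trivial T R
      nontrivial (i , a , e , perm) with labelledRule-atom exceptAtomAt l some-body some-head e
      ... | refl , _ = exceptAtomAt-unsatisfied mx (proj₂ (∈-filter⁻ (λ t → satisfiesAtom? (attribute I i) (exceptAtomAt i) (t i)) {xs = tuples T} (∈-resp-↭ (↭-sym perm) mx)))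
      large : k ≤ ruleSize R
      large = ℕ.≤-trans k≤n (ℕ.≤-reflexive (sym (trans (labelledRule-size exceptAtomAt l some-body some-head l<3)
        (trans (cong (∣_∣ {n}) (Vec.tabulate-cong λ i → used (toℕ i ≡ᵇ 0))) (card-all n)))))
        where
        used : ∀ b → not ((if b then 1 else 2) ≡ᵇ 0) ≡ true
        used true  = refl
        used false = refl
      unsatisfied : ∀ {C : Condition I} i → C i ≡ just (exceptAtomAt i) → ∀ {y} → y ∈ tuples T → ¬ Satisfies I C y
      unsatisfied i e my sat with sat i
      ... | p rewrite e with p
      ...   | Maybe.just q = exceptAtomAt-unsatisfied my q
      body-at : body R (proj₁ some-body) ≡ just (exceptAtomAt (proj₁ some-body))
      body-at rewrite proj₂ some-body = refl
      accepted : s ℚ.≤ indexValue ρ T R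
      accepted = subst (s ℚ.≤_) (sym (indexValue-at ρ T R))
        (subst₂ (λ r b → s ℚ.≤ indexAt ρ r b (length (tuples T)))
          (sym (length-filter≡0 (satisfies? I (body∧head R)) (tuples T) (unsatisfied {C = body∧head R} (proj₁ some-body) (in-body R body-at))))
          (sym (length-filter≡0 (satisfies? I (body R)) (tuples T) (unsatisfied {C = body R} (proj₁ some-body) body-at)))
          (vacuous-index 0<s ρ (length (tuples T)) v le))

    hasRule⇐ : RuleExists c → HasRule ρ T k s
    hasRule⇐ (inj₁ (x , mx , l , l<3 , sat , cand)) = candidate-rule mx l<3 sat cand
    hasRule⇐ (inj₂ v) with Coefficients.vacuous c in e
    ... | just h = vacuous-rule e v

    hasRule⇔ : RuleExists c ⇔ HasRule ρ T k s
    hasRule⇔ = mk⇔ hasRule⇐ hasRule⇒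

-- The encoded instance

-- `slash` is itself a plain symbol, so that a numeral does not contain it cannot come from
-- `plain-lacks`.
bits-lack : ∀ {s} bs → 2 ≤ code s → Lacks s (map bit bs)
bits-lack {s} []           h = []
bits-lack {s} (false ∷ bs) h = ≡ᵇ-false {code s} {0} (λ e → ℕ.<⇒≱ (s≤s z≤n) (subst (2 ≤_) e h)) ∷ bits-lack bs h
bits-lack {s} (true ∷ bs)  h = ≡ᵇ-false {code s} {1} (λ e → ℕ.<⇒≱ (s≤s (s≤s z≤n)) (subst (2 ≤_) e h)) ∷ bits-lack bs h

length-blocks : ∀ {X A : Set} (lead : A) (f : X → List A) xs → length xs ≤ length (concatMap (λ x → lead ∷ f x) xs)
length-blocks lead f []       = z≤n
length-blocks lead f (x ∷ xs) = s≤s (ℕ.≤-trans (length-blocks lead f xs)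
  (ℕ.≤-trans (ℕ.m≤n+m _ (length (f x))) (ℕ.≤-reflexive (sym (List.length-++ (f x))))))

module Encoding (D : Database) (bool : Boolean D) (k : ℕ) (s : ℚ) (0<s : 0ℚ ℚ.< s) where

  I : AttributeSet
  I = attributes D

  n : ℕ
  n = size I

  nonnull : Tuple I → Fin n → Bool
  nonnull = Rules.nonnull D bool

  attributeRest : Fin n → List Symbol
  attributeRest i = map bit (name (attribute I i)) ++ encodeKind (kind (attribute I i)) ∷ encodeValue (kind (attribute I i)) (proj₁ (bool i))

  columnBlocks rowBlocks thresholdField sizeField w : List Symbol
  columnBlocks = concatMap (λ i → attr# ∷ attributeRest i) (allFin n)
  rowBlocks = concatMap (λ t → row# ∷ tupleRest I t) (tuples D)
  thresholdField = threshold# ∷ encodeℚ s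
  sizeField = size# ∷ encodeℕ k ++ thresholdField
  w = encodeDatabase D bool ++ sizeField

  w-blocks : w ≡ columnBlocks ++ (rowBlocks ++ sizeField)
  w-blocks = trans (List.++-assoc columnBlocks (concatMap (encodeTuple I) (tuples D)) sizeField)
    (cong (λ l → columnBlocks ++ (List.concat l ++ sizeField)) (List.map-cong (encodeTuple-rest I) (tuples D)))

  attributeRest-lacks : ∀ {s} → 5 ≤ code s → is s (letter cat#) ≡ false → is s (letter num#) ≡ false → ∀ i → Lacks s (attributeRest i)
  attributeRest-lacks {s} h c m i = All.++⁺ (plain-lacks {s} h (plain-bits (name (attribute I i))))
    (kind-lacks (kind (attribute I i)) ∷ plain-lacks {s} h (plain-value (kind (attribute I i)) (proj₁ (bool i))))
    where
    kind-lacks : ∀ k → is s (letter (encodeKind k)) ≡ false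
    kind-lacks categorical = c
    kind-lacks numeric     = m

  columns-lack : ∀ {s} → 5 ≤ code s → is s (letter cat#) ≡ false → is s (letter num#) ≡ false → is s (letter attr#) ≡ false → Lacks s columnBlocks
  columns-lack {s} h c m a = lacks-concatMap {s = s} (λ i → attr# ∷ attributeRest i) (λ i → a ∷ attributeRest-lacks {s} h c m i) (allFin n)

  rows-lack : ∀ {s} → 5 ≤ code s → is s (letter cell#) ≡ false → is s (letter null#) ≡ false → is s (letter row#) ≡ false → Lacks s rowBlocks
  rows-lack {s} h c m r = lacks-concatMap {s = s} (λ t → row# ∷ tupleRest I t) (λ t → r ∷ tupleRest-lacks {s} I t h c m) (tuples D)

  fields-lack : ∀ {s} → 5 ≤ code s → is s (letter size#) ≡ false → is s (letter threshold#) ≡ false → Lacks s sizeField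
  fields-lack {x} h e e′ = e ∷ All.++⁺ (plain-lacks {x} h (plain-ℕ k)) (e′ ∷ plain-lacks {x} h (plain-ℚ s))

  encodeℚ-positive : encodeℚ s ≡ plus ∷ encodeℕ (numerator s) ++ slash ∷ encodeℕ (denominator s)
  encodeℚ-positive = cong (λ i → encodeℤ i ++ slash ∷ encodeℕ (↧ₙ s)) (proj₁ (positive-numerator {s} 0<s))

  module _ (Z : ℕ) (w≤Z : suc (length w) ≤ Z) where
    open Correctness (symbolAt w) Z
    open Positions w Z w≤Z
    open Arithmetic (symbolAt w) Z

    private
      module Columns = Blocks w (is attr#) attr# refl attributeRest (attributeRest-lacks {attr#} (ℕ.m≤m+n 5 0) refl refl) (λ _ → ⊤) (λ _ → tt)
      module Rows = Blocks w (is row#) row# refl (tupleRest I) (λ t → tupleRest-lacks {row#} I t (ℕ.m≤m+n 5 3) refl refl) NotNull (λ _ → refl)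

      all-suffix : Suffix w 1 (columnBlocks ++ (rowBlocks ++ sizeField))
      all-suffix = subst (Suffix w 1) w-blocks start

      rows-suffix : Suffix w (length columnBlocks + 1) (rowBlocks ++ sizeField)
      rows-suffix = suffix-++ columnBlocks all-suffix

      places : List ℕ
      places = Rows.positions (tuples D) (length columnBlocks + 1)

      columns : ∀ {m} (ρ : Vec ℕ m) → ⟦ ncolsF ⟧ ρ ≡ n
      columns ρ = begin
        ⟦ ncolsF ⟧ ρ                                            ≡⟨ countF-value {ρ = ρ} {b = lim} {read (is attr#) v₀} ℕ.≤-refl ⟩
        count Z (λ p → 𝟙 (is attr# (symbolAt w p)) ≡ᵇ 1)        ≡⟨ count-cong Z (λ {p} _ → trans (𝟙≡ᵇ1 (is attr# (symbolAt w p))) (sym (Bool.∧-identityʳ _))) ⟩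
        count Z (λ p → is attr# (symbolAt w p) ∧ true)          ≡⟨ Columns.count-all (λ _ → true) {[]} {allFin n} {rowBlocks ++ sizeField} w-blocks []
                                                                     (All.++⁺ (rows-lack {attr#} (ℕ.m≤m+n 5 0) refl refl refl) (fields-lack {attr#} (ℕ.m≤m+n 5 0) refl refl)) refl refl w≤Z ⟩
        countIn (λ _ → true) (Columns.positions (allFin n) 1)   ≡⟨ count-positions (allFin n) 1 ⟩
        length (allFin n)                                       ≡⟨ List.length-tabulate id ⟩
        n                                                       ∎
        where
        open ≡-Reasoning
        count-positions : ∀ xs p → countIn (λ _ → true) (Columns.positions xs p) ≡ length xs
        count-positions []       p = refl
        count-positions (x ∷ xs) p = cong suc (count-positions xs _)

      w-length : length w ≡ length columnBlocks + (length rowBlocks + length sizeField)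
      w-length = trans (cong length w-blocks) (trans (List.length-++ columnBlocks) (cong (length columnBlocks +_) (List.length-++ rowBlocks)))

      n≤w : n ≤ length w
      n≤w = ℕ.≤-trans (ℕ.≤-reflexive (sym (List.length-tabulate {n = n} id)))
        (ℕ.≤-trans (length-blocks attr# attributeRest (allFin n)) (ℕ.≤-trans (ℕ.m≤m+n _ _) (ℕ.≤-reflexive (sym w-length))))

      rows≤w : length (tuples D) ≤ length w
      rows≤w = ℕ.≤-trans (length-blocks row# (tupleRest I) (tuples D))
        (ℕ.≤-trans (ℕ.m≤m+n _ (length sizeField)) (ℕ.≤-trans (ℕ.m≤n+m _ (length columnBlocks)) (ℕ.≤-reflexive (sym w-length))))

      row-at : ∀ {t p} → Rows.At t p → RowAt (nonnull t) p
      row-at {t} (v , g , h) i = nonnull-value w Z w≤Z I t i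
        (ℕ.≤-trans (Fin.toℕ<n i) (ℕ.≤-trans n≤w (ℕ.≤-trans (ℕ.n≤1+n _) w≤Z))) g h

      regroup : ∀ u {v x} → Suffix w 1 (u ++ (v ++ x)) → Suffix w 1 ((u ++ v) ++ x)
      regroup u {v} {x} = subst (Suffix w 1) (sym (List.++-assoc u v x))

      size-suffix : Suffix w (⟦ sizeAt ⟧ []) (encodeℕ k ++ thresholdField)
      size-suffix = find-suffix size# (columnBlocks ++ rowBlocks) (regroup columnBlocks all-suffix)
        (All.++⁺ (columns-lack {size#} (ℕ.m≤m+n 5 6) refl refl refl) (rows-lack {size#} (ℕ.m≤m+n 5 6) refl refl refl))

      threshold-suffix : Suffix w (⟦ thresholdAt ⟧ []) (plus ∷ encodeℕ (numerator s) ++ slash ∷ encodeℕ (denominator s))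
      threshold-suffix = subst (Suffix w _) encodeℚ-positive
        (find-suffix threshold# ((columnBlocks ++ rowBlocks) ++ (size# ∷ encodeℕ k)) (regroup (columnBlocks ++ rowBlocks) (regroup columnBlocks all-suffix))
          (All.++⁺ (All.++⁺ (columns-lack {threshold#} (ℕ.m≤m+n 5 7) refl refl refl) (rows-lack {threshold#} (ℕ.m≤m+n 5 7) refl refl refl))
                   (refl ∷ plain-lacks {threshold#} (ℕ.m≤m+n 5 7) (plain-ℕ k))))

      number-at : ∀ m {p v} → Suffix w p (encodeℕ m ++ v) → isBit (headD v) ≡ false → ∃[ bs ] (Bits p bs × fromBits bs ≡ m)
      number-at m {p} {v} h e with binary m
      ... | bs , eq , val = bs , bits-from bs (subst (λ l → Suffix w p (l ++ v)) eq h) e , val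

      denominator-suffix : Suffix w (⟦ denominatorAt ⟧ []) (encodeℕ (denominator s))
      denominator-suffix = find-suffix slash (plus ∷ encodeℕ (numerator s)) threshold-suffix
        (refl ∷ subst (Lacks slash) (sym (proj₁ (proj₂ (binary (numerator s))))) (bits-lack {slash} (proj₁ (binary (numerator s))) (s≤s (s≤s z≤n))))

      k-number = number-at k size-suffix refl
      num-number = number-at (numerator s) (next threshold-suffix) refl
      den-number = number-at (denominator s) (subst (Suffix w _) (sym (List.++-identityʳ _)) denominator-suffix) refl

    layout : Layout nonnull (tuples D) k (numerator s) (denominator s)
    layout = record
      { columns    = columns
      ; places     = places
      ; rows-at    = Pointwise.map row-at (Rows.at-positions (tuples D) refl rows-suffix)
      ; count-rows = λ φ → Rows.count-all φ {columnBlocks} {tuples D} {sizeField} w-blocks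
          (columns-lack {row#} (ℕ.m≤m+n 5 3) refl refl refl) (fields-lack {row#} (ℕ.m≤m+n 5 3) refl refl) refl refl w≤Z
      ; k-bits     = proj₁ k-number
      ; num-bits   = proj₁ num-number
      ; den-bits   = proj₁ den-number
      ; k-at       = proj₁ (proj₂ k-number)
      ; num-at     = proj₁ (proj₂ num-number)
      ; den-at     = proj₁ (proj₂ den-number)
      ; k-value    = proj₂ (proj₂ k-number)
      ; num-value  = proj₂ (proj₂ num-number)
      ; den-value  = proj₂ (proj₂ den-number)
      ; N          = suc (length w)
      ; 1≤N        = s≤s z≤n
      ; n≤N        = ℕ.≤-trans n≤w (ℕ.n≤1+n _)
      ; rows≤N     = ℕ.≤-trans rows≤w (ℕ.n≤1+n _)
      }

  n<|w| : n < suc (length w)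
  n<|w| = s≤s (ℕ.≤-trans (ℕ.≤-reflexive (sym (List.length-tabulate {n = n} id)))
    (ℕ.≤-trans (length-blocks attr# attributeRest (allFin n)) (ℕ.≤-trans (ℕ.m≤m+n _ _)
      (ℕ.≤-reflexive (sym (trans (cong length w-blocks) (List.length-++ columnBlocks)))))))

  2≤|w| : 2 ≤ suc (length w)
  2≤|w| = s≤s (ℕ.≤-trans (s≤s z≤n) (ℕ.≤-trans (ℕ.m≤n+m (length sizeField) (length (encodeDatabase D bool))) (ℕ.≤-reflexive (sym (List.length-++ (encodeDatabase D bool))))))

-- The exponent of the limit

n<2^n : ∀ n → n < 2 ^ n
n<2^n zero    = s≤s z≤n
n<2^n (suc n) = ℕ.≤-trans (s≤s (n<2^n n)) (ℕ.+-mono-≤ (ℕ.m^n>0 2 n) (ℕ.≤-reflexive (sym (ℕ.+-identityʳ _))))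

module _ {N : ℕ} (2≤N : 2 ≤ N) where
  private
    instance
      N≢0 : ℕ.NonZero N
      N≢0 = ℕ.>-nonZero (ℕ.≤-trans (s≤s z≤n) 2≤N)

    doubled : ∀ {a e} → a ≤ N ^ e → a + a ≤ N ^ suc e
    doubled {a} {e} h = ℕ.≤-trans (ℕ.≤-reflexive (cong (a +_) (sym (ℕ.+-identityʳ a)))) (ℕ.*-mono-≤ 2≤N h)

  -- The constant c is below 2 ^ c ≤ N ^ c. Of the three further factors one is N itself, one pays
  -- for the doubling and one for the successor.
  weighted≤ : ∀ c → suc (c * N + c * N) ≤ N ^ (3 + c)
  weighted≤ c = ℕ.≤-trans (ℕ.+-mono-≤ (ℕ.m^n>0 N (2 + c)) (doubled {e = 1 + c} (ℕ.≤-trans (ℕ.≤-reflexive (ℕ.*-comm c N)) (ℕ.*-monoʳ-≤ N c≤))))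
    (ℕ.≤-trans (ℕ.≤-reflexive (cong (N ^ (2 + c) +_) (sym (ℕ.+-identityʳ _)))) (ℕ.*-monoˡ-≤ (N ^ (2 + c)) 2≤N))
    where
    c≤ : c ≤ N ^ c
    c≤ = ℕ.≤-trans (ℕ.<⇒≤ (n<2^n c)) (ℕ.^-monoˡ-≤ c 2≤N)

  -- 3 ^ t is at most 4 ^ t, the square of (2 ^ l) ^ c times 2 ^ n₀; the first factor is at most N ^
  -- c, and N ≥ 2 absorbs the constant in N ^ n₀.
  3^≤ : ∀ c n₀ {t l} → t ≤ c * l + n₀ → 2 ^ l ≤ N → 3 ^ t ≤ N ^ (2 * (c + n₀))
  3^≤ c n₀ {t} {l} t≤ 2^l≤N = begin
    3 ^ t                             ≤⟨ ℕ.^-monoˡ-≤ t (ℕ.n≤1+n 3) ⟩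
    (2 ^ 2) ^ t                       ≡⟨ ℕ.^-*-assoc 2 2 t ⟩
    2 ^ (2 * t)                       ≤⟨ ℕ.^-monoʳ-≤ 2 (ℕ.*-monoʳ-≤ 2 t≤) ⟩
    2 ^ (2 * (c * l + n₀))            ≡⟨ trans (cong (2 ^_) (ℕ.*-comm 2 (c * l + n₀))) (sym (ℕ.^-*-assoc 2 (c * l + n₀) 2)) ⟩
    (2 ^ (c * l + n₀)) ^ 2            ≤⟨ ℕ.^-monoˡ-≤ 2 (begin
      2 ^ (c * l + n₀)                  ≡⟨ ℕ.^-distribˡ-+-* 2 (c * l) n₀ ⟩
      2 ^ (c * l) * 2 ^ n₀              ≡⟨ cong (_* 2 ^ n₀) (trans (cong (2 ^_) (ℕ.*-comm c l)) (sym (ℕ.^-*-assoc 2 l c))) ⟩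
      (2 ^ l) ^ c * 2 ^ n₀              ≤⟨ ℕ.*-mono-≤ (ℕ.^-monoˡ-≤ c 2^l≤N) (ℕ.^-monoˡ-≤ n₀ 2≤N) ⟩
      N ^ c * N ^ n₀                    ≡⟨ sym (ℕ.^-distribˡ-+-* N c n₀) ⟩
      N ^ (c + n₀)                      ∎) ⟩
    (N ^ (c + n₀)) ^ 2                ≡⟨ trans (ℕ.^-*-assoc N (c + n₀) 2) (cong (N ^_) (ℕ.*-comm (c + n₀) 2)) ⟩
    N ^ (2 * (c + n₀))                ∎
    where open ℕ.≤-Reasoning

-- Sparseness speaks only of databases with at least n₀ columns; with fewer, a tuple has fewer than
-- n₀ values, whence the added constant.
tupleSize≤ : ∀ {ℓ} {S : Pred Database ℓ} ((c , n₀ , sparse) : Sparse S) {D} → S D → ∀ {t} → t ∈ tuples D →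
             tupleSize (attributes D) t ≤ c * ⌊log₂ size (attributes D) ⌋ + n₀
tupleSize≤ (c , n₀ , sparse) {D} D∈S {t} m with n₀ ℕ.≤? size (attributes D)
... | yes p = ℕ.≤-trans (All.lookup (xs≤max 0 (map (tupleSize (attributes D)) (tuples D))) (∈-map⁺ (tupleSize (attributes D)) m))
                (ℕ.≤-trans (sparse (D , D∈S) p) (ℕ.m≤m+n _ n₀))
... | no ¬p = ℕ.≤-trans (∣p∣≤n (support t)) (ℕ.≤-trans (ℕ.<⇒≤ (ℕ.≰⇒> ¬p)) (ℕ.m≤n+m n₀ _))

theorem4p2 : ∀ {ℓ : Level} (S : Pred Database ℓ) (boolean : S ⊆ Boolean) →
    Sparse S → (ρ : Index) → InL (ruleProblem S boolean ρ)
theorem4p2 S boolean sparse@(c , n₀ , _) ρ = inL (ruleProblem S boolean ρ) (ruleExistsF (coefficients ρ)) d correct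
  where
  open Coefficients (coefficients ρ) using (weight)
  open DecisionProblem (ruleProblem S boolean ρ)
  d : ℕ
  -- The first summand makes room for the comparisons (`weighted≤`), the second for the codes of
  -- labellings (`3^≤`).
  d = (3 + weight) + 2 * (c + n₀)
  correct : ∀ x → Semantics.Holds (symbolAt (encode x)) (suc (length (encode x)) ^ d) (ruleExistsF (coefficients ρ)) [] ⇔ Yes x
  correct x = Rules.hasRule⇔ X.T (boolean X.T∈S) ρ X.k X.s X.0<s X.k≤I ⇔-∘
    Correctness.holds-ruleExists (symbolAt w) Z (layout Z w≤Z) (coefficients ρ) K≤Z 3^≤Z
    where
    module X = Input x
    open Encoding X.T (boolean X.T∈S) X.k X.s X.0<s
    N Z : ℕ
    N = suc (length w)
    Z = N ^ d
    ≤Z : ∀ {e} → e ≤ d → N ^ e ≤ Z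
    ≤Z = ℕ.^-monoʳ-≤ N
    w≤Z : N ≤ Z
    w≤Z = ℕ.≤-trans (ℕ.≤-reflexive (sym (ℕ.*-identityʳ N))) (≤Z {1} (s≤s z≤n))
    K≤Z : suc (weight * N + weight * N) ≤ Z
    K≤Z = ℕ.≤-trans (weighted≤ 2≤|w| weight) (≤Z (ℕ.m≤m+n (3 + weight) _))
    3^≤Z : ∀ {t} → t ∈ tuples X.T → 3 ^ ∣ Vec.tabulate (nonnull t) ∣ ≤ Z
    3^≤Z m = ℕ.≤-trans
      (3^≤ 2≤|w| c n₀ (tupleSize≤ {S = S} sparse X.T∈S m)
        -- From 1 ≤ k ≤ |I| there is at least one column, without which 2 to the logarithm would
        -- exceed |I|.
        (ℕ.≤-trans (2^⌊log₂n⌋≤n n (ℕ.≤-trans X.1≤k X.k≤I)) (ℕ.<⇒≤ n<|w|)))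
      (≤Z (ℕ.m≤n+m (2 * (c + n₀)) (3 + weight)))
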